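{- Let $q>1$ be real. For a partition $\lambda$ define $J_\lambda(q)=\frac{q^{|\lambda|^2-|\lambda|-2n(\lambda)}\left[(\frac1q)_{|\lambda|}\right]^2}{\prod_{s\in\lambda}(1-q^{ -h(s)})^2}$, and let $J_0(q)=1$ and $J_n(q)=\sum_{|\lambda|=n}J_\lambda(q)$. Then: (1) $J_n(q)$ is a polynomial in $q$ of degree $2\binom n2$ with non-negative integer coefficients, which is palindromic, i.e. $J_n(q)=q^{2\binom n2}J_n(1/q)$, and satisfies $J_n(1)=n!$. (2) $\frac{J_n(q)}{q^{n^2}(1-\frac1q)^2\cdots(1-\frac1{q^n})^2}=[u^n]\frac{1}{\prod_{r=1}^\infty\prod_{s=0}^\infty(1-\frac{u}{q^{r+s}})}$.
   Context: $(x)_N=(1-x)(1-\frac xq)\cdots(1-\frac{x}{q^{N-1}})$, so $(\frac1q)_n=\prod_{k=1}^n(1-q^{ -k})$. $n(\lambda)=\sum_i(i-1)\lambda_i$. For a box $s$ of $\lambda$, $h(s)=a(s)+l(s)+1$ is its hook length, $a(s)$ and $l(s)$ being the numbers of boxes of $\lambda$ strictly to its right and strictly below it. $[u^n]f(u)$ denotes the coefficient of $u^n$ in the power series $f(u)$.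
   Formalization: The number q > 1 is taken rational instead of real; the coefficient of u^n in the infinite product is expressed as its convergent series in powers of 1/q. -}

module Defs where

open import Data.Bool using (Bool; true; false; _∧_)
open import Data.Nat as ℕ using (ℕ; zero; suc; _∸_; _≤ᵇ_; _<ᵇ_; _≡ᵇ_)
open import Data.Integer as ℤ using (ℤ; +_; -[1+_])
open import Data.List using (List; []; _∷_; map; concatMap; upTo; filterᵇ; length; foldr)
open import Data.Rational using (ℚ; 0ℚ; 1ℚ; _+_; _*_; _-_; _÷_; ∣_∣; _<_; _≟_; ≢-nonZero)
open import Data.Product using (∃)
open import Relation.Nullary using (yes; no)

fromℕ : ℕ → ℚ
fromℕ n = ℤ.+ n Data.Rational./ 1

_^ℚ_ : ℚ → ℕ → ℚ
q ^ℚ zero  = 1ℚ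
q ^ℚ suc k = q * (q ^ℚ k)

-- total division (x / 0 := 0); only ever applied to nonzero divisors
-- when q > 1 (all denominators below are then nonzero)
_÷₀_ : ℚ → ℚ → ℚ
x ÷₀ y with y ≟ 0ℚ
... | yes _ = 0ℚ
... | no y≢0 = _÷_ x y {{≢-nonZero y≢0}}

_^ℤ_ : ℚ → ℤ → ℚ
q ^ℤ (+ n)     = q ^ℚ n
q ^ℤ -[1+ n ]  = 1ℚ ÷₀ (q ^ℚ suc n)

prodQ : List ℚ → ℚ
prodQ = foldr _*_ 1ℚ

sumQ : List ℚ → ℚ
sumQ = foldr _+_ 0ℚ

sumℕ : List ℕ → ℕ
sumℕ = foldr ℕ._+_ 0

allPos : List ℕ → Bool
allPos []       = true
allPos (x ∷ xs) = (1 ≤ᵇ x) ∧ allPos xs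

nonIncr : List ℕ → Bool
nonIncr []           = true
nonIncr (x ∷ [])     = true
nonIncr (x ∷ y ∷ xs) = (y ≤ᵇ x) ∧ nonIncr (y ∷ xs)

isPartitionOf : ℕ → List ℕ → Bool
isPartitionOf n λs = (sumℕ λs ≡ᵇ n) ∧ (allPos λs ∧ nonIncr λs)

listsOf : ℕ → ℕ → List (List ℕ)
listsOf zero    m = [] ∷ []
listsOf (suc k) m = concatMap (λ x → map (x ∷_) (listsOf k m)) (upTo (suc m))

partitions : ℕ → List (List ℕ)
partitions n =
  filterᵇ (isPartitionOf n) (concatMap (λ k → listsOf k n) (upTo (suc n)))

size : List ℕ → ℕ
size = sumℕ

nλ : List ℕ → ℕ
nλ = go 0
  where
  go : ℕ → List ℕ → ℕ
  go i []       = 0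
  go i (x ∷ xs) = i ℕ.* x ℕ.+ go (suc i) xs

countGt : ℕ → List ℕ → ℕ
countGt j xs = length (filterᵇ (j <ᵇ_) xs)

-- list of hook lengths of all boxes of λ.  The box in row i, column j
-- (0-indexed, j < λ_i) has arm a = λ_i - j - 1 and leg l = #{k > i : λ_k > j},
-- so h = a + l + 1 = (λ_i - j) + l.
hooks : List ℕ → List ℕ
hooks []           = []
hooks (row ∷ rest) =
  map (λ j → (row ∸ j) ℕ.+ countGt j rest) (upTo row) Data.List.++ hooks rest

poch : ℚ → ℕ → ℚ
poch q N = prodQ (map (λ k → 1ℚ - (1ℚ ÷₀ (q ^ℚ suc k))) (upTo N))

sq : ℚ → ℚ
sq x = x * x

expo : List ℕ → ℤ
expo λs = (ℤ.+ (size λs ℕ.* size λs)) ℤ.- (ℤ.+ size λs) ℤ.- (ℤ.+ (2 ℕ.* nλ λs))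

Jλ : List ℕ → ℚ → ℚ
Jλ λs q =
  ((q ^ℤ expo λs) * sq (poch q (size λs)))
    ÷₀ prodQ (map (λ h → sq (1ℚ - (1ℚ ÷₀ (q ^ℚ h)))) (hooks λs))

J : ℕ → ℚ → ℚ
J zero    q = 1ℚ
J (suc n) q = sumQ (map (λ λs → Jλ λs q) (partitions (suc n)))

evalPoly : List ℕ → ℚ → ℚ
evalPoly []       q = 0ℚ
evalPoly (c ∷ cs) q = fromℕ c + q * evalPoly cs q

-- Coefficients of  1 / ∏_{r≥1} ∏_{s≥0} (1 - u x^{r+s})   (x = 1/q).
-- Expanding each factor as Σ_k u^k x^{k(r+s)}, the coefficient of u^n x^N
-- is the number of choices of multiplicities k_{r,s} ≥ 0 with
-- Σ k_{r,s} = n and Σ k_{r,s}(r+s) = N.  Factors with r+s > N can only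
-- contribute k = 0 to the coefficient of x^N, so only pairs with r+s ≤ N
-- need to be listed.

ways : List ℕ → ℕ → ℕ → ℕ
ways []       zero    zero    = 1
ways []       _       _       = 0
ways (w ∷ ws) n N =
  sumℕ (map (λ k → if (k ℕ.* w ≤ᵇ N) then ways ws (n ∸ k) (N ∸ (k ℕ.* w)) else 0)
            (upTo (suc n)))
  where
  open import Data.Bool using (if_then_else_)

pairWeights : ℕ → List ℕ
pairWeights N = concatMap (λ r → map (λ s → suc r ℕ.+ s) (upTo (N ∸ r))) (upTo N)

coef : ℕ → ℕ → ℕ
coef n N = ways (pairWeights N) n N

partialSum : (ℕ → ℚ) → ℕ → ℚ
partialSum a M = sumQ (map a (upTo M))

SeriesSum : (ℕ → ℚ) → ℚ → Set
SeriesSum a L = ∀ (ε : ℚ) → 0ℚ < ε →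
  ∃ λ M₀ → ∀ M → M₀ ℕ.≤ M → ∣ L - partialSum a M ∣ < ε

{-# OPTIONS --safe #-}
module Submission where

-- Put x = 1/q and g κ = x^(n(κ)) / ∏ (1 − x^h) over the hooks of κ, the Schur
-- function s_κ(1, x, x², …); then J_n = q^(n²) xⁿ (x)_n² Σ g². Two rules for g
-- suffice: branching, g κ = Σ x^|ν| g ν over the ν with κ/ν a horizontal strip,
-- and Pieri, Σ g κ = g μ / (x)_k over the κ with κ/μ a horizontal strip of size k.
-- For branching, g is a Vandermonde product in the powers x^l of the beta-numbers;
-- as a determinant it is a mixed difference of another such product, and the sum
-- telescopes. Pieri follows from branching by Fomin's local rule. Together they
-- give, for H_n = Σ g² over the partitions of n, the generating function identity
-- H(u) = h(u) H(xu) with h(u) = Σ uⁿ/(x)_n = ∏ 1/(1 − u x^s), whose iteration is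
-- the product of part (2). On the other side Σ x^(inv π + maj π) over S_n, divided
-- by (x)_n², satisfies the same recursion; this polynomial visibly has non-negative
-- coefficients and value n! at 1, and complementing letters makes it palindromic.

-- The Vandermonde argument yields branching only, so Pieri has to be forced out of it. In the sum
-- of g κ over the κ above μ, branching expands each g κ, and the local rule replaces common upper
-- neighbours by common lower ones; the sum for (μ, k) becomes a combination of the sums for (κ, j)
-- with κ below μ and j at most k. The expected value h_k g μ obeys the same recursion, so the
-- difference obeys it too. In it the pair (μ, k) returns with coefficient x^(|μ|+k), which differs
-- from 1 unless μ is empty and k = 0. The statistic inv + maj has this origin: (x)_n g κ is the
-- generating function of maj over the standard tableaux of shape κ, so Robinson-Schensted turns
-- (x)_n² H_n into the sum of x^(maj π + maj π⁻¹), and the pair (maj, inv) is distributed like (maj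
-- π, maj π⁻¹). Inversions are the better choice because the effect of deleting the last letter can
-- be read off from the last two letters, which gives a recursion on coefficient lists.

module Base where

  open import Defs using (_^ℚ_)
  open import Data.Bool using (Bool; true; false; _∧_; T)
  open import Data.Nat as ℕ using (ℕ; zero; suc; z≤n; s≤s; _≤ᵇ_)
  import Data.Nat.Properties as ℕ
  open import Data.Rational using (ℚ; 0ℚ; 1ℚ; _+_; _*_; _-_; -_)
  open import Data.Rational.Properties using (+-*-commutativeRing; _≟_; +-assoc; +-identityʳ; +-identityˡ; *-zeroˡ; *-zeroʳ; *-identityˡ; *-assoc; +-comm; *-distribˡ-+)
  open import Data.Product using (_,_)
  open import Data.Sum using (inj₁; inj₂)
  open import Data.Unit using (tt)
  open import Relation.Binary.PropositionalEquality
  open import Relation.Nullary.Decidable using (dec⇒maybe)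
  open import Tactic.RingSolver using (solve-∀)
  open import Tactic.RingSolver.Core.AlmostCommutativeRing using (AlmostCommutativeRing; fromCommutativeRing)
  open import Function using (_∘_)
  open ≡-Reasoning

  -- Powers, finite sums and Boolean indicators over the rationals.

  ℚ-ring : AlmostCommutativeRing _ _
  ℚ-ring = fromCommutativeRing +-*-commutativeRing (λ x → dec⇒maybe (0ℚ ≟ x))

  *-zeroʳ′ : ∀ p {q} → q ≡ 0ℚ → p * q ≡ 0ℚ
  *-zeroʳ′ p refl = *-zeroʳ p

  *-zeroˡ′ : ∀ {p} q → p ≡ 0ℚ → p * q ≡ 0ℚ
  *-zeroˡ′ q refl = *-zeroˡ q

  ^ℚ-+ : ∀ x m n → x ^ℚ (m ℕ.+ n) ≡ (x ^ℚ m) * (x ^ℚ n)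
  ^ℚ-+ x zero    n = sym (*-identityˡ _)
  ^ℚ-+ x (suc m) n = trans (cong (x *_) (^ℚ-+ x m n)) (sym (*-assoc x _ _))

  ^ℚ-* : ∀ x m n → x ^ℚ (n ℕ.* m) ≡ (x ^ℚ m) ^ℚ n
  ^ℚ-* x m zero    = refl
  ^ℚ-* x m (suc n) = trans (^ℚ-+ x m (n ℕ.* m)) (cong ((x ^ℚ m) *_) (^ℚ-* x m n))

  1^ℚ : ∀ n → 1ℚ ^ℚ n ≡ 1ℚ
  1^ℚ zero    = refl
  1^ℚ (suc n) = trans (*-identityˡ _) (1^ℚ n)

  Σ< : ℕ → (ℕ → ℚ) → ℚ
  Σ< zero    f = 0ℚ
  Σ< (suc n) f = f 0 + Σ< n (f ∘ suc)

  Σ<-cong : ∀ n {f g : ℕ → ℚ} → (∀ i → i ℕ.< n → f i ≡ g i) → Σ< n f ≡ Σ< n g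
  Σ<-cong zero    e = refl
  Σ<-cong (suc n) e = cong₂ _+_ (e 0 (s≤s z≤n)) (Σ<-cong n (λ i i<n → e (suc i) (s≤s i<n)))

  Σ<-ext : ∀ n {f g : ℕ → ℚ} → (∀ i → f i ≡ g i) → Σ< n f ≡ Σ< n g
  Σ<-ext n e = Σ<-cong n (λ i _ → e i)

  Σ<-0 : ∀ n → Σ< n (λ _ → 0ℚ) ≡ 0ℚ
  Σ<-0 zero    = refl
  Σ<-0 (suc n) = trans (+-identityˡ _) (Σ<-0 n)

  Σ<-+ : ∀ n f g → Σ< n (λ i → f i + g i) ≡ Σ< n f + Σ< n g
  Σ<-+ zero    f g = refl
  Σ<-+ (suc n) f g = trans (cong (f 0 + g 0 +_) (Σ<-+ n (f ∘ suc) (g ∘ suc))) (exchange (f 0) (g 0) _ _)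
    where
    exchange : ∀ a b c d → a + b + (c + d) ≡ a + c + (b + d)
    exchange = solve-∀ ℚ-ring

  Σ<-* : ∀ n c f → Σ< n (λ i → c * f i) ≡ c * Σ< n f
  Σ<-* zero    c f = sym (*-zeroʳ c)
  Σ<-* (suc n) c f = trans (cong (c * f 0 +_) (Σ<-* n c (f ∘ suc))) (sym (*-distribˡ-+ c _ _))

  Σ<-swap : ∀ m n (f : ℕ → ℕ → ℚ) → Σ< m (λ i → Σ< n (f i)) ≡ Σ< n (λ j → Σ< m (λ i → f i j))
  Σ<-swap zero    n f = sym (Σ<-0 n)
  Σ<-swap (suc m) n f = trans (cong (Σ< n (f 0) +_) (Σ<-swap m n (f ∘ suc)))
                              (sym (Σ<-+ n (f 0) _))

  Σ<-last : ∀ n f → Σ< (suc n) f ≡ Σ< n f + f n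
  Σ<-last zero    f = +-comm (f 0) 0ℚ
  Σ<-last (suc n) f = trans (cong (f 0 +_) (Σ<-last n (f ∘ suc))) (sym (+-assoc (f 0) _ _))

  Σ<-split : ∀ m n f → Σ< (m ℕ.+ n) f ≡ Σ< m f + Σ< n (λ i → f (m ℕ.+ i))
  Σ<-split zero    n f = sym (+-identityˡ _)
  Σ<-split (suc m) n f = trans (cong (f 0 +_) (Σ<-split m n (f ∘ suc))) (sym (+-assoc (f 0) _ _))

  Σ<-reverse : ∀ n f → Σ< (suc n) f ≡ Σ< (suc n) (λ i → f (n ℕ.∸ i))
  Σ<-reverse zero    f = refl
  Σ<-reverse (suc n) f = begin
    Σ< (suc (suc n)) f                              ≡⟨ Σ<-last (suc n) f ⟩
    Σ< (suc n) f + f (suc n)                        ≡⟨ cong (_+ f (suc n)) (Σ<-reverse n f) ⟩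
    Σ< (suc n) (λ i → f (n ℕ.∸ i)) + f (suc n)      ≡⟨ +-comm _ (f (suc n)) ⟩
    f (suc n) + Σ< (suc n) (λ i → f (n ℕ.∸ i))      ∎

  Σ<-telescope : ∀ n (f : ℕ → ℚ) → Σ< n (λ i → f (suc i) - f i) ≡ f n - f 0
  Σ<-telescope zero    f = cancel (f 0)
    where
    cancel : ∀ a → 0ℚ ≡ a - a
    cancel = solve-∀ ℚ-ring
  Σ<-telescope (suc n) f = trans (cong (f 1 - f 0 +_) (Σ<-telescope n (f ∘ suc))) (cancel (f 0) (f 1) (f (suc n)))
    where
    cancel : ∀ a b c → b - a + (c - b) ≡ c - a
    cancel = solve-∀ ℚ-ring

  ⟦_⟧ : Bool → ℚ
  ⟦ true ⟧  = 1ℚ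
  ⟦ false ⟧ = 0ℚ

  ⟦⟧-∧ : ∀ a b → ⟦ a ∧ b ⟧ ≡ ⟦ a ⟧ * ⟦ b ⟧
  ⟦⟧-∧ true  b = sym (*-identityˡ _)
  ⟦⟧-∧ false b = sym (*-zeroˡ ⟦ b ⟧)

  -- Conditions such as "is a partition" enter sums as indicator factors; this is how they become
  -- available as hypotheses on the summand.
  ⟦⟧-cong : ∀ b {p q : ℚ} → (T b → p ≡ q) → ⟦ b ⟧ * p ≡ ⟦ b ⟧ * q
  ⟦⟧-cong true  e = cong (1ℚ *_) (e tt)
  ⟦⟧-cong false {p} {q} e = trans (*-zeroˡ p) (sym (*-zeroˡ q))

  range : ℕ → ℕ → ℕ → Bool
  range lo hi k = (lo ≤ᵇ k) ∧ (k ≤ᵇ hi)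

  private
    Σ<-below : ∀ n hi (f : ℕ → ℚ) → n ℕ.≤ suc hi → Σ< n (λ k → ⟦ k ≤ᵇ hi ⟧ * f k) ≡ Σ< n f
    Σ<-below n hi f n≤ = Σ<-cong n λ i i<n →
      trans (cong (λ b → ⟦ b ⟧ * f i) (T⇒true (i ≤ᵇ hi) (ℕ.≤⇒≤ᵇ (ℕ.≤-pred (ℕ.≤-trans i<n n≤))))) (*-identityˡ (f i))
      where
      T⇒true : ∀ b → T b → b ≡ true
      T⇒true true _ = refl

  -- The interval and the bound are written as `lo`, `lo + d` and `lo + d + e`, so that no
  -- subtraction occurs and induction on `lo` suffices.
  Σ<-range : ∀ lo d e (f : ℕ → ℚ) →
             Σ< (suc (lo ℕ.+ d ℕ.+ e)) (λ k → ⟦ range lo (lo ℕ.+ d) k ⟧ * f k) ≡ Σ< (suc d) (λ i → f (lo ℕ.+ i))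
  Σ<-range zero d e f = begin
    Σ< (suc (d ℕ.+ e)) g                                         ≡⟨ Σ<-split (suc d) e g ⟩
    Σ< (suc d) g + Σ< e (λ i → g (suc d ℕ.+ i))                  ≡⟨ cong₂ _+_ (Σ<-below (suc d) d f ℕ.≤-refl) (trans (Σ<-ext e vanish) (Σ<-0 e)) ⟩
    Σ< (suc d) f + 0ℚ                                            ≡⟨ +-identityʳ _ ⟩
    Σ< (suc d) f                                                 ∎
    where
    g : ℕ → ℚ
    g k = ⟦ k ≤ᵇ d ⟧ * f k
    gt : ∀ a i → (suc a ℕ.+ i ≤ᵇ a) ≡ false
    gt zero    i = refl
    gt (suc a) i = gt a i
    vanish : ∀ i → g (suc d ℕ.+ i) ≡ 0ℚ
    vanish i = trans (cong (λ b → ⟦ b ⟧ * f (suc d ℕ.+ i)) (gt d i)) (*-zeroˡ (f (suc d ℕ.+ i)))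
  Σ<-range (suc lo) d e f = begin
    0ℚ * f 0 + Σ< (suc (lo ℕ.+ d ℕ.+ e)) (λ k → ⟦ range (suc lo) (suc lo ℕ.+ d) (suc k) ⟧ * f (suc k))
      ≡⟨ cong₂ _+_ (*-zeroˡ (f 0)) (Σ<-ext (suc (lo ℕ.+ d ℕ.+ e)) (λ k → cong (λ b → ⟦ b ⟧ * f (suc k)) (shift lo (lo ℕ.+ d) k))) ⟩
    0ℚ + Σ< (suc (lo ℕ.+ d ℕ.+ e)) (λ k → ⟦ range lo (lo ℕ.+ d) k ⟧ * f (suc k))
      ≡⟨ +-identityˡ _ ⟩
    Σ< (suc (lo ℕ.+ d ℕ.+ e)) (λ k → ⟦ range lo (lo ℕ.+ d) k ⟧ * f (suc k))
      ≡⟨ Σ<-range lo d e (f ∘ suc) ⟩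
    Σ< (suc d) (λ i → f (suc lo ℕ.+ i)) ∎
    where
    shift : ∀ a b k → range (suc a) (suc b) (suc k) ≡ range a b k
    shift zero    b zero    = refl
    shift zero    b (suc k) = refl
    shift (suc a) b zero    = refl
    shift (suc a) b (suc k) = refl

  Σ<-range-cong : ∀ n lo hi {f g : ℕ → ℚ} → (∀ k → k ℕ.< n → lo ℕ.≤ k → k ℕ.≤ hi → f k ≡ g k) →
                  Σ< n (λ k → ⟦ range lo hi k ⟧ * f k) ≡ Σ< n (λ k → ⟦ range lo hi k ⟧ * g k)
  Σ<-range-cong n lo hi {f} {g} e = Σ<-cong n step
    where
    step : ∀ k → k ℕ.< n → ⟦ range lo hi k ⟧ * f k ≡ ⟦ range lo hi k ⟧ * g k
    step k k<n with lo ≤ᵇ k in p | k ≤ᵇ hi in q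
    ... | true  | true  = cong (1ℚ *_) (e k k<n (ℕ.≤ᵇ⇒≤ lo k (subst T (sym p) tt)) (ℕ.≤ᵇ⇒≤ k hi (subst T (sym q) tt)))
    ... | true  | false = trans (*-zeroˡ (f k)) (sym (*-zeroˡ (g k)))
    ... | false | _     = trans (*-zeroˡ (f k)) (sym (*-zeroˡ (g k)))

  Σ<-range-telescope : ∀ M lo hi (f : ℕ → ℚ) → lo ℕ.≤ hi → hi ℕ.< M →
                       Σ< M (λ k → ⟦ range lo hi k ⟧ * (f (suc k) - f k)) ≡ f (suc hi) - f lo
  Σ<-range-telescope M lo hi f lo≤hi hi<M with ℕ.m≤n⇒∃[o]m+o≡n lo≤hi | ℕ.m≤n⇒∃[o]m+o≡n hi<M
  ... | d , refl | e , refl = begin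
    Σ< (suc (lo ℕ.+ d ℕ.+ e)) (λ k → ⟦ range lo (lo ℕ.+ d) k ⟧ * (f (suc k) - f k))
      ≡⟨ Σ<-range lo d e (λ k → f (suc k) - f k) ⟩
    Σ< (suc d) (λ i → f (suc (lo ℕ.+ i)) - f (lo ℕ.+ i))
      ≡⟨ Σ<-ext (suc d) (λ i → cong (λ z → f z - f (lo ℕ.+ i)) (sym (ℕ.+-suc lo i))) ⟩
    Σ< (suc d) (λ i → f (lo ℕ.+ suc i) - f (lo ℕ.+ i))
      ≡⟨ Σ<-telescope (suc d) (λ i → f (lo ℕ.+ i)) ⟩
    f (lo ℕ.+ suc d) - f (lo ℕ.+ 0)
      ≡⟨ cong₂ (λ a b → f a - f b) (ℕ.+-suc lo d) (ℕ.+-identityʳ lo) ⟩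
    f (suc (lo ℕ.+ d)) - f lo ∎

  range-empty : ∀ lo hi k → hi ℕ.< lo → range lo hi k ≡ false
  range-empty lo hi k hi<lo with lo ≤ᵇ k in p | k ≤ᵇ hi in q
  ... | false | _     = refl
  ... | true  | false = refl
  ... | true  | true  with ℕ.<-irrefl refl (ℕ.≤-<-trans (ℕ.≤-trans (ℕ.≤ᵇ⇒≤ lo k (subst T (sym p) tt)) (ℕ.≤ᵇ⇒≤ k hi (subst T (sym q) tt))) hi<lo)
  ...   | ()

  -- A sum over an interval is unchanged by reflecting the interval; the reflected
  -- point is handed over as a second argument so that no subtraction is needed.
  Σ<-range-reflect : ∀ M lo hi (F : ℕ → ℕ → ℚ) → hi ℕ.< M →
    Σ< M (λ k → ⟦ range lo hi k ⟧ * F k (lo ℕ.+ hi ℕ.∸ k)) ≡ Σ< M (λ k → ⟦ range lo hi k ⟧ * F (lo ℕ.+ hi ℕ.∸ k) k)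
  Σ<-range-reflect M lo hi F hi<M with ℕ.≤-<-connex lo hi
  ... | inj₂ hi<lo = Σ<-ext M λ k → trans (zero₁ k _) (sym (zero₁ k _))
    where
    zero₁ : ∀ k c → ⟦ range lo hi k ⟧ * c ≡ 0ℚ
    zero₁ k c = trans (cong (λ b → ⟦ b ⟧ * c) (range-empty lo hi k hi<lo)) (*-zeroˡ c)
  ... | inj₁ lo≤hi with ℕ.m≤n⇒∃[o]m+o≡n lo≤hi | ℕ.m≤n⇒∃[o]m+o≡n hi<M
  ... | d , refl | e , refl = begin
    Σ< (suc (lo ℕ.+ d ℕ.+ e)) (λ k → ⟦ range lo (lo ℕ.+ d) k ⟧ * F k (lo ℕ.+ (lo ℕ.+ d) ℕ.∸ k))
      ≡⟨ Σ<-range lo d e (λ k → F k (lo ℕ.+ (lo ℕ.+ d) ℕ.∸ k)) ⟩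
    Σ< (suc d) (λ i → F (lo ℕ.+ i) (lo ℕ.+ (lo ℕ.+ d) ℕ.∸ (lo ℕ.+ i)))
      ≡⟨ Σ<-cong (suc d) (λ i i≤d → cong (F (lo ℕ.+ i)) (mirror i (ℕ.≤-pred i≤d))) ⟩
    Σ< (suc d) (λ i → F (lo ℕ.+ i) (lo ℕ.+ (d ℕ.∸ i)))
      ≡⟨ Σ<-reverse d (λ i → F (lo ℕ.+ i) (lo ℕ.+ (d ℕ.∸ i))) ⟩
    Σ< (suc d) (λ i → F (lo ℕ.+ (d ℕ.∸ i)) (lo ℕ.+ (d ℕ.∸ (d ℕ.∸ i))))
      ≡⟨ Σ<-cong (suc d) (λ i i≤d → cong₂ F (sym (mirror i (ℕ.≤-pred i≤d))) (cong (lo ℕ.+_) (ℕ.m∸[m∸n]≡n (ℕ.≤-pred i≤d)))) ⟩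
    Σ< (suc d) (λ i → F (lo ℕ.+ (lo ℕ.+ d) ℕ.∸ (lo ℕ.+ i)) (lo ℕ.+ i))
      ≡⟨ Σ<-range lo d e (λ k → F (lo ℕ.+ (lo ℕ.+ d) ℕ.∸ k) k) ⟨
    Σ< (suc (lo ℕ.+ d ℕ.+ e)) (λ k → ⟦ range lo (lo ℕ.+ d) k ⟧ * F (lo ℕ.+ (lo ℕ.+ d) ℕ.∸ k) k) ∎
    where
    mirror : ∀ i → i ℕ.≤ d → lo ℕ.+ (lo ℕ.+ d) ℕ.∸ (lo ℕ.+ i) ≡ lo ℕ.+ (d ℕ.∸ i)
    mirror i i≤d = trans (ℕ.[m+n]∸[m+o]≡n∸o lo (lo ℕ.+ d) i) (ℕ.+-∸-assoc lo i≤d)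

-- Determinants, mixed differences and weighted Vandermonde products.

module Determinant where

  open Base
  open import Defs using (_^ℚ_; sumℕ)
  open import Data.List using (List; []; _∷_; _++_; _ʳ++_; map; length; reverse)
  open import Data.List.Properties using (++-assoc; ʳ++-defn; ++-ʳ++; map-ʳ++)
  open import Data.List.Relation.Binary.Pointwise as Pointwise using (Pointwise; []; _∷_)
  open import Data.Nat as ℕ using (ℕ; zero; suc)
  import Data.Nat.Properties as ℕ
  open import Data.Rational using (ℚ; 0ℚ; 1ℚ; _+_; _*_; _-_; -_)
  open import Data.Rational.Properties using (*-zeroʳ; +-identityʳ)
  open import Relation.Binary.PropositionalEquality
  open import Function using (_∘_)
  open import Tactic.RingSolver using (solve-∀)
  open ≡-Reasoning

  -- A column is a function of the row label, so that an operation such as `δ` or `scale` acts on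
  -- all rows at once, whichever labels are chosen.
  Column : Set
  Column = ℕ → ℚ

  -- Laplace expansion along the row m, the columns before the current one being
  -- kept in reverse order.
  laplace : (List Column → ℚ) → ℕ → List Column → List Column → ℚ
  laplace d m pre []         = 0ℚ
  laplace d m pre (φ ∷ post) = φ m * d (pre ʳ++ post) - laplace d m (φ ∷ pre) post

  det : List Column → List ℕ → ℚ
  det φs      (m ∷ ms) = laplace (λ ψs → det ψs ms) m [] φs
  det []      []       = 1ℚ
  det (_ ∷ _) []       = 0ℚ

  Multilinear : (List Column → ℚ) → Set
  Multilinear d = ∀ l r (φ ψ : Column) c →
    d (l ++ (λ m → φ m + c * ψ m) ∷ r) ≡ d (l ++ φ ∷ r) + c * d (l ++ ψ ∷ r)

  -- Equal neighbours are enough: every column operation below adds a multiple of the column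
  -- immediately to the left.
  Alternating : (List Column → ℚ) → Set
  Alternating d = ∀ l r (φ : Column) → d (l ++ φ ∷ φ ∷ r) ≡ 0ℚ

  0≡0+c0 : ∀ c → 0ℚ ≡ 0ℚ + c * 0ℚ
  0≡0+c0 = solve-∀ ℚ-ring

  infix-ʳ++ : ∀ (q p post : List Column) X → (q ++ X ∷ p) ʳ++ post ≡ reverse p ++ X ∷ (q ʳ++ post)
  infix-ʳ++ q p post X = trans (++-ʳ++ q) (ʳ++-defn p)

  ʳ++-infix : ∀ (pre s post : List Column) X → pre ʳ++ (s ++ X ∷ post) ≡ (reverse pre ++ s) ++ X ∷ post
  ʳ++-infix pre s post X = trans (ʳ++-defn pre) (sym (++-assoc (reverse pre) s (X ∷ post)))

  module _ {d : List Column → ℚ} (lin : Multilinear d) where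

    -- Once the changed column has been passed, the expansion meets it only inside the minors, which
    -- are linear in it by `lin`.
    laplace-linearᵖʳᵉ : ∀ m q p post φ ψ c →
      laplace d m (q ++ (λ i → φ i + c * ψ i) ∷ p) post
      ≡ laplace d m (q ++ φ ∷ p) post + c * laplace d m (q ++ ψ ∷ p) post
    laplace-linearᵖʳᵉ m q p []         φ ψ c = 0≡0+c0 c
    laplace-linearᵖʳᵉ m q p (X ∷ post) φ ψ c = begin
      X m * d ((q ++ φψ ∷ p) ʳ++ post) - laplace d m (X ∷ q ++ φψ ∷ p) post
        ≡⟨ cong₂ (λ a b → X m * a - b) split (laplace-linearᵖʳᵉ m (X ∷ q) p post φ ψ c) ⟩
      X m * (d ((q ++ φ ∷ p) ʳ++ post) + c * d ((q ++ ψ ∷ p) ʳ++ post))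
        - (laplace d m (X ∷ q ++ φ ∷ p) post + c * laplace d m (X ∷ q ++ ψ ∷ p) post)
        ≡⟨ rearrange (X m) _ c _ _ _ ⟩
      laplace d m (q ++ φ ∷ p) (X ∷ post) + c * laplace d m (q ++ ψ ∷ p) (X ∷ post) ∎
      where
      φψ : Column
      φψ i = φ i + c * ψ i
      split : d ((q ++ φψ ∷ p) ʳ++ post) ≡ d ((q ++ φ ∷ p) ʳ++ post) + c * d ((q ++ ψ ∷ p) ʳ++ post)
      split = begin
        d ((q ++ φψ ∷ p) ʳ++ post)                 ≡⟨ cong d (infix-ʳ++ q p post φψ) ⟩
        d (reverse p ++ φψ ∷ (q ʳ++ post))         ≡⟨ lin (reverse p) (q ʳ++ post) φ ψ c ⟩
        d (reverse p ++ φ ∷ (q ʳ++ post)) + c * d (reverse p ++ ψ ∷ (q ʳ++ post))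
          ≡⟨ cong₂ (λ a b → d a + c * d b) (infix-ʳ++ q p post φ) (infix-ʳ++ q p post ψ) ⟨
        d ((q ++ φ ∷ p) ʳ++ post) + c * d ((q ++ ψ ∷ p) ʳ++ post) ∎
      rearrange : ∀ x a c b e f → x * (a + c * b) - (e + c * f) ≡ (x * a - e) + c * (x * b - f)
      rearrange = solve-∀ ℚ-ring

    laplace-linearᵖᵒˢᵗ : ∀ m pre s post φ ψ c →
      laplace d m pre (s ++ (λ i → φ i + c * ψ i) ∷ post)
      ≡ laplace d m pre (s ++ φ ∷ post) + c * laplace d m pre (s ++ ψ ∷ post)
    laplace-linearᵖᵒˢᵗ m pre [] post φ ψ c =
      -- The term that deletes the changed column is linear through its entry; in all later terms
      -- the column counts as passed.
      trans (cong (λ z → (φ m + c * ψ m) * d (pre ʳ++ post) - z) (laplace-linearᵖʳᵉ m [] pre post φ ψ c))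
            (rearrange (φ m) c (ψ m) _ _ _)
      where
      rearrange : ∀ x c y a e f → (x + c * y) * a - (e + c * f) ≡ (x * a - e) + c * (y * a - f)
      rearrange = solve-∀ ℚ-ring
    laplace-linearᵖᵒˢᵗ m pre (X ∷ s) post φ ψ c = begin
      X m * d (pre ʳ++ (s ++ φψ ∷ post)) - laplace d m (X ∷ pre) (s ++ φψ ∷ post)
        ≡⟨ cong₂ (λ a b → X m * a - b) split (laplace-linearᵖᵒˢᵗ m (X ∷ pre) s post φ ψ c) ⟩
      X m * (d (pre ʳ++ (s ++ φ ∷ post)) + c * d (pre ʳ++ (s ++ ψ ∷ post)))
        - (laplace d m (X ∷ pre) (s ++ φ ∷ post) + c * laplace d m (X ∷ pre) (s ++ ψ ∷ post))
        ≡⟨ rearrange (X m) _ c _ _ _ ⟩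
      laplace d m pre (X ∷ s ++ φ ∷ post) + c * laplace d m pre (X ∷ s ++ ψ ∷ post) ∎
      where
      φψ : Column
      φψ i = φ i + c * ψ i
      split : d (pre ʳ++ (s ++ φψ ∷ post)) ≡ d (pre ʳ++ (s ++ φ ∷ post)) + c * d (pre ʳ++ (s ++ ψ ∷ post))
      split = begin
        d (pre ʳ++ (s ++ φψ ∷ post))         ≡⟨ cong d (ʳ++-infix pre s post φψ) ⟩
        d ((reverse pre ++ s) ++ φψ ∷ post)  ≡⟨ lin (reverse pre ++ s) post φ ψ c ⟩
        d ((reverse pre ++ s) ++ φ ∷ post) + c * d ((reverse pre ++ s) ++ ψ ∷ post)
          ≡⟨ cong₂ (λ a b → d a + c * d b) (ʳ++-infix pre s post φ) (ʳ++-infix pre s post ψ) ⟨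
        d (pre ʳ++ (s ++ φ ∷ post)) + c * d (pre ʳ++ (s ++ ψ ∷ post)) ∎
      rearrange : ∀ x a c b e f → x * (a + c * b) - (e + c * f) ≡ (x * a - e) + c * (x * b - f)
      rearrange = solve-∀ ℚ-ring

  module _ {d : List Column → ℚ} (alt : Alternating d) where

    private
      zero-term : ∀ x {a b} → a ≡ 0ℚ → b ≡ 0ℚ → x * a - b ≡ 0ℚ
      zero-term x refl refl = lemma x
        where
        lemma : ∀ x → x * 0ℚ - 0ℚ ≡ 0ℚ
        lemma = solve-∀ ℚ-ring

    laplace-alternatingᵖʳᵉ : ∀ m q p post φ → laplace d m (q ++ φ ∷ φ ∷ p) post ≡ 0ℚ
    laplace-alternatingᵖʳᵉ m q p []         φ = refl
    laplace-alternatingᵖʳᵉ m q p (X ∷ post) φ =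
      zero-term (X m) (trans (cong d split) (alt (reverse p) (q ʳ++ post) φ)) (laplace-alternatingᵖʳᵉ m (X ∷ q) p post φ)
      where
      split : (q ++ φ ∷ φ ∷ p) ʳ++ post ≡ reverse p ++ φ ∷ φ ∷ (q ʳ++ post)
      split = trans (++-ʳ++ q) (ʳ++-defn p)

    laplace-alternatingᵖᵒˢᵗ : ∀ m pre s post φ → laplace d m pre (s ++ φ ∷ φ ∷ post) ≡ 0ℚ
    laplace-alternatingᵖᵒˢᵗ m pre [] post φ =
      -- The two terms that delete one of the equal columns have the same minor and opposite signs;
      -- every later minor still contains both columns.
      trans (cong (λ z → φ m * d (pre ʳ++ φ ∷ post) - (φ m * d (pre ʳ++ φ ∷ post) - z))
                  (laplace-alternatingᵖʳᵉ m [] pre post φ))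
            (cancel (φ m * d (pre ʳ++ φ ∷ post)))
      where
      cancel : ∀ a → a - (a - 0ℚ) ≡ 0ℚ
      cancel = solve-∀ ℚ-ring
    laplace-alternatingᵖᵒˢᵗ m pre (X ∷ s) post φ =
      zero-term (X m) (trans (cong d split) (alt (reverse pre ++ s) post φ)) (laplace-alternatingᵖᵒˢᵗ m (X ∷ pre) s post φ)
      where
      split : pre ʳ++ (s ++ φ ∷ φ ∷ post) ≡ (reverse pre ++ s) ++ φ ∷ φ ∷ post
      split = ʳ++-infix pre s (φ ∷ post) φ

  det-multilinear : ∀ ms → Multilinear (λ φs → det φs ms)
  det-multilinear []       []      r φ ψ c = 0≡0+c0 c
  det-multilinear []       (_ ∷ _) r φ ψ c = 0≡0+c0 c
  det-multilinear (m ∷ ms) l       r φ ψ c = laplace-linearᵖᵒˢᵗ (det-multilinear ms) m [] l r φ ψ c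

  det-alternating : ∀ ms → Alternating (λ φs → det φs ms)
  det-alternating []       []      r φ = refl
  det-alternating []       (_ ∷ _) r φ = refl
  det-alternating (m ∷ ms) l       r φ = laplace-alternatingᵖᵒˢᵗ (det-alternating ms) m [] l r φ

  _≐_ : List Column → List Column → Set
  _≐_ = Pointwise (λ φ ψ → ∀ m → φ m ≡ ψ m)

  ʳ++-≐ : ∀ {as bs cs ds} → as ≐ bs → cs ≐ ds → (as ʳ++ cs) ≐ (bs ʳ++ ds)
  ʳ++-≐ []       q = q
  ʳ++-≐ (e ∷ es) q = ʳ++-≐ es (e ∷ q)

  laplace-cong : ∀ {d} → (∀ {φs ψs} → φs ≐ ψs → d φs ≡ d ψs) → ∀ m {as bs cs ds} → as ≐ bs → cs ≐ ds →
                 laplace d m as cs ≡ laplace d m bs ds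
  laplace-cong d-cong m p []      = refl
  laplace-cong d-cong m p (e ∷ q) =
    cong₂ _-_ (cong₂ _*_ (e m) (d-cong (ʳ++-≐ p q))) (laplace-cong d-cong m (e ∷ p) q)

  det-cong : ∀ ms {φs ψs} → φs ≐ ψs → det φs ms ≡ det ψs ms
  det-cong []       []        = refl
  det-cong []       (_ ∷ _)   = refl
  det-cong (m ∷ ms) es        = laplace-cong (det-cong ms) m [] es

  columns : (ℕ → Column) → ℕ → ℕ → List Column
  columns φ k zero    = []
  columns φ k (suc n) = φ k ∷ columns φ (suc k) n

  sheared : (ℕ → ℚ) → (ℕ → Column) → ℕ → ℕ → List Column
  sheared b φ k zero    = []
  sheared b φ k (suc n) = (λ m → φ (suc k) m + b k * φ k m) ∷ sheared b φ (suc k) n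

  -- Columns are cleaned from left to right. Expanding the first sheared column leaves the wanted
  -- determinant and one in which `φ k` stands next to itself; the cleaned column is then the pivot
  -- for the next one.
  det-shear : ∀ b φ l k n ms → det (l ++ φ k ∷ sheared b φ k n) ms ≡ det (l ++ φ k ∷ columns φ (suc k) n) ms
  det-shear b φ l k zero    ms = refl
  det-shear b φ l k (suc n) ms = begin
    det (l ++ φ k ∷ sheared b φ k (suc n)) ms
      ≡⟨ cong (λ z → det z ms) (++-assoc l (φ k ∷ []) _) ⟨
    det (l′ ++ sheared b φ k (suc n)) ms
      ≡⟨ det-multilinear ms l′ (sheared b φ (suc k) n) (φ (suc k)) (φ k) (b k) ⟩
    det (l′ ++ φ (suc k) ∷ sheared b φ (suc k) n) ms + b k * det (l′ ++ φ k ∷ sheared b φ (suc k) n) ms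
      ≡⟨ cong₂ (λ x y → x + b k * y) (det-shear b φ l′ (suc k) n ms)
           (trans (cong (λ z → det z ms) (++-assoc l (φ k ∷ []) _)) (det-alternating ms l (sheared b φ (suc k) n) (φ k))) ⟩
    det (l′ ++ φ (suc k) ∷ columns φ (suc (suc k)) n) ms + b k * 0ℚ
      ≡⟨ trans (cong (det (l′ ++ columns φ (suc k) (suc n)) ms +_) (*-zeroʳ (b k))) (+-identityʳ _) ⟩
    det (l′ ++ columns φ (suc k) (suc n)) ms
      ≡⟨ cong (λ z → det z ms) (++-assoc l (φ k ∷ []) _) ⟩
    det (l ++ φ k ∷ columns φ (suc k) (suc n)) ms ∎
    where
    l′ : List Column
    l′ = l ++ φ k ∷ []

  ∏ : (ℕ → ℚ) → List ℕ → ℚ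
  ∏ f []       = 1ℚ
  ∏ f (m ∷ ms) = f m * ∏ f ms

  scale : (ℕ → ℚ) → Column → Column
  scale f φ m = f m * φ m

  det-scale : ∀ f φs ms → det (map (scale f) φs) ms ≡ ∏ f ms * det φs ms
  det-scale f []      []       = refl
  det-scale f (_ ∷ _) []       = refl
  det-scale f φs      (m ∷ ms) = expand [] φs
    where
    rearrange : ∀ f x p d e → f * x * (p * d) - f * p * e ≡ f * p * (x * d - e)
    rearrange = solve-∀ ℚ-ring
    expand : ∀ pre post → laplace (λ ψs → det ψs ms) m (map (scale f) pre) (map (scale f) post)
                          ≡ f m * ∏ f ms * laplace (λ ψs → det ψs ms) m pre post
    expand pre []         = sym (*-zeroʳ (f m * ∏ f ms))
    expand pre (φ ∷ post) = trans
      (cong₂ (λ a b → f m * φ m * a - b)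
        (trans (cong (λ z → det z ms) (sym (map-ʳ++ (scale f) pre))) (det-scale f (pre ʳ++ post) ms))
        (expand (φ ∷ pre) post))
      (rearrange (f m) (φ m) (∏ f ms) _ _)

  -- The composite of the forward differences in all arguments, one for each position.
  Δ : (List ℕ → ℚ) → List ℕ → ℚ
  Δ E []       = E []
  Δ E (m ∷ ms) = Δ (E ∘ (suc m ∷_)) ms - Δ (E ∘ (m ∷_)) ms

  Δ-cong : ∀ n {E F : List ℕ → ℚ} → (∀ ms → length ms ≡ n → E ms ≡ F ms) → ∀ ms → length ms ≡ n → Δ E ms ≡ Δ F ms
  Δ-cong n       e []       p    = e [] p
  Δ-cong (suc n) e (m ∷ ms) p =
    cong₂ _-_ (Δ-cong n (λ l q → e (suc m ∷ l) (cong suc q)) ms (ℕ.suc-injective p))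
              (Δ-cong n (λ l q → e (m ∷ l) (cong suc q)) ms (ℕ.suc-injective p))

  Δ-linear : ∀ c (E F : List ℕ → ℚ) ms → Δ (λ l → c * E l - F l) ms ≡ c * Δ E ms - Δ F ms
  Δ-linear c E F []       = refl
  Δ-linear c E F (m ∷ ms) = trans
    (cong₂ _-_ (Δ-linear c (E ∘ (suc m ∷_)) (F ∘ (suc m ∷_)) ms) (Δ-linear c (E ∘ (m ∷_)) (F ∘ (m ∷_)) ms))
    (rearrange c _ _ _ _)
    where
    rearrange : ∀ c a b e f → (c * a - b) - (c * e - f) ≡ c * (a - e) - (b - f)
    rearrange = solve-∀ ℚ-ring

  Δ-zero : ∀ ms → Δ (λ _ → 0ℚ) ms ≡ 0ℚ
  Δ-zero []       = refl
  Δ-zero (m ∷ ms) = trans (cong₂ _-_ (Δ-zero ms) (Δ-zero ms)) refl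

  δ : Column → Column
  δ φ m = φ (suc m) - φ m

  -- Each label occurs in exactly one row and the determinant is linear in that row, so differencing
  -- in every label differences every entry.
  Δ-det : ∀ φs ms → Δ (det φs) ms ≡ det (map δ φs) ms
  Δ-det []      []       = refl
  Δ-det (_ ∷ _) []       = refl
  Δ-det φs      (m ∷ ms) = begin
    Δ (λ l → laplace (λ ψs → det ψs l) (suc m) [] φs) ms - Δ (λ l → laplace (λ ψs → det ψs l) m [] φs) ms
      ≡⟨ cong₂ _-_ (inside (suc m) [] φs) (inside m [] φs) ⟩
    laplace (λ ψs → Δ (det ψs) ms) (suc m) [] φs - laplace (λ ψs → Δ (det ψs) ms) m [] φs
      ≡⟨ combine [] φs ⟩
    laplace (λ ψs → det ψs ms) m [] (map δ φs) ∎
    where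
    inside : ∀ k pre post → Δ (λ l → laplace (λ ψs → det ψs l) k pre post) ms ≡ laplace (λ ψs → Δ (det ψs) ms) k pre post
    inside k pre []         = Δ-zero ms
    inside k pre (φ ∷ post) = trans (Δ-linear (φ k) (det (pre ʳ++ post)) _ ms)
                                    (cong (λ z → φ k * Δ (det (pre ʳ++ post)) ms - z) (inside k (φ ∷ pre) post))
    rearrange : ∀ x y a e f → (x * a - e) - (y * a - f) ≡ (x - y) * a - (e - f)
    rearrange = solve-∀ ℚ-ring
    combine : ∀ pre post → laplace (λ ψs → Δ (det ψs) ms) (suc m) pre post - laplace (λ ψs → Δ (det ψs) ms) m pre post
                           ≡ laplace (λ ψs → det ψs ms) m (map δ pre) (map δ post)
    combine pre []         = refl
    combine pre (φ ∷ post) = trans (rearrange (φ (suc m)) (φ m) _ _ _)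
      (cong₂ (λ a b → δ φ m * a - b)
         (trans (Δ-det (pre ʳ++ post) ms) (cong (λ z → det z ms) (map-ʳ++ δ pre)))
         (combine (φ ∷ pre) post))

  module _ (x : ℚ) where

    power : (ℕ → ℚ) → ℕ → Column
    power w j m = ((x ^ℚ m) ^ℚ j) * w m

    vandermonde : (ℕ → ℚ) → List ℕ → ℚ
    vandermonde w []       = 1ℚ
    vandermonde w (l ∷ ls) = w l * ∏ (λ m → (x ^ℚ m) - (x ^ℚ l)) ls * vandermonde w ls

    laplace-vanish : ∀ d l b w pre k n → (∀ j → power w (suc j) l + b j * power w j l ≡ 0ℚ) →
                     laplace d l pre (sheared b (power w) k n) ≡ 0ℚ
    laplace-vanish d l b w pre k zero    e = refl
    laplace-vanish d l b w pre k (suc n) e =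
      trans (cong₂ (λ a c → a * d (pre ʳ++ sheared b (power w) (suc k) n) - c) (e k) (laplace-vanish d l b w _ (suc k) n e))
            (zero-term (d (pre ʳ++ sheared b (power w) (suc k) n)))
      where
      zero-term : ∀ a → 0ℚ * a - 0ℚ ≡ 0ℚ
      zero-term = solve-∀ ℚ-ring

    -- Shearing by minus `x ^ℚ l`, with `l` the first label, kills row `l` outside column 0 and
    -- leaves the factor `(x ^ℚ m) - (x ^ℚ l)` in each other row `m`, in front of a smaller
    -- determinant of the same kind.
    det-vandermonde : ∀ w ls → det (columns (power w) 0 (length ls)) ls ≡ vandermonde w ls
    det-vandermonde w []       = refl
    det-vandermonde w (l ∷ ls) = begin
      det (columns (power w) 0 (suc n)) (l ∷ ls)                             ≡⟨ det-shear b (power w) [] 0 n (l ∷ ls) ⟨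
      det (power w 0 ∷ sheared b (power w) 0 n) (l ∷ ls)
        ≡⟨ cong (λ z → power w 0 l * det (sheared b (power w) 0 n) ls - z) (laplace-vanish _ l b w _ 0 n vanish) ⟩
      1ℚ * w l * det (sheared b (power w) 0 n) ls - 0ℚ
        ≡⟨ cong (λ z → 1ℚ * w l * z - 0ℚ) (trans (det-cong ls (factor 0 n)) (det-scale f (columns (power w) 0 n) ls)) ⟩
      1ℚ * w l * (∏ f ls * det (columns (power w) 0 n) ls) - 0ℚ               ≡⟨ tidy (w l) (∏ f ls) _ ⟩
      w l * ∏ f ls * det (columns (power w) 0 n) ls                          ≡⟨ cong (w l * ∏ f ls *_) (det-vandermonde w ls) ⟩
      w l * ∏ f ls * vandermonde w ls                                        ∎
      where
      n = length ls
      b : ℕ → ℚ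
      b _ = - (x ^ℚ l)
      f : ℕ → ℚ
      f m = (x ^ℚ m) - (x ^ℚ l)
      tidy : ∀ a p d → 1ℚ * a * (p * d) - 0ℚ ≡ a * p * d
      tidy = solve-∀ ℚ-ring
      vanish′ : ∀ y p v → y * p * v + - y * (p * v) ≡ 0ℚ
      vanish′ = solve-∀ ℚ-ring
      vanish : ∀ j → power w (suc j) l + b j * power w j l ≡ 0ℚ
      vanish j = vanish′ (x ^ℚ l) ((x ^ℚ l) ^ℚ j) (w l)
      factor′ : ∀ y z p v → y * p * v + - z * (p * v) ≡ (y - z) * (p * v)
      factor′ = solve-∀ ℚ-ring
      factor : ∀ k n → sheared b (power w) k n ≐ map (scale f) (columns (power w) k n)
      factor k zero    = []
      factor k (suc n) = (λ m → factor′ (x ^ℚ m) (x ^ℚ l) ((x ^ℚ m) ^ℚ k) (w m)) ∷ factor (suc k) n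

    ∏-power : ∀ ms → ∏ (x ^ℚ_) ms ≡ x ^ℚ sumℕ ms
    ∏-power []       = refl
    ∏-power (m ∷ ms) = trans (cong ((x ^ℚ m) *_) (∏-power ms)) (sym (^ℚ-+ x m (sumℕ ms)))

    -- δ turns y^j w′ into (y^(j+1) − (1 − x^j) y^j) w, where y = x^m: a shear of the columns y^(j+1) w.
    Δ-vandermonde : ∀ w w′ → (∀ m → w′ (suc m) ≡ w m) → (∀ m → w′ m ≡ (1ℚ - (x ^ℚ m)) * w m) →
                    ∀ ms → Δ (vandermonde w′) ms ≡ (x ^ℚ sumℕ ms) * vandermonde w ms
    Δ-vandermonde w w′ shift-w base-w ms = begin
      Δ (vandermonde w′) ms                             ≡⟨ Δ-cong n (λ l p → trans (sym (det-vandermonde w′ l)) (cong (λ k → det (columns (power w′) 0 k) l) p)) ms refl ⟩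
      Δ (det (columns (power w′) 0 n)) ms               ≡⟨ Δ-det (columns (power w′) 0 n) ms ⟩
      det (map δ (columns (power w′) 0 n)) ms           ≡⟨ det-cong ms (step 0 n) ⟩
      det (sheared b (power w) 0 n) ms                  ≡⟨ unshear n ⟩
      det (columns (power w) 1 n) ms                    ≡⟨ det-cong ms (shift 0 n) ⟩
      det (map (scale (x ^ℚ_)) (columns (power w) 0 n)) ms ≡⟨ det-scale (x ^ℚ_) (columns (power w) 0 n) ms ⟩
      ∏ (x ^ℚ_) ms * det (columns (power w) 0 n) ms     ≡⟨ cong₂ _*_ (∏-power ms) (det-vandermonde w ms) ⟩
      (x ^ℚ sumℕ ms) * vandermonde w ms                  ∎
      where
      n = length ms
      b : ℕ → ℚ
      b k = - (1ℚ - (x ^ℚ k))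
      power-comm : ∀ m j → (x ^ℚ suc m) ^ℚ j ≡ (x ^ℚ j) * ((x ^ℚ m) ^ℚ j)
      power-comm m j = trans (sym (^ℚ-* x (suc m) j)) (trans (cong (x ^ℚ_) (ℕ.*-suc j m))
                         (trans (^ℚ-+ x j (j ℕ.* m)) (cong ((x ^ℚ j) *_) (^ℚ-* x m j))))
      step′ : ∀ xj p v y → xj * p * v - p * ((1ℚ - y) * v) ≡ y * p * v + - (1ℚ - xj) * (p * v)
      step′ = solve-∀ ℚ-ring
      step : ∀ k n → map δ (columns (power w′) k n) ≐ sheared b (power w) k n
      step k zero    = []
      step k (suc n) = (λ m → trans
          (cong₂ _-_ (cong₂ _*_ (power-comm m k) (shift-w m)) (cong (((x ^ℚ m) ^ℚ k) *_) (base-w m)))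
          (step′ (x ^ℚ k) ((x ^ℚ m) ^ℚ k) (w m) (x ^ℚ m))) ∷ step (suc k) n
      drop-zero : ∀ a c → a + - (1ℚ - 1ℚ) * c ≡ a
      drop-zero = solve-∀ ℚ-ring
      unshear : ∀ n → det (sheared b (power w) 0 n) ms ≡ det (columns (power w) 1 n) ms
      unshear zero    = refl
      -- The shear coefficient of column 0 contains 1 - x^0 = 0, so the first column is already
      -- `power w 1` and can serve as the pivot for the others.
      unshear (suc n) = trans (det-multilinear ms [] (sheared b (power w) 1 n) (power w 1) (power w 0) (b 0))
                          (trans (drop-zero _ (det (power w 0 ∷ sheared b (power w) 1 n) ms)) (det-shear b (power w) [] 1 n ms))
      shift′ : ∀ y p v → y * p * v ≡ y * (p * v)
      shift′ = solve-∀ ℚ-ring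
      shift : ∀ k n → columns (power w) (suc k) n ≐ map (scale (x ^ℚ_)) (columns (power w) k n)
      shift k zero    = []
      shift k (suc n) = (λ m → shift′ (x ^ℚ m) ((x ^ℚ m) ^ℚ k) (w m)) ∷ shift (suc k) n

    -- With `vandermonde-end`, this supplies the vanishing boundary terms of the telescoping sum
    -- behind branching.
    vandermonde-repeat : ∀ w pre a post → vandermonde w (pre ++ a ∷ a ∷ post) ≡ 0ℚ
    vandermonde-repeat w []        a post = lemma (w a) (x ^ℚ a) _ _
      where
      lemma : ∀ v y p d → v * ((y - y) * p) * d ≡ 0ℚ
      lemma = solve-∀ ℚ-ring
    vandermonde-repeat w (l ∷ pre) a post = *-zeroʳ′ (w l * _) (vandermonde-repeat w pre a post)

    vandermonde-end : ∀ w → w 0 ≡ 0ℚ → ∀ pre → vandermonde w (pre ++ 0 ∷ []) ≡ 0ℚ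
    vandermonde-end w w0 []        = trans (cong (λ z → z * 1ℚ * 1ℚ) w0) refl
    vandermonde-end w w0 (l ∷ pre) = *-zeroʳ′ (w l * _) (vandermonde-end w w0 pre)

-- Partitions padded with zeros, horizontal strips, and sums over boxes of lists.

module Partition where

  open Base
  open import Defs using (sumℕ)
  open import Data.Bool using (Bool; true; false; _∧_; T)
  open import Data.List using (List; []; _∷_; length)
  open import Data.Nat as ℕ using (ℕ; zero; suc; z≤n; s≤s; _≤ᵇ_)
  import Data.Nat.Properties as ℕ
  open import Data.Product using (_×_; _,_; proj₁; proj₂)
  open import Data.Rational using (ℚ; 0ℚ; _+_; _*_)
  open import Data.Rational.Properties using (+-identityʳ; +-identityˡ; *-assoc)
  open import Data.Unit using (tt)
  open import Data.Empty using (⊥-elim)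
  open import Function using (_∘_)
  open import Relation.Binary.PropositionalEquality
  open import Relation.Nullary using (¬_)

  T-∧⁻ : ∀ a {b} → T (a ∧ b) → T a × T b
  T-∧⁻ true t = tt , t

  T-∧⁺ : ∀ a {b} → T a → T b → T (a ∧ b)
  T-∧⁺ true _ t = t

  T-≡ : ∀ {a b} → (T a → T b) → (T b → T a) → a ≡ b
  T-≡ {true}  {true}  f g = refl
  T-≡ {true}  {false} f g = ⊥-elim (f tt)
  T-≡ {false} {true}  f g = ⊥-elim (g tt)
  T-≡ {false} {false} f g = refl

  T-range : ∀ lo hi k → T (range lo hi k) → lo ℕ.≤ k × k ℕ.≤ hi
  T-range lo hi k t = let (p , q) = T-∧⁻ (lo ≤ᵇ k) t in ℕ.≤ᵇ⇒≤ lo k p , ℕ.≤ᵇ⇒≤ k hi q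

  hd : List ℕ → ℕ
  hd []      = 0
  hd (a ∷ _) = a

  data Decreasing : List ℕ → Set where
    []  : Decreasing []
    _∷_ : ∀ {a r} → hd r ℕ.≤ a → Decreasing r → Decreasing (a ∷ r)

  decreasing? : List ℕ → Bool
  decreasing? []      = true
  decreasing? (a ∷ r) = (hd r ≤ᵇ a) ∧ decreasing? r

  decreasing?⁻ : ∀ κ → T (decreasing? κ) → Decreasing κ
  decreasing?⁻ []      t = []
  decreasing?⁻ (a ∷ r) t = let (p , q) = T-∧⁻ (hd r ≤ᵇ a) t in ℕ.≤ᵇ⇒≤ (hd r) a p ∷ decreasing?⁻ r q

  decreasing?⁺ : ∀ {κ} → Decreasing κ → T (decreasing? κ)
  decreasing?⁺ []              = tt
  decreasing?⁺ (_∷_ {a} {r} p d) = T-∧⁺ (hd r ≤ᵇ a) (ℕ.≤⇒≤ᵇ p) (decreasing?⁺ d)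

  -- κ / ν is a horizontal strip; both are padded with zeros to the same length.
  _≻_ : List ℕ → List ℕ → Bool
  []      ≻ []      = true
  []      ≻ (_ ∷ _) = false
  (_ ∷ _) ≻ []      = false
  (a ∷ κ) ≻ (c ∷ ν) = range (hd κ) a c ∧ (κ ≻ ν)

  ≻-hd : ∀ κ ν → T (κ ≻ ν) → hd ν ℕ.≤ hd κ
  ≻-hd []      []      t = z≤n
  ≻-hd (a ∷ κ) (c ∷ ν) t = proj₂ (T-range (hd κ) a c (proj₁ (T-∧⁻ (range (hd κ) a c) t)))

  ≻-decreasingʳ : ∀ κ ν → T (κ ≻ ν) → Decreasing ν
  ≻-decreasingʳ []      []      t = []
  ≻-decreasingʳ (a ∷ κ) (c ∷ ν) t =
    let (p , q) = T-∧⁻ (range (hd κ) a c) t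
    in ℕ.≤-trans (≻-hd κ ν q) (proj₁ (T-range (hd κ) a c p)) ∷ ≻-decreasingʳ κ ν q

  ≻-decreasingˡ : ∀ κ ν → T (κ ≻ ν) → Decreasing κ
  ≻-decreasingˡ []      []      t = []
  ≻-decreasingˡ (a ∷ κ) (c ∷ ν) t =
    let (p , q) = T-∧⁻ (range (hd κ) a c) t
        (l , u) = T-range (hd κ) a c p
    in ℕ.≤-trans l u ∷ ≻-decreasingˡ κ ν q

  ≻-size : ∀ κ ν → T (κ ≻ ν) → sumℕ ν ℕ.≤ sumℕ κ
  ≻-size []      []      t = z≤n
  ≻-size (a ∷ κ) (c ∷ ν) t =
    let (p , q) = T-∧⁻ (range (hd κ) a c) t
    in ℕ.+-mono-≤ (proj₂ (T-range (hd κ) a c p)) (≻-size κ ν q)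

  -- Sizes are compared row by row, so equal totals force equality in every row. In an induction on
  -- size this singles out the one term that does not get smaller.
  ≻-size-≡ : ∀ κ ν → T (κ ≻ ν) → sumℕ ν ≡ sumℕ κ → ν ≡ κ
  ≻-size-≡ []      []      t e = refl
  ≻-size-≡ (a ∷ κ) (c ∷ ν) t e with T-∧⁻ (range (hd κ) a c) t
  ... | p , q = cong₂ _∷_ c≡a (≻-size-≡ κ ν q (ℕ.+-cancelˡ-≡ a _ _ (trans (cong (ℕ._+ sumℕ ν) (sym c≡a)) e)))
    where
    c≡a : c ≡ a
    c≡a = ℕ.≤-antisym (proj₂ (T-range (hd κ) a c p))
            (ℕ.+-cancelʳ-≤ (sumℕ ν) a c (ℕ.≤-trans (ℕ.+-monoʳ-≤ a (≻-size κ ν q)) (ℕ.≤-reflexive (sym e))))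

  range⁺ : ∀ {lo hi k} → lo ℕ.≤ k → k ℕ.≤ hi → T (range lo hi k)
  range⁺ {lo} {hi} {k} p q = T-∧⁺ (lo ≤ᵇ k) (ℕ.≤⇒≤ᵇ p) (ℕ.≤⇒≤ᵇ q)

  ≻-refl : ∀ {κ} → Decreasing κ → T (κ ≻ κ)
  ≻-refl []              = tt
  ≻-refl (_∷_ {a} {r} p d) = T-∧⁺ (range (hd r) a a) (range⁺ {hd r} p ℕ.≤-refl) (≻-refl d)

  data Box (M : ℕ) : ℕ → List ℕ → Set where
    []  : Box M 0 []
    _∷_ : ∀ {ℓ a r} → a ℕ.< M → Box M ℓ r → Box M (suc ℓ) (a ∷ r)

  Box-length : ∀ {M ℓ κ} → Box M ℓ κ → length κ ≡ ℓ
  Box-length []      = refl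
  Box-length (_ ∷ b) = cong suc (Box-length b)

  -- The sum is over all lists in the box, decreasing or not. Shape conditions are left to
  -- indicators, so two such sums can always be interchanged.
  ΣBox : ℕ → ℕ → (List ℕ → ℚ) → ℚ
  ΣBox M zero    F = F []
  ΣBox M (suc ℓ) F = Σ< M (λ a → ΣBox M ℓ (λ r → F (a ∷ r)))

  ΣBox-cong : ∀ M ℓ {F G : List ℕ → ℚ} → (∀ κ → Box M ℓ κ → F κ ≡ G κ) → ΣBox M ℓ F ≡ ΣBox M ℓ G
  ΣBox-cong M zero    e = e [] []
  ΣBox-cong M (suc ℓ) e = Σ<-cong M (λ a a<M → ΣBox-cong M ℓ (λ κ b → e (a ∷ κ) (a<M ∷ b)))

  ΣBox-ext : ∀ M ℓ {F G : List ℕ → ℚ} → (∀ κ → F κ ≡ G κ) → ΣBox M ℓ F ≡ ΣBox M ℓ G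
  ΣBox-ext M ℓ e = ΣBox-cong M ℓ (λ κ _ → e κ)

  ΣBox-* : ∀ M ℓ c F → ΣBox M ℓ (λ κ → c * F κ) ≡ c * ΣBox M ℓ F
  ΣBox-* M zero    c F = refl
  ΣBox-* M (suc ℓ) c F = trans (Σ<-ext M (λ a → ΣBox-* M ℓ c (λ r → F (a ∷ r)))) (Σ<-* M c (λ a → ΣBox M ℓ (λ r → F (a ∷ r))))

  ΣBox-+ : ∀ M ℓ F G → ΣBox M ℓ (λ κ → F κ + G κ) ≡ ΣBox M ℓ F + ΣBox M ℓ G
  ΣBox-+ M zero    F G = refl
  ΣBox-+ M (suc ℓ) F G = trans (Σ<-ext M (λ a → ΣBox-+ M ℓ (λ r → F (a ∷ r)) (λ r → G (a ∷ r)))) (Σ<-+ M (λ a → ΣBox M ℓ (λ r → F (a ∷ r))) (λ a → ΣBox M ℓ (λ r → G (a ∷ r))))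

  ΣBox-0 : ∀ M ℓ → ΣBox M ℓ (λ _ → 0ℚ) ≡ 0ℚ
  ΣBox-0 M zero    = refl
  ΣBox-0 M (suc ℓ) = trans (Σ<-ext M (λ _ → ΣBox-0 M ℓ)) (Σ<-0 M)

  ΣBox-Σ< : ∀ M ℓ n (F : List ℕ → ℕ → ℚ) → ΣBox M ℓ (λ κ → Σ< n (F κ)) ≡ Σ< n (λ i → ΣBox M ℓ (λ κ → F κ i))
  ΣBox-Σ< M zero    n F = refl
  ΣBox-Σ< M (suc ℓ) n F = trans (Σ<-ext M (λ a → ΣBox-Σ< M ℓ n (λ r → F (a ∷ r))))
                                (Σ<-swap M n (λ a i → ΣBox M ℓ (λ r → F (a ∷ r) i)))

  ΣBox-swap : ∀ M ℓ k (F : List ℕ → List ℕ → ℚ) →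
              ΣBox M ℓ (λ κ → ΣBox M k (F κ)) ≡ ΣBox M k (λ ν → ΣBox M ℓ (λ κ → F κ ν))
  ΣBox-swap M zero    k F = refl
  ΣBox-swap M (suc ℓ) k F = trans (Σ<-ext M (λ a → ΣBox-swap M ℓ k (λ r → F (a ∷ r))))
                                  (sym (ΣBox-Σ< M k M (λ ν a → ΣBox M ℓ (λ r → F (a ∷ r) ν))))

  Σ<-single : ∀ n j f → j ℕ.< n → (∀ i → i ℕ.< n → ¬ (i ≡ j) → f i ≡ 0ℚ) → Σ< n f ≡ f j
  Σ<-single (suc n) zero    f _ e =
    trans (cong (f 0 +_) (trans (Σ<-cong n (λ i i<n → e (suc i) (s≤s i<n) (λ ()))) (Σ<-0 n))) (+-identityʳ _)
  Σ<-single (suc n) (suc j) f (s≤s j<n) e =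
    trans (cong₂ _+_ (e 0 (s≤s z≤n) (λ ())) (Σ<-single n j (f ∘ suc) j<n (λ i i<n i≢j → e (suc i) (s≤s i<n) (i≢j ∘ ℕ.suc-injective))))
          (+-identityˡ _)

  ΣBox-single : ∀ M ℓ μ F → Box M ℓ μ → (∀ κ → Box M ℓ κ → ¬ (κ ≡ μ) → F κ ≡ 0ℚ) → ΣBox M ℓ F ≡ F μ
  ΣBox-single M zero    []      F []        e = refl
  ΣBox-single M (suc ℓ) (a ∷ r) F (a<M ∷ b) e = trans
    (Σ<-single M a _ a<M (λ i i<M i≢a → trans (ΣBox-cong M ℓ (λ κ b′ → e (i ∷ κ) (i<M ∷ b′) (i≢a ∘ cong hd))) (ΣBox-0 M ℓ)))
    (ΣBox-single M ℓ r (λ κ → F (a ∷ κ)) b (λ κ b′ κ≢r → e (a ∷ κ) (a<M ∷ b′) (κ≢r ∘ ∷-tail)))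
    where
    ∷-tail : ∀ {a b : ℕ} {r s} → a ∷ r ≡ b ∷ s → r ≡ s
    ∷-tail refl = refl

  ΣBox-⟦⟧-cong : ∀ M ℓ (b : List ℕ → Bool) {F G : List ℕ → ℚ} → (∀ κ → Box M ℓ κ → T (b κ) → F κ ≡ G κ) →
                 ΣBox M ℓ (λ κ → ⟦ b κ ⟧ * F κ) ≡ ΣBox M ℓ (λ κ → ⟦ b κ ⟧ * G κ)
  ΣBox-⟦⟧-cong M ℓ b e = ΣBox-cong M ℓ (λ κ bx → ⟦⟧-cong (b κ) (e κ bx))

  -- For fixed κ the rows of ν range over independent intervals, so a sum over horizontal strips can
  -- be evaluated one row at a time.
  Σ≻-∷ : ∀ M ℓ a κ (F : List ℕ → ℚ) → ΣBox M (suc ℓ) (λ ν → ⟦ (a ∷ κ) ≻ ν ⟧ * F ν)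
                       ≡ Σ< M (λ c → ⟦ range (hd κ) a c ⟧ * ΣBox M ℓ (λ ν → ⟦ κ ≻ ν ⟧ * F (c ∷ ν)))
  Σ≻-∷ M ℓ a κ F = Σ<-ext M λ c → trans
    (ΣBox-ext M ℓ (λ ν → trans (cong (_* F (c ∷ ν)) (⟦⟧-∧ (range (hd κ) a c) (κ ≻ ν))) (*-assoc ⟦ range (hd κ) a c ⟧ ⟦ κ ≻ ν ⟧ (F (c ∷ ν)))))
    (ΣBox-* M ℓ ⟦ range (hd κ) a c ⟧ (λ ν → ⟦ κ ≻ ν ⟧ * F (c ∷ ν)))

-- The principal specialisation of Schur functions and its branching rule.

module Principal where

  open Base
  open import Defs using (_^ℚ_; sumℕ; countGt)
  open Determinant
  open Partition
  open import Data.Bool using (true; false; T)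
  open import Data.List using (List; []; _∷_; _++_; map; length; applyUpTo)
  open import Data.Nat as ℕ using (ℕ; zero; suc; z≤n; s≤s; _<ᵇ_)
  import Data.Nat.Properties as ℕ
  open import Data.Nat.Tactic.RingSolver using () renaming (solve-∀ to ℕ-solve-∀)
  open import Data.Product using (_,_)
  open import Data.Rational using (ℚ; 0ℚ; 1ℚ; _+_; _*_; _-_; -_)
  open import Data.Rational.Properties using (*-identityˡ; *-identityʳ; +-identityʳ; *-assoc; *-comm)
  open import Data.Unit using (tt)
  open import Data.Empty using (⊥-elim)
  open import Function using (_∘_)
  open import Relation.Binary.PropositionalEquality
  open import Tactic.RingSolver using (solve-∀)
  open ≡-Reasoning

  -- The first-column hook lengths, provided that κ has no empty row.
  beta : List ℕ → List ℕ
  beta []      = []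
  beta (a ∷ r) = a ℕ.+ length r ∷ beta r

  -- The binomial coefficient of ℓ over 2; `tetrahedron` is that of ℓ over 3. They are the exponents
  -- by which the Vandermonde product in the beta-numbers differs from `g`.
  triangle : ℕ → ℕ
  triangle zero    = 0
  triangle (suc ℓ) = ℓ ℕ.+ triangle ℓ

  tetrahedron : ℕ → ℕ
  tetrahedron zero    = 0
  tetrahedron (suc ℓ) = triangle ℓ ℕ.+ tetrahedron ℓ

  sum-beta : ∀ κ → sumℕ (beta κ) ≡ sumℕ κ ℕ.+ triangle (length κ)
  sum-beta []      = refl
  sum-beta (a ∷ r) = trans (cong (a ℕ.+ length r ℕ.+_) (sum-beta r)) (rearrange a (length r) (sumℕ r) (triangle (length r)))
    where
    rearrange : ∀ a b c d → a ℕ.+ b ℕ.+ (c ℕ.+ d) ≡ a ℕ.+ c ℕ.+ (b ℕ.+ d)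
    rearrange = ℕ-solve-∀

  length-beta : ∀ κ → length (beta κ) ≡ length κ
  length-beta []      = refl
  length-beta (a ∷ r) = cong suc (length-beta r)

  Repeat : (List ℕ → ℚ) → Set
  Repeat E = ∀ pre a post → E (pre ++ a ∷ a ∷ post) ≡ 0ℚ

  End : (List ℕ → ℚ) → Set
  End E = ∀ pre → E (pre ++ 0 ∷ []) ≡ 0ℚ

  -- The sum telescopes in every row; all boundary terms but one have two equal
  -- neighbouring arguments, or a last argument 0.
  Δ-telescope : ∀ M κ E → Decreasing κ → hd κ ℕ.< M → Repeat E → End E →
                ΣBox M (length κ) (λ ν → ⟦ κ ≻ ν ⟧ * Δ E (beta ν)) ≡ E (map suc (beta κ))
  Δ-telescope M []          E d<          a<M rep end = *-identityˡ (E [])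
  Δ-telescope M (a ∷ [])    E (p ∷ d)     a<M rep end = begin
    ΣBox M 1 (λ ν → ⟦ (a ∷ []) ≻ ν ⟧ * Δ E (beta ν))
      ≡⟨ Σ≻-∷ M 0 a [] (λ ν → Δ E (beta ν)) ⟩
    Σ< M (λ c → ⟦ range 0 a c ⟧ * (1ℚ * (E (suc (c ℕ.+ 0) ∷ []) - E (c ℕ.+ 0 ∷ []))))
      ≡⟨ Σ<-ext M (λ c → cong (⟦ range 0 a c ⟧ *_) (*-identityˡ (E (suc (c ℕ.+ 0) ∷ []) - E (c ℕ.+ 0 ∷ [])))) ⟩
    Σ< M (λ c → ⟦ range 0 a c ⟧ * (E (suc (c ℕ.+ 0) ∷ []) - E (c ℕ.+ 0 ∷ [])))
      ≡⟨ Σ<-range-telescope M 0 a (λ c → E (c ℕ.+ 0 ∷ [])) z≤n a<M ⟩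
    E (suc (a ℕ.+ 0) ∷ []) - E (0 ∷ [])
      ≡⟨ cong (λ z → E (suc (a ℕ.+ 0) ∷ []) - z) (end []) ⟩
    E (suc (a ℕ.+ 0) ∷ []) - 0ℚ
      ≡⟨ minus-zero _ ⟩
    E (suc (a ℕ.+ 0) ∷ []) ∎
    where
    minus-zero : ∀ z → z - 0ℚ ≡ z
    minus-zero = solve-∀ ℚ-ring
  Δ-telescope M (a ∷ κ@(b ∷ r)) E (p ∷ d) a<M rep end = begin
    ΣBox M (suc ℓ) (λ ν → ⟦ (a ∷ κ) ≻ ν ⟧ * Δ E (beta ν))
      ≡⟨ Σ≻-∷ M ℓ a κ (λ ν → Δ E (beta ν)) ⟩
    Σ< M (λ c → ⟦ range b a c ⟧ * ΣBox M ℓ (λ ν → ⟦ κ ≻ ν ⟧ * (Δ (E ∘ (suc (c ℕ.+ length ν) ∷_)) (beta ν) - Δ (E ∘ (c ℕ.+ length ν ∷_)) (beta ν))))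
      ≡⟨ Σ<-ext M (λ c → cong (⟦ range b a c ⟧ *_) (row c)) ⟩
    Σ< M (λ c → ⟦ range b a c ⟧ * (E (suc (c ℕ.+ ℓ) ∷ L) - E (c ℕ.+ ℓ ∷ L)))
      ≡⟨ Σ<-range-telescope M b a (λ c → E (c ℕ.+ ℓ ∷ L)) p a<M ⟩
    E (suc (a ℕ.+ ℓ) ∷ L) - E (b ℕ.+ ℓ ∷ L)
      -- At the lower end of the interval the argument `b + ℓ` is the next beta-number plus one,
      -- which is the head of `L`: two equal neighbours.
      ≡⟨ cong (λ z → E (suc (a ℕ.+ ℓ) ∷ L) - z) (trans (cong (λ z → E (z ∷ L)) (ℕ.+-suc b (length r))) (rep [] (suc (b ℕ.+ length r)) (map suc (beta r)))) ⟩
    E (suc (a ℕ.+ ℓ) ∷ L) - 0ℚ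
      ≡⟨ minus-zero _ ⟩
    E (suc (a ℕ.+ ℓ) ∷ L) ∎
    where
    ℓ = length κ
    L = map suc (beta κ)
    minus-zero : ∀ z → z - 0ℚ ≡ z
    minus-zero = solve-∀ ℚ-ring
    split : ∀ t u v → t * (u - v) ≡ t * u + (- 1ℚ) * (t * v)
    split = solve-∀ ℚ-ring
    unsplit : ∀ u v → u + (- 1ℚ) * v ≡ u - v
    unsplit = solve-∀ ℚ-ring
    F : ℕ → List ℕ → ℚ
    F z ν = ⟦ κ ≻ ν ⟧ * Δ (E ∘ (z ∷_)) (beta ν)
    IH : ∀ z → ΣBox M ℓ (λ ν → ⟦ κ ≻ ν ⟧ * Δ (E ∘ (z ∷_)) (beta ν)) ≡ E (z ∷ L)
    IH z = Δ-telescope M κ (E ∘ (z ∷_)) d (ℕ.≤-<-trans p a<M) (λ pre → rep (z ∷ pre)) (λ pre → end (z ∷ pre))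
    row : ∀ c → ΣBox M ℓ (λ ν → ⟦ κ ≻ ν ⟧ * (Δ (E ∘ (suc (c ℕ.+ length ν) ∷_)) (beta ν) - Δ (E ∘ (c ℕ.+ length ν ∷_)) (beta ν)))
                ≡ E (suc (c ℕ.+ ℓ) ∷ L) - E (c ℕ.+ ℓ ∷ L)
    row c = begin
      ΣBox M ℓ (λ ν → ⟦ κ ≻ ν ⟧ * (Δ (E ∘ (suc (c ℕ.+ length ν) ∷_)) (beta ν) - Δ (E ∘ (c ℕ.+ length ν ∷_)) (beta ν)))
        -- All ν in the box have length `ℓ`, so the first argument of `E` is the same for the whole
        -- inner sum and the induction hypothesis applies with it frozen.
        ≡⟨ ΣBox-cong M ℓ (λ ν bx → trans
             (cong (λ k → ⟦ κ ≻ ν ⟧ * (Δ (E ∘ (suc (c ℕ.+ k) ∷_)) (beta ν) - Δ (E ∘ (c ℕ.+ k ∷_)) (beta ν))) (Box-length bx))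
             (split ⟦ κ ≻ ν ⟧ (Δ (E ∘ (suc (c ℕ.+ ℓ) ∷_)) (beta ν)) (Δ (E ∘ (c ℕ.+ ℓ ∷_)) (beta ν)))) ⟩
      ΣBox M ℓ (λ ν → ⟦ κ ≻ ν ⟧ * Δ (E ∘ (suc (c ℕ.+ ℓ) ∷_)) (beta ν) + (- 1ℚ) * (⟦ κ ≻ ν ⟧ * Δ (E ∘ (c ℕ.+ ℓ ∷_)) (beta ν)))
        ≡⟨ ΣBox-+ M ℓ (F (suc (c ℕ.+ ℓ))) (λ ν → (- 1ℚ) * F (c ℕ.+ ℓ) ν) ⟩
      ΣBox M ℓ (λ ν → ⟦ κ ≻ ν ⟧ * Δ (E ∘ (suc (c ℕ.+ ℓ) ∷_)) (beta ν)) + ΣBox M ℓ (λ ν → (- 1ℚ) * (⟦ κ ≻ ν ⟧ * Δ (E ∘ (c ℕ.+ ℓ ∷_)) (beta ν)))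
        ≡⟨ cong₂ _+_ (IH (suc (c ℕ.+ ℓ))) (trans (ΣBox-* M ℓ (- 1ℚ) (F (c ℕ.+ ℓ))) (cong ((- 1ℚ) *_) (IH (c ℕ.+ ℓ)))) ⟩
      E (suc (c ℕ.+ ℓ) ∷ L) + (- 1ℚ) * E (c ℕ.+ ℓ ∷ L)
        ≡⟨ unsplit (E (suc (c ℕ.+ ℓ) ∷ L)) (E (c ℕ.+ ℓ ∷ L)) ⟩
      E (suc (c ℕ.+ ℓ) ∷ L) - E (c ℕ.+ ℓ ∷ L) ∎

  ∏< : (ℕ → ℚ) → ℕ → (ℕ → ℕ) → ℚ
  ∏< ρ n f = ∏ ρ (applyUpTo f n)

  ∏<-cong : ∀ ρ n {f g} → (∀ i → i ℕ.< n → f i ≡ g i) → ∏< ρ n f ≡ ∏< ρ n g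
  ∏<-cong ρ zero    e = refl
  ∏<-cong ρ (suc n) e = cong₂ (λ a b → ρ a * b) (e 0 (s≤s z≤n)) (∏<-cong ρ n (λ i i<n → e (suc i) (s≤s i<n)))

  ∏<-split : ∀ ρ m n f → ∏< ρ (m ℕ.+ n) f ≡ ∏< ρ m f * ∏< ρ n (λ i → f (m ℕ.+ i))
  ∏<-split ρ zero    n f = sym (*-identityˡ _)
  ∏<-split ρ (suc m) n f = trans (cong (ρ (f 0) *_) (∏<-split ρ m n (f ∘ suc))) (sym (*-assoc (ρ (f 0)) _ _))

  countGt-zero : ∀ {r} j → Decreasing r → hd r ℕ.≤ j → countGt j r ≡ 0
  countGt-zero j []      p = refl
  countGt-zero j (_∷_ {a} {r} q d) p with j <ᵇ a in eq
  ... | true  = ⊥-elim (ℕ.<-irrefl refl (ℕ.<-≤-trans (ℕ.<ᵇ⇒< j a (subst T (sym eq) tt)) p))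
  ... | false = countGt-zero j d (ℕ.≤-trans q p)

  countGt-∷-< : ∀ j b r → j ℕ.< b → countGt j (b ∷ r) ≡ suc (countGt j r)
  countGt-∷-< j b r j<b with j <ᵇ b in eq
  ... | true  = refl
  ... | false = ⊥-elim (subst T eq (ℕ.<⇒<ᵇ j<b))

  -- q plays the role of 1/x, and ρ k that of 1/(1 − x^k).
  module Specialisation (x q : ℚ) (xq≡1 : x * q ≡ 1ℚ) (ρ : ℕ → ℚ)
                        (ρ-inverse : ∀ k → (1ℚ - (x ^ℚ suc k)) * ρ (suc k) ≡ 1ℚ) where

    h : ℕ → ℚ
    h zero    = 1ℚ
    h (suc k) = h k * ρ (suc k)

    h-step : ∀ k → (1ℚ - (x ^ℚ suc k)) * h (suc k) ≡ h k
    h-step k = trans (rearrange (1ℚ - (x ^ℚ suc k)) (h k) (ρ (suc k))) (trans (cong (h k *_) (ρ-inverse k)) (*-identityʳ (h k)))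
      where
      rearrange : ∀ a b c → a * (b * c) ≡ b * (a * c)
      rearrange = solve-∀ ℚ-ring

    row-hooks : ℕ → List ℕ → ℕ → ℕ
    row-hooks a r j = (a ℕ.∸ j) ℕ.+ countGt j r

    row : ℕ → List ℕ → ℚ
    row a r = ∏< ρ a (row-hooks a r)

    -- The factors x^|r| taken over all tails r multiply to x^(n(κ)): a row with i rows above it is
    -- counted i times.
    g : List ℕ → ℚ
    g []      = 1ℚ
    g (a ∷ r) = (x ^ℚ sumℕ r) * row a r * g r

    ∏<-arms : ∀ d → ∏< ρ d (d ℕ.∸_) ≡ h d
    ∏<-arms zero    = refl
    ∏<-arms (suc d) = trans (*-comm (ρ (suc d)) _) (cong (_* ρ (suc d)) (∏<-arms d))

    row-[] : ∀ a → row a [] ≡ h a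
    row-[] a = trans (∏<-cong ρ a (λ j _ → ℕ.+-identityʳ (a ℕ.∸ j))) (∏<-arms a)

    -- Shortening the top row by one box while inserting a row of length `b` below it lowers each
    -- arm by one and raises the leg by one in the first `b` columns, so those hooks agree. Beyond
    -- them the hooks are the arms plus one, running from `d + 1` down on one side and from `d` down
    -- on the other.
    row-∷ : ∀ d b r → Decreasing r → hd r ℕ.≤ b →
            (1ℚ - (x ^ℚ suc d)) * row (suc (b ℕ.+ d)) r ≡ row (b ℕ.+ d) (b ∷ r)
    row-∷ d b r dec p = begin
      (1ℚ - (x ^ℚ suc d)) * ∏< ρ (suc (b ℕ.+ d)) F
        ≡⟨ cong (λ n → (1ℚ - (x ^ℚ suc d)) * ∏< ρ n F) (ℕ.+-suc b d) ⟨
      (1ℚ - (x ^ℚ suc d)) * ∏< ρ (b ℕ.+ suc d) F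
        ≡⟨ cong ((1ℚ - (x ^ℚ suc d)) *_) (∏<-split ρ b (suc d) F) ⟩
      (1ℚ - (x ^ℚ suc d)) * (∏< ρ b F * ∏< ρ (suc d) (λ i → F (b ℕ.+ i)))
        ≡⟨ cong (λ z → (1ℚ - (x ^ℚ suc d)) * (∏< ρ b F * z)) (trans (∏<-cong ρ (suc d) (λ i _ → tail-F i)) (∏<-arms (suc d))) ⟩
      (1ℚ - (x ^ℚ suc d)) * (∏< ρ b F * h (suc d))
        ≡⟨ rearrange (1ℚ - (x ^ℚ suc d)) (∏< ρ b F) (h (suc d)) ⟩
      ∏< ρ b F * ((1ℚ - (x ^ℚ suc d)) * h (suc d))
        ≡⟨ cong₂ _*_ (∏<-cong ρ b head-FG) (trans (h-step d) (sym (trans (∏<-cong ρ d (λ i _ → tail-G i)) (∏<-arms d)))) ⟩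
      ∏< ρ b G * ∏< ρ d (λ i → G (b ℕ.+ i))
        ≡⟨ ∏<-split ρ b d G ⟨
      ∏< ρ (b ℕ.+ d) G ∎
      where
      F G : ℕ → ℕ
      F = row-hooks (suc (b ℕ.+ d)) r
      G = row-hooks (b ℕ.+ d) (b ∷ r)
      rearrange : ∀ a b c → a * (b * c) ≡ b * (a * c)
      rearrange = solve-∀ ℚ-ring
      zero-count : ∀ i → countGt (b ℕ.+ i) r ≡ 0
      zero-count i = countGt-zero (b ℕ.+ i) dec (ℕ.≤-trans p (ℕ.m≤m+n b i))
      tail-F : ∀ i → F (b ℕ.+ i) ≡ suc d ℕ.∸ i
      tail-F i = trans (cong₂ ℕ._+_ (trans (cong (ℕ._∸ (b ℕ.+ i)) (sym (ℕ.+-suc b d))) (ℕ.[m+n]∸[m+o]≡n∸o b (suc d) i)) (zero-count i))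
                       (ℕ.+-identityʳ _)
      tail-G : ∀ i → G (b ℕ.+ i) ≡ d ℕ.∸ i
      tail-G i = trans (cong₂ ℕ._+_ (ℕ.[m+n]∸[m+o]≡n∸o b d i) (countGt-zero (b ℕ.+ i) (p ∷ dec) (ℕ.m≤m+n b i)))
                       (ℕ.+-identityʳ _)
      head-FG : ∀ j → j ℕ.< b → F j ≡ G j
      head-FG j j<b = begin
        suc (b ℕ.+ d) ℕ.∸ j ℕ.+ countGt j r     ≡⟨ cong (ℕ._+ countGt j r) (ℕ.+-∸-assoc 1 (ℕ.≤-trans (ℕ.<⇒≤ j<b) (ℕ.m≤m+n b d))) ⟩
        suc (b ℕ.+ d ℕ.∸ j) ℕ.+ countGt j r     ≡⟨ ℕ.+-suc (b ℕ.+ d ℕ.∸ j) (countGt j r) ⟨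
        b ℕ.+ d ℕ.∸ j ℕ.+ suc (countGt j r)     ≡⟨ cong (b ℕ.+ d ℕ.∸ j ℕ.+_) (countGt-∷-< j b r j<b) ⟨
        b ℕ.+ d ℕ.∸ j ℕ.+ countGt j (b ∷ r)     ∎

    -- With β = `a + length r`, the hooks of the first row are 1, ..., β without the differences β -
    -- m for the later beta-numbers m. The induction removes the second row and lengthens the first
    -- by one box, which leaves β unchanged.
    row-beta : ∀ a r → Decreasing (a ∷ r) →
               h (a ℕ.+ length r) * ∏ (λ m → (x ^ℚ m) - (x ^ℚ (a ℕ.+ length r))) (beta r) ≡ row a r * (x ^ℚ sumℕ (beta r))
    row-beta a []      d = cong (_* 1ℚ) (trans (cong h (ℕ.+-identityʳ a)) (sym (row-[] a)))
    row-beta a (b ∷ r) (b≤a ∷ (p ∷ d)) with ℕ.m≤n⇒∃[o]m+o≡n b≤a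
    ... | e , refl = begin
      h A * ((X - (x ^ℚ A)) * ∏ (λ m → (x ^ℚ m) - (x ^ℚ A)) (beta r))
        ≡⟨ cong (λ k → h k * ((X - (x ^ℚ k)) * ∏ (λ m → (x ^ℚ m) - (x ^ℚ k)) (beta r))) (ℕ.+-suc (b ℕ.+ e) (length r)) ⟩
      h A′ * ((X - (x ^ℚ A′)) * ∏ (λ m → (x ^ℚ m) - (x ^ℚ A′)) (beta r))
        ≡⟨ rearrange (h A′) X (x ^ℚ A′) _ ⟩
      (X - (x ^ℚ A′)) * (h A′ * ∏ (λ m → (x ^ℚ m) - (x ^ℚ A′)) (beta r))
        ≡⟨ cong₂ (λ u v → (X - u) * v) power-split (row-beta (suc (b ℕ.+ e)) r (ℕ.≤-trans p (ℕ.≤-trans b≤a (ℕ.n≤1+n (b ℕ.+ e))) ∷ d)) ⟩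
      (X - (x ^ℚ suc e) * X) * (row (suc (b ℕ.+ e)) r * (x ^ℚ sumℕ (beta r)))
        ≡⟨ factor X (x ^ℚ suc e) _ _ ⟩
      (1ℚ - (x ^ℚ suc e)) * row (suc (b ℕ.+ e)) r * (X * (x ^ℚ sumℕ (beta r)))
        ≡⟨ cong₂ _*_ (row-∷ e b r d p) (sym (^ℚ-+ x (b ℕ.+ length r) (sumℕ (beta r)))) ⟩
      row (b ℕ.+ e) (b ∷ r) * (x ^ℚ (b ℕ.+ length r ℕ.+ sumℕ (beta r))) ∎
      where
      X = x ^ℚ (b ℕ.+ length r)
      A = b ℕ.+ e ℕ.+ suc (length r)
      A′ = suc (b ℕ.+ e) ℕ.+ length r
      rearrange : ∀ h y z p → h * ((y - z) * p) ≡ (y - z) * (h * p)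
      rearrange = solve-∀ ℚ-ring
      factor : ∀ y z u v → (y - z * y) * (u * v) ≡ (1ℚ - z) * u * (y * v)
      factor = solve-∀ ℚ-ring
      exponent : ∀ b e l → suc (b ℕ.+ e) ℕ.+ l ≡ suc e ℕ.+ (b ℕ.+ l)
      exponent = ℕ-solve-∀
      power-split : (x ^ℚ A′) ≡ (x ^ℚ suc e) * X
      power-split = trans (cong (x ^ℚ_) (exponent b e (length r))) (^ℚ-+ x (suc e) (b ℕ.+ length r))

    -- Each row contributes x to the sum of the later beta-numbers where `g` has x to the sum of the
    -- later parts; the surplus `triangle` exponents add up to `tetrahedron`.
    vandermonde-g : ∀ κ → Decreasing κ → vandermonde x h (beta κ) ≡ (x ^ℚ tetrahedron (length κ)) * g κ
    vandermonde-g []      d           = refl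
    vandermonde-g (a ∷ r) (p ∷ d) = begin
      h (a ℕ.+ ℓ) * ∏ (λ m → (x ^ℚ m) - (x ^ℚ (a ℕ.+ ℓ))) (beta r) * vandermonde x h (beta r)
        ≡⟨ cong₂ _*_ (row-beta a r (p ∷ d)) (vandermonde-g r d) ⟩
      row a r * (x ^ℚ sumℕ (beta r)) * ((x ^ℚ tetrahedron ℓ) * g r)
        ≡⟨ cong (λ z → row a r * z * ((x ^ℚ tetrahedron ℓ) * g r)) (trans (cong (x ^ℚ_) (sum-beta r)) (^ℚ-+ x (sumℕ r) (triangle ℓ))) ⟩
      row a r * ((x ^ℚ sumℕ r) * (x ^ℚ triangle ℓ)) * ((x ^ℚ tetrahedron ℓ) * g r)
        ≡⟨ rearrange (row a r) (x ^ℚ sumℕ r) (x ^ℚ triangle ℓ) (x ^ℚ tetrahedron ℓ) (g r) ⟩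
      (x ^ℚ triangle ℓ) * (x ^ℚ tetrahedron ℓ) * ((x ^ℚ sumℕ r) * row a r * g r)
        ≡⟨ cong (_* g (a ∷ r)) (^ℚ-+ x (triangle ℓ) (tetrahedron ℓ)) ⟨
      (x ^ℚ tetrahedron (suc ℓ)) * g (a ∷ r) ∎
      where
      ℓ = length r
      rearrange : ∀ r s t u g → r * (s * t) * (u * g) ≡ t * u * (s * r * g)
      rearrange = solve-∀ ℚ-ring

    -- The shift of `h`, extended by 0. This value at 0 is forced by `h′-h`, and it makes the lower
    -- boundary term of the last row vanish.
    h′ : ℕ → ℚ
    h′ zero    = 0ℚ
    h′ (suc m) = h m

    h′-h : ∀ m → h′ m ≡ (1ℚ - (x ^ℚ m)) * h m
    h′-h zero    = refl
    h′-h (suc m) = sym (h-step m)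

    vandermonde-suc : ∀ ls → vandermonde x h′ (map suc ls) ≡ (x ^ℚ triangle (length ls)) * vandermonde x h ls
    vandermonde-suc []       = refl
    vandermonde-suc (l ∷ ls) = begin
      h l * ∏ (λ m → (x ^ℚ m) - (x ^ℚ suc l)) (map suc ls) * vandermonde x h′ (map suc ls)
        ≡⟨ cong₂ (λ a b → h l * a * b) (pull ls) (vandermonde-suc ls) ⟩
      h l * ((x ^ℚ length ls) * ∏ (λ m → (x ^ℚ m) - (x ^ℚ l)) ls) * ((x ^ℚ triangle (length ls)) * vandermonde x h ls)
        ≡⟨ rearrange (h l) (x ^ℚ length ls) _ (x ^ℚ triangle (length ls)) _ ⟩
      (x ^ℚ length ls) * (x ^ℚ triangle (length ls)) * vandermonde x h (l ∷ ls)
        ≡⟨ cong (_* vandermonde x h (l ∷ ls)) (^ℚ-+ x (length ls) (triangle (length ls))) ⟨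
      (x ^ℚ triangle (suc (length ls))) * vandermonde x h (l ∷ ls) ∎
      where
      rearrange : ∀ h y p z v → h * (y * p) * (z * v) ≡ y * z * (h * p * v)
      rearrange = solve-∀ ℚ-ring
      pull′ : ∀ y z w u v → (y * z - y * w) * (u * v) ≡ y * u * ((z - w) * v)
      pull′ = solve-∀ ℚ-ring
      pull : ∀ ms → ∏ (λ m → (x ^ℚ m) - (x ^ℚ suc l)) (map suc ms) ≡ (x ^ℚ length ms) * ∏ (λ m → (x ^ℚ m) - (x ^ℚ l)) ms
      pull []       = refl
      pull (m ∷ ms) = trans (cong (((x ^ℚ suc m) - (x ^ℚ suc l)) *_) (pull ms)) (pull′ x (x ^ℚ m) (x ^ℚ l) (x ^ℚ length ms) _)

    ^ℚ-inverse : ∀ n → (q ^ℚ n) * (x ^ℚ n) ≡ 1ℚ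
    ^ℚ-inverse zero    = refl
    ^ℚ-inverse (suc n) = trans (rearrange q (q ^ℚ n) x (x ^ℚ n)) (trans (cong₂ _*_ xq≡1 (^ℚ-inverse n)) refl)
      where
      rearrange : ∀ a b c d → a * b * (c * d) ≡ c * a * (b * d)
      rearrange = solve-∀ ℚ-ring

    ^ℚ-cancel : ∀ n {a b} → (x ^ℚ n) * a ≡ (x ^ℚ n) * b → a ≡ b
    ^ℚ-cancel n {a} {b} e = trans (restore a) (trans (cong ((q ^ℚ n) *_) e) (sym (restore b)))
      where
      restore : ∀ a → a ≡ (q ^ℚ n) * ((x ^ℚ n) * a)
      restore a = sym (trans (sym (*-assoc (q ^ℚ n) (x ^ℚ n) a)) (trans (cong (_* a) (^ℚ-inverse n)) (*-identityˡ a)))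

    -- After multiplication by `C` the summand is a mixed difference: x^|ν| and x^triangle combine
    -- to x^(sum of the beta-numbers), the factor produced by `Δ-vandermonde`. The sum telescopes to
    -- the beta-numbers of κ raised by one, and lowering them again costs x^triangle. Cancelling `C`
    -- is possible because x is invertible.
    branching : ∀ M κ → Decreasing κ → hd κ ℕ.< M →
                ΣBox M (length κ) (λ ν → ⟦ κ ≻ ν ⟧ * ((x ^ℚ sumℕ ν) * g ν)) ≡ g κ
    branching M κ d κ<M = ^ℚ-cancel (triangle ℓ ℕ.+ tetrahedron ℓ) (begin
      C * ΣBox M ℓ (λ ν → ⟦ κ ≻ ν ⟧ * ((x ^ℚ sumℕ ν) * g ν))
        ≡⟨ ΣBox-* M ℓ C _ ⟨
      ΣBox M ℓ (λ ν → C * (⟦ κ ≻ ν ⟧ * ((x ^ℚ sumℕ ν) * g ν)))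
        ≡⟨ ΣBox-ext M ℓ (λ ν → commute C ⟦ κ ≻ ν ⟧ _) ⟩
      ΣBox M ℓ (λ ν → ⟦ κ ≻ ν ⟧ * (C * ((x ^ℚ sumℕ ν) * g ν)))
        ≡⟨ ΣBox-⟦⟧-cong M ℓ (κ ≻_) difference ⟩
      ΣBox M ℓ (λ ν → ⟦ κ ≻ ν ⟧ * Δ (vandermonde x h′) (beta ν))
        ≡⟨ Δ-telescope M κ (vandermonde x h′) d κ<M (vandermonde-repeat x h′) (vandermonde-end x h′ refl) ⟩
      vandermonde x h′ (map suc (beta κ))
        ≡⟨ vandermonde-suc (beta κ) ⟩
      (x ^ℚ triangle (length (beta κ))) * vandermonde x h (beta κ)
        ≡⟨ cong₂ (λ a b → (x ^ℚ triangle a) * b) (length-beta κ) (vandermonde-g κ d) ⟩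
      (x ^ℚ triangle ℓ) * ((x ^ℚ tetrahedron ℓ) * g κ)
        ≡⟨ *-assoc (x ^ℚ triangle ℓ) (x ^ℚ tetrahedron ℓ) (g κ) ⟨
      (x ^ℚ triangle ℓ) * (x ^ℚ tetrahedron ℓ) * g κ
        ≡⟨ cong (_* g κ) (^ℚ-+ x (triangle ℓ) (tetrahedron ℓ)) ⟨
      C * g κ ∎)
      where
      ℓ = length κ
      C = x ^ℚ (triangle ℓ ℕ.+ tetrahedron ℓ)
      commute : ∀ c b y → c * (b * y) ≡ b * (c * y)
      commute = solve-∀ ℚ-ring
      rearrange : ∀ t u s g → t * u * (s * g) ≡ s * t * (u * g)
      rearrange = solve-∀ ℚ-ring
      difference : ∀ ν → Box M ℓ ν → T (κ ≻ ν) → C * ((x ^ℚ sumℕ ν) * g ν) ≡ Δ (vandermonde x h′) (beta ν)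
      difference ν bx t = begin
        C * ((x ^ℚ sumℕ ν) * g ν)
          ≡⟨ cong (_* ((x ^ℚ sumℕ ν) * g ν)) (^ℚ-+ x (triangle ℓ) (tetrahedron ℓ)) ⟩
        (x ^ℚ triangle ℓ) * (x ^ℚ tetrahedron ℓ) * ((x ^ℚ sumℕ ν) * g ν)
          ≡⟨ rearrange (x ^ℚ triangle ℓ) (x ^ℚ tetrahedron ℓ) (x ^ℚ sumℕ ν) (g ν) ⟩
        (x ^ℚ sumℕ ν) * (x ^ℚ triangle ℓ) * ((x ^ℚ tetrahedron ℓ) * g ν)
          ≡⟨ cong₂ _*_ (sym (^ℚ-+ x (sumℕ ν) (triangle ℓ))) (cong (λ k → (x ^ℚ tetrahedron k) * g ν) (sym (Box-length bx))) ⟩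
        (x ^ℚ (sumℕ ν ℕ.+ triangle ℓ)) * ((x ^ℚ tetrahedron (length ν)) * g ν)
          ≡⟨ cong₂ _*_ (cong (x ^ℚ_) (trans (cong (λ k → sumℕ ν ℕ.+ triangle k) (sym (Box-length bx))) (sym (sum-beta ν))))
                       (sym (vandermonde-g ν (≻-decreasingʳ κ ν t))) ⟩
        (x ^ℚ sumℕ (beta ν)) * vandermonde x h (beta ν)
          ≡⟨ Δ-vandermonde x h h′ (λ _ → refl) h′-h (beta ν) ⟨
        Δ (vandermonde x h′) (beta ν) ∎

-- Fomin's local rule and the Pieri rule.

module Pieri where

  open Base
  open import Defs using (_^ℚ_; sumℕ)
  open Partition
  open Principal
  open import Data.Bool using (Bool; true; false; _∧_; T)
  open import Data.List using (List; []; _∷_)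
  open import Data.Nat as ℕ using (ℕ; zero; suc; z≤n; s≤s; _≤ᵇ_; _≡ᵇ_; _⊔_; _⊓_)
  import Data.Nat.Properties as ℕ
  open import Data.Nat.Induction using (<-rec)
  open import Data.Nat.Tactic.RingSolver using () renaming (solve-∀ to ℕ-solve-∀)
  open import Data.Product using (_,_; proj₁; proj₂)
  open import Data.Sum using (inj₁; inj₂)
  open import Data.Rational using (ℚ; 0ℚ; 1ℚ; _+_; _*_; _-_; -_)
  open import Data.Rational.Properties using (*-zeroʳ; *-identityˡ; *-identityʳ; +-identityʳ; +-identityˡ; *-assoc)
  open import Data.Unit using (tt)
  open import Data.Empty using (⊥-elim)
  open import Function using (_∘_)
  open import Relation.Binary.PropositionalEquality
  open import Relation.Nullary using (¬_)
  open import Tactic.RingSolver using (solve-∀)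
  open ≡-Reasoning

  ⟦⟧-true : ∀ {b} → T b → ⟦ b ⟧ ≡ 1ℚ
  ⟦⟧-true {true} _ = refl

  ⟦⟧-false : ∀ {b} → ¬ T b → ⟦ b ⟧ ≡ 0ℚ
  ⟦⟧-false {true}  f = ⊥-elim (f tt)
  ⟦⟧-false {false} _ = refl

  -- (a ∷ κ) ⊐ μ compares shapes with one row more and one row less: κ / μ is a horizontal strip.
  _⊐_ : List ℕ → List ℕ → Bool
  []      ⊐ μ = false
  (a ∷ κ) ⊐ μ = (hd μ ≤ᵇ a) ∧ (μ ≻ κ)

  ⊐-decreasingʳ : ∀ κ μ → T (κ ⊐ μ) → Decreasing μ
  ⊐-decreasingʳ (a ∷ κ) μ t = ≻-decreasingˡ μ κ (proj₂ (T-∧⁻ (hd μ ≤ᵇ a) t))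

  ⊐-decreasingˡ : ∀ κ μ → T (κ ⊐ μ) → Decreasing κ
  ⊐-decreasingˡ (a ∷ κ) μ t with T-∧⁻ (hd μ ≤ᵇ a) t
  ... | p , q = ℕ.≤-trans (≻-hd μ κ q) (ℕ.≤ᵇ⇒≤ (hd μ) a p) ∷ ≻-decreasingʳ μ κ q

  ≻-size-hd : ∀ κ ν → T (κ ≻ ν) → sumℕ κ ℕ.≤ hd κ ℕ.+ sumℕ ν
  ≻-size-hd []      []      t = z≤n
  ≻-size-hd (b ∷ κ) (c ∷ ν) t with T-∧⁻ (range (hd κ) b c) t
  ... | p , q = ℕ.+-monoʳ-≤ b (ℕ.≤-trans (≻-size-hd κ ν q) (ℕ.+-monoˡ-≤ (sumℕ ν) (proj₁ (T-range (hd κ) b c p))))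

  ⊐-size : ∀ κ μ → T (κ ⊐ μ) → sumℕ μ ℕ.≤ sumℕ κ
  ⊐-size (a ∷ κ) μ t with T-∧⁻ (hd μ ≤ᵇ a) t
  ... | p , q = ℕ.≤-trans (≻-size-hd μ κ q) (ℕ.+-monoˡ-≤ (sumℕ κ) (ℕ.≤ᵇ⇒≤ (hd μ) a p))

  -- Besides describing the common lower neighbours of μ and `c ∷ ν`, this is the exact condition on
  -- the tail κ of a common upper neighbour `a ∷ κ`; the first row then only has to satisfy
  -- `hd μ ≤ a` and `c ≤ a`. Hence one set parametrises both sides of the local rule.
  between : List ℕ → ℕ → List ℕ → List ℕ → Bool
  between μ c ν κ = (μ ≻ κ) ∧ ((c ∷ ν) ⊐ κ)

  -- The inequalities linking `k` to the next row of κ are traded for inequalities with μ and ν, so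
  -- each row of κ has its own interval, independent of the others.
  between-∷ : ∀ a μ c n ν k κ →
              between (a ∷ μ) c (n ∷ ν) (k ∷ κ) ≡ range (hd μ ⊔ n) (a ⊓ c) k ∧ between μ n ν κ
  between-∷ a μ c n ν k κ = T-≡ to from
    where
    to : T (between (a ∷ μ) c (n ∷ ν) (k ∷ κ)) → T (range (hd μ ⊔ n) (a ⊓ c) k ∧ between μ n ν κ)
    to t with T-∧⁻ ((a ∷ μ) ≻ (k ∷ κ)) t
    ... | t₁ , t₂ with T-∧⁻ (range (hd μ) a k) t₁ | T-∧⁻ (k ≤ᵇ c) t₂
    ... | p , μκ | k≤c , t₃ with T-∧⁻ (range (hd κ) k n) t₃
    ... | r , κν with T-range (hd μ) a k p | T-range (hd κ) k n r
    ... | μ≤k , k≤a | κ≤n , n≤k =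
      T-∧⁺ (range (hd μ ⊔ n) (a ⊓ c) k) (range⁺ {hd μ ⊔ n} (ℕ.⊔-lub μ≤k n≤k) (ℕ.⊓-glb k≤a (ℕ.≤ᵇ⇒≤ k c k≤c)))
        (T-∧⁺ (μ ≻ κ) μκ (T-∧⁺ (hd κ ≤ᵇ n) (ℕ.≤⇒≤ᵇ κ≤n) κν))
    from : T (range (hd μ ⊔ n) (a ⊓ c) k ∧ between μ n ν κ) → T (between (a ∷ μ) c (n ∷ ν) (k ∷ κ))
    from t with T-∧⁻ (range (hd μ ⊔ n) (a ⊓ c) k) t
    ... | p , t₁ with T-range (hd μ ⊔ n) (a ⊓ c) k p | T-∧⁻ (μ ≻ κ) t₁
    ... | l , u | μκ , t₂ with T-∧⁻ (hd κ ≤ᵇ n) t₂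
    ... | κ≤n , κν =
      T-∧⁺ ((a ∷ μ) ≻ (k ∷ κ))
        (T-∧⁺ (range (hd μ) a k) (range⁺ {hd μ} (ℕ.m⊔n≤o⇒m≤o (hd μ) n l) (ℕ.m≤n⊓o⇒m≤n a c u)) μκ)
        (T-∧⁺ (k ≤ᵇ c) (ℕ.≤⇒≤ᵇ (ℕ.m≤n⊓o⇒m≤o a c u))
          (T-∧⁺ (range (hd κ) k n) (range⁺ {hd κ} (ℕ.≤ᵇ⇒≤ (hd κ) n κ≤n) (ℕ.m⊔n≤o⇒n≤o (hd μ) n l)) κν))

  Σbetween-∷ : ∀ M ℓ a μ c n ν (F : List ℕ → ℚ) →
    ΣBox M (suc ℓ) (λ κ → ⟦ between (a ∷ μ) c (n ∷ ν) κ ⟧ * F κ)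
    ≡ Σ< M (λ k → ⟦ range (hd μ ⊔ n) (a ⊓ c) k ⟧ * ΣBox M ℓ (λ κ → ⟦ between μ n ν κ ⟧ * F (k ∷ κ)))
  Σbetween-∷ M ℓ a μ c n ν F = Σ<-ext M λ k → trans
    (ΣBox-ext M ℓ (λ κ → trans (cong (_* F (k ∷ κ)) (trans (cong ⟦_⟧ (between-∷ a μ c n ν k κ)) (⟦⟧-∧ (range (hd μ ⊔ n) (a ⊓ c) k) (between μ n ν κ))))
                               (*-assoc ⟦ range (hd μ ⊔ n) (a ⊓ c) k ⟧ ⟦ between μ n ν κ ⟧ (F (k ∷ κ)))))
    (ΣBox-* M ℓ ⟦ range (hd μ ⊔ n) (a ⊓ c) k ⟧ (λ κ → ⟦ between μ n ν κ ⟧ * F (k ∷ κ)))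

  -- The common upper and lower neighbours of two partitions are exchanged by
  -- reflecting every row of κ in the interval it ranges over.
  between-reflect : ∀ M {ℓ μ ν} (Θ : ℕ → ℕ → ℚ) → (∀ d z e → Θ (z ℕ.+ d) (e ℕ.+ d) ≡ Θ z e) →
    ∀ c e → Box M ℓ μ → Box M ℓ ν →
    ΣBox M ℓ (λ κ → ⟦ between μ c ν κ ⟧ * Θ (hd μ ⊔ c ℕ.+ sumℕ κ) e)
    ≡ ΣBox M ℓ (λ κ → ⟦ between μ c ν κ ⟧ * Θ (sumℕ μ ℕ.+ (c ℕ.+ sumℕ ν)) (e ℕ.+ sumℕ κ))
  between-reflect M Θ shift c e [] [] = cong (1ℚ *_) (cong (Θ (c ℕ.+ 0)) (sym (ℕ.+-identityʳ e)))
  between-reflect M {suc ℓ} {a ∷ μ} {n ∷ ν} Θ shift c e (a<M ∷ bμ) (_ ∷ bν) = begin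
    ΣBox M (suc ℓ) (λ κ → ⟦ between (a ∷ μ) c (n ∷ ν) κ ⟧ * Θ (mx ℕ.+ sumℕ κ) e)
      ≡⟨ Σbetween-∷ M ℓ a μ c n ν (λ κ → Θ (mx ℕ.+ sumℕ κ) e) ⟩
    Σ< M (λ k → ⟦ range lo hi k ⟧ * ΣBox M ℓ (λ κ → ⟦ w κ ⟧ * Θ (mx ℕ.+ (k ℕ.+ sumℕ κ)) e))
      ≡⟨ Σ<-range-cong M lo hi (λ k _ l u → inner k u) ⟩
    Σ< M (λ k → ⟦ range lo hi k ⟧ * S (lo ℕ.+ hi ℕ.∸ k))
      ≡⟨ Σ<-range-reflect M lo hi (λ _ k → S k) (ℕ.≤-<-trans (ℕ.m⊓n≤m a c) a<M) ⟩
    Σ< M (λ k → ⟦ range lo hi k ⟧ * S k)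
      ≡⟨ Σbetween-∷ M ℓ a μ c n ν (λ κ → Θ (a ℕ.+ sumℕ μ ℕ.+ (c ℕ.+ (n ℕ.+ sumℕ ν))) (e ℕ.+ sumℕ κ)) ⟨
    ΣBox M (suc ℓ) (λ κ → ⟦ between (a ∷ μ) c (n ∷ ν) κ ⟧ * Θ (a ℕ.+ sumℕ μ ℕ.+ (c ℕ.+ (n ℕ.+ sumℕ ν))) (e ℕ.+ sumℕ κ)) ∎
    where
    mx = a ⊔ c
    lo = hd μ ⊔ n
    hi = a ⊓ c
    w : List ℕ → Bool
    w = between μ n ν
    S : ℕ → ℚ
    S k = ΣBox M ℓ (λ κ → ⟦ w κ ⟧ * Θ (a ℕ.+ sumℕ μ ℕ.+ (c ℕ.+ (n ℕ.+ sumℕ ν))) (e ℕ.+ (k ℕ.+ sumℕ κ)))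
    regroup₁ : ∀ m k s d → m ℕ.+ (k ℕ.+ s) ℕ.+ d ≡ m ℕ.+ ((k ℕ.+ d) ℕ.+ s)
    regroup₁ = ℕ-solve-∀
    regroup₂ : ∀ m l h s → m ℕ.+ (l ℕ.+ h ℕ.+ s) ≡ m ℕ.+ h ℕ.+ (l ℕ.+ s)
    regroup₂ = ℕ-solve-∀
    regroup₃ : ∀ a c m n v → a ℕ.+ c ℕ.+ (m ℕ.+ (n ℕ.+ v)) ≡ a ℕ.+ m ℕ.+ (c ℕ.+ (n ℕ.+ v))
    regroup₃ = ℕ-solve-∀
    ⊔+⊓ : ∀ a c → a ⊔ c ℕ.+ a ⊓ c ≡ a ℕ.+ c
    ⊔+⊓ a c with ℕ.≤-total a c
    ... | inj₁ a≤c = trans (cong₂ ℕ._+_ (ℕ.m≤n⇒m⊔n≡n a≤c) (ℕ.m≤n⇒m⊓n≡m a≤c)) (ℕ.+-comm c a)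
    ... | inj₂ c≤a = cong₂ ℕ._+_ (ℕ.m≥n⇒m⊔n≡m c≤a) (ℕ.m≥n⇒m⊓n≡n c≤a)
    inner : ∀ k → k ℕ.≤ hi → ΣBox M ℓ (λ κ → ⟦ w κ ⟧ * Θ (mx ℕ.+ (k ℕ.+ sumℕ κ)) e) ≡ S (lo ℕ.+ hi ℕ.∸ k)
    inner k k≤hi = begin
      ΣBox M ℓ (λ κ → ⟦ w κ ⟧ * Θ (mx ℕ.+ (k ℕ.+ sumℕ κ)) e)
        -- `Θ` depends only on the difference of its arguments. Adding the mirror image of `k` to
        -- both turns `k` into `lo + hi`; here `lo` is the maximum needed for the next row, and
        -- `mx + hi` goes into the function for the induction hypothesis.
        ≡⟨ ΣBox-ext M ℓ (λ κ → cong (⟦ w κ ⟧ *_) (trans (sym (shift k̄ (mx ℕ.+ (k ℕ.+ sumℕ κ)) e)) (cong (λ z → Θ z (e ℕ.+ k̄)) (total κ)))) ⟩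
      ΣBox M ℓ (λ κ → ⟦ w κ ⟧ * Θ (mx ℕ.+ hi ℕ.+ (lo ℕ.+ sumℕ κ)) (e ℕ.+ k̄))
        ≡⟨ between-reflect M (λ z → Θ (mx ℕ.+ hi ℕ.+ z)) (λ d z e → trans (cong (λ y → Θ y (e ℕ.+ d)) (sym (ℕ.+-assoc (mx ℕ.+ hi) z d))) (shift d (mx ℕ.+ hi ℕ.+ z) e)) n (e ℕ.+ k̄) bμ bν ⟩
      ΣBox M ℓ (λ κ → ⟦ w κ ⟧ * Θ (mx ℕ.+ hi ℕ.+ (sumℕ μ ℕ.+ (n ℕ.+ sumℕ ν))) (e ℕ.+ k̄ ℕ.+ sumℕ κ))
        ≡⟨ ΣBox-ext M ℓ (λ κ → cong (⟦ w κ ⟧ *_) (cong₂ Θ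
             (trans (cong (ℕ._+ (sumℕ μ ℕ.+ (n ℕ.+ sumℕ ν))) (⊔+⊓ a c)) (regroup₃ a c (sumℕ μ) n (sumℕ ν)))
             (ℕ.+-assoc e k̄ (sumℕ κ)))) ⟩
      S k̄ ∎
      where
      k̄ = lo ℕ.+ hi ℕ.∸ k
      total : ∀ κ → mx ℕ.+ (k ℕ.+ sumℕ κ) ℕ.+ k̄ ≡ mx ℕ.+ hi ℕ.+ (lo ℕ.+ sumℕ κ)
      total κ = trans (regroup₁ mx k (sumℕ κ) k̄)
                  (trans (cong (λ z → mx ℕ.+ (z ℕ.+ sumℕ κ)) (ℕ.m+[n∸m]≡n (ℕ.≤-trans k≤hi (ℕ.m≤n+m hi lo))))
                         (regroup₂ mx lo hi (sumℕ κ)))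

  -- The size condition leaves only a = s - m, which lies in the range of summation because `s < M`;
  -- what remains is that it exists and is at least `p` and `c`.
  Σ<-first-row : ∀ M p c m s → s ℕ.< M →
                 Σ< M (λ a → ⟦ p ≤ᵇ a ⟧ * (⟦ c ≤ᵇ a ⟧ * ⟦ a ℕ.+ m ≡ᵇ s ⟧)) ≡ ⟦ p ⊔ c ℕ.+ m ≤ᵇ s ⟧
  Σ<-first-row M p c m s s<M with ℕ.≤-<-connex m s
  ... | inj₂ s<m = trans
    (trans (Σ<-ext M (λ a → *-zeroʳ′ ⟦ p ≤ᵇ a ⟧ (*-zeroʳ′ ⟦ c ≤ᵇ a ⟧ (⟦⟧-false (λ t → ℕ.<⇒≱ s<m (ℕ.≤-trans (ℕ.m≤n+m m a) (ℕ.≤-reflexive (ℕ.≡ᵇ⇒≡ (a ℕ.+ m) s t)))))))) (Σ<-0 M))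
    (sym (⟦⟧-false (λ t → ℕ.<⇒≱ s<m (ℕ.≤-trans (ℕ.m≤n+m m (p ⊔ c)) (ℕ.≤ᵇ⇒≤ (p ⊔ c ℕ.+ m) s t)))))
  ... | inj₁ m≤s with ℕ.m≤n⇒∃[o]m+o≡n m≤s
  ... | d , refl = begin
    Σ< M (λ a → ⟦ p ≤ᵇ a ⟧ * (⟦ c ≤ᵇ a ⟧ * ⟦ a ℕ.+ m ≡ᵇ m ℕ.+ d ⟧))
      ≡⟨ Σ<-single M d _ (ℕ.≤-<-trans (ℕ.m≤n+m d m) s<M) (λ a _ a≢d → *-zeroʳ′ ⟦ p ≤ᵇ a ⟧ (*-zeroʳ′ ⟦ c ≤ᵇ a ⟧ (⟦⟧-false (λ t → a≢d (ℕ.+-cancelʳ-≡ m a d (trans (ℕ.≡ᵇ⇒≡ (a ℕ.+ m) (m ℕ.+ d) t) (ℕ.+-comm m d))))))) ⟩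
    ⟦ p ≤ᵇ d ⟧ * (⟦ c ≤ᵇ d ⟧ * ⟦ d ℕ.+ m ≡ᵇ m ℕ.+ d ⟧)
      ≡⟨ cong (λ z → ⟦ p ≤ᵇ d ⟧ * (⟦ c ≤ᵇ d ⟧ * z)) (⟦⟧-true (ℕ.≡⇒≡ᵇ (d ℕ.+ m) (m ℕ.+ d) (ℕ.+-comm d m))) ⟩
    ⟦ p ≤ᵇ d ⟧ * (⟦ c ≤ᵇ d ⟧ * 1ℚ)
      ≡⟨ cong (⟦ p ≤ᵇ d ⟧ *_) (*-identityʳ ⟦ c ≤ᵇ d ⟧) ⟩
    ⟦ p ≤ᵇ d ⟧ * ⟦ c ≤ᵇ d ⟧
      ≡⟨ ⟦⟧-∧ (p ≤ᵇ d) (c ≤ᵇ d) ⟨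
    ⟦ (p ≤ᵇ d) ∧ (c ≤ᵇ d) ⟧
      ≡⟨ cong ⟦_⟧ (T-≡ to from) ⟩
    ⟦ p ⊔ c ℕ.+ m ≤ᵇ m ℕ.+ d ⟧ ∎
    where
    to : T ((p ≤ᵇ d) ∧ (c ≤ᵇ d)) → T (p ⊔ c ℕ.+ m ≤ᵇ m ℕ.+ d)
    to t with T-∧⁻ (p ≤ᵇ d) t
    ... | p≤d , c≤d = ℕ.≤⇒≤ᵇ (ℕ.≤-trans (ℕ.+-monoˡ-≤ m (ℕ.⊔-lub (ℕ.≤ᵇ⇒≤ p d p≤d) (ℕ.≤ᵇ⇒≤ c d c≤d))) (ℕ.≤-reflexive (ℕ.+-comm d m)))
    from : T (p ⊔ c ℕ.+ m ≤ᵇ m ℕ.+ d) → T ((p ≤ᵇ d) ∧ (c ≤ᵇ d))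
    from t = T-∧⁺ (p ≤ᵇ d) (ℕ.≤⇒≤ᵇ (ℕ.m⊔n≤o⇒m≤o p c q)) (ℕ.≤⇒≤ᵇ (ℕ.m⊔n≤o⇒n≤o p c q))
      where
      q : p ⊔ c ℕ.≤ d
      q = ℕ.+-cancelʳ-≤ m (p ⊔ c) d (ℕ.≤-trans (ℕ.≤ᵇ⇒≤ (p ⊔ c ℕ.+ m) (m ℕ.+ d) t) (ℕ.≤-reflexive (ℕ.+-comm m d)))

  -- Fomin's local rule.
  upper-neighbours : ∀ M {ℓ μ ν} c k → Box M ℓ μ → Box M ℓ ν → sumℕ μ ℕ.+ k ℕ.< M →
    ΣBox M (suc ℓ) (λ κ → ⟦ κ ⊐ μ ⟧ * (⟦ sumℕ κ ≡ᵇ sumℕ μ ℕ.+ k ⟧ * ⟦ κ ≻ (c ∷ ν) ⟧))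
    ≡ ΣBox M ℓ (λ κ → ⟦ μ ≻ κ ⟧ * (⟦ (c ∷ ν) ⊐ κ ⟧ * ⟦ c ℕ.+ sumℕ ν ≤ᵇ k ℕ.+ sumℕ κ ⟧))
  upper-neighbours M {ℓ} {μ} {ν} c k bμ bν s<M = begin
    Σ< M (λ a → ΣBox M ℓ (λ κ → ⟦ (a ∷ κ) ⊐ μ ⟧ * (⟦ a ℕ.+ sumℕ κ ≡ᵇ s ⟧ * ⟦ (a ∷ κ) ≻ (c ∷ ν) ⟧)))
      ≡⟨ ΣBox-Σ< M ℓ M (λ κ a → ⟦ (a ∷ κ) ⊐ μ ⟧ * (⟦ a ℕ.+ sumℕ κ ≡ᵇ s ⟧ * ⟦ (a ∷ κ) ≻ (c ∷ ν) ⟧)) ⟨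
    ΣBox M ℓ (λ κ → Σ< M (λ a → ⟦ (a ∷ κ) ⊐ μ ⟧ * (⟦ a ℕ.+ sumℕ κ ≡ᵇ s ⟧ * ⟦ (a ∷ κ) ≻ (c ∷ ν) ⟧)))
      ≡⟨ ΣBox-ext M ℓ (λ κ → trans (Σ<-ext M (λ a → split a κ)) (trans (Σ<-* M ⟦ between μ c ν κ ⟧ _) (cong (⟦ between μ c ν κ ⟧ *_) (Σ<-first-row M (hd μ) c (sumℕ κ) s s<M)))) ⟩
    ΣBox M ℓ (λ κ → ⟦ between μ c ν κ ⟧ * ⟦ hd μ ⊔ c ℕ.+ sumℕ κ ≤ᵇ s ⟧)
      ≡⟨ ΣBox-ext M ℓ (λ κ → cong (λ z → ⟦ between μ c ν κ ⟧ * ⟦ hd μ ⊔ c ℕ.+ sumℕ κ ≤ᵇ z ⟧) (sym (ℕ.+-identityʳ s))) ⟩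
    ΣBox M ℓ (λ κ → ⟦ between μ c ν κ ⟧ * Θ (hd μ ⊔ c ℕ.+ sumℕ κ) 0)
      ≡⟨ between-reflect M Θ shift c 0 bμ bν ⟩
    ΣBox M ℓ (λ κ → ⟦ between μ c ν κ ⟧ * Θ (sumℕ μ ℕ.+ (c ℕ.+ sumℕ ν)) (sumℕ κ))
      -- After the reflection |μ| occurs on both sides of the size inequality and cancels: the strip
      -- from κ to `c ∷ ν` has at most `k` boxes.
      ≡⟨ ΣBox-ext M ℓ (λ κ → trans (cong₂ _*_ (⟦⟧-∧ (μ ≻ κ) ((c ∷ ν) ⊐ κ)) (cong ⟦_⟧ (T-≡ (to κ) (from κ)))) (*-assoc ⟦ μ ≻ κ ⟧ ⟦ (c ∷ ν) ⊐ κ ⟧ ⟦ c ℕ.+ sumℕ ν ≤ᵇ k ℕ.+ sumℕ κ ⟧)) ⟩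
    ΣBox M ℓ (λ κ → ⟦ μ ≻ κ ⟧ * (⟦ (c ∷ ν) ⊐ κ ⟧ * ⟦ c ℕ.+ sumℕ ν ≤ᵇ k ℕ.+ sumℕ κ ⟧)) ∎
    where
    s = sumℕ μ ℕ.+ k
    Θ : ℕ → ℕ → ℚ
    Θ z e = ⟦ z ≤ᵇ s ℕ.+ e ⟧
    shift : ∀ d z e → Θ (z ℕ.+ d) (e ℕ.+ d) ≡ Θ z e
    shift d z e = cong ⟦_⟧ (T-≡ {z ℕ.+ d ≤ᵇ s ℕ.+ (e ℕ.+ d)}
      (λ t → ℕ.≤⇒≤ᵇ (ℕ.+-cancelʳ-≤ d z (s ℕ.+ e) (ℕ.≤-trans (ℕ.≤ᵇ⇒≤ (z ℕ.+ d) _ t) (ℕ.≤-reflexive (sym (ℕ.+-assoc s e d))))))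
      (λ t → ℕ.≤⇒≤ᵇ (ℕ.≤-trans (ℕ.+-monoˡ-≤ d (ℕ.≤ᵇ⇒≤ z _ t)) (ℕ.≤-reflexive (ℕ.+-assoc s e d)))))
    to : ∀ κ → T (sumℕ μ ℕ.+ (c ℕ.+ sumℕ ν) ≤ᵇ s ℕ.+ sumℕ κ) → T (c ℕ.+ sumℕ ν ≤ᵇ k ℕ.+ sumℕ κ)
    to κ t = ℕ.≤⇒≤ᵇ (ℕ.+-cancelˡ-≤ (sumℕ μ) _ _ (ℕ.≤-trans (ℕ.≤ᵇ⇒≤ (sumℕ μ ℕ.+ (c ℕ.+ sumℕ ν)) _ t) (ℕ.≤-reflexive (ℕ.+-assoc (sumℕ μ) k (sumℕ κ)))))
    from : ∀ κ → T (c ℕ.+ sumℕ ν ≤ᵇ k ℕ.+ sumℕ κ) → T (sumℕ μ ℕ.+ (c ℕ.+ sumℕ ν) ≤ᵇ s ℕ.+ sumℕ κ)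
    from κ t = ℕ.≤⇒≤ᵇ (ℕ.≤-trans (ℕ.+-monoʳ-≤ (sumℕ μ) (ℕ.≤ᵇ⇒≤ (c ℕ.+ sumℕ ν) _ t)) (ℕ.≤-reflexive (sym (ℕ.+-assoc (sumℕ μ) k (sumℕ κ)))))
    rearrange : ∀ p m e r u n → p * m * (e * (r * u * n)) ≡ m * (r * n) * (p * (u * e))
    rearrange = solve-∀ ℚ-ring
    split : ∀ a κ → ⟦ (a ∷ κ) ⊐ μ ⟧ * (⟦ a ℕ.+ sumℕ κ ≡ᵇ s ⟧ * ⟦ (a ∷ κ) ≻ (c ∷ ν) ⟧)
                    ≡ ⟦ between μ c ν κ ⟧ * (⟦ hd μ ≤ᵇ a ⟧ * (⟦ c ≤ᵇ a ⟧ * ⟦ a ℕ.+ sumℕ κ ≡ᵇ s ⟧))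
    split a κ = begin
      ⟦ (a ∷ κ) ⊐ μ ⟧ * (⟦ a ℕ.+ sumℕ κ ≡ᵇ s ⟧ * ⟦ (a ∷ κ) ≻ (c ∷ ν) ⟧)
        ≡⟨ cong₂ (λ y z → y * (⟦ a ℕ.+ sumℕ κ ≡ᵇ s ⟧ * z)) (⟦⟧-∧ (hd μ ≤ᵇ a) (μ ≻ κ))
             (trans (⟦⟧-∧ (range (hd κ) a c) (κ ≻ ν)) (cong (_* ⟦ κ ≻ ν ⟧) (⟦⟧-∧ (hd κ ≤ᵇ c) (c ≤ᵇ a)))) ⟩
      ⟦ hd μ ≤ᵇ a ⟧ * ⟦ μ ≻ κ ⟧ * (⟦ a ℕ.+ sumℕ κ ≡ᵇ s ⟧ * (⟦ hd κ ≤ᵇ c ⟧ * ⟦ c ≤ᵇ a ⟧ * ⟦ κ ≻ ν ⟧))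
        ≡⟨ rearrange ⟦ hd μ ≤ᵇ a ⟧ ⟦ μ ≻ κ ⟧ ⟦ a ℕ.+ sumℕ κ ≡ᵇ s ⟧ ⟦ hd κ ≤ᵇ c ⟧ ⟦ c ≤ᵇ a ⟧ ⟦ κ ≻ ν ⟧ ⟩
      ⟦ μ ≻ κ ⟧ * (⟦ hd κ ≤ᵇ c ⟧ * ⟦ κ ≻ ν ⟧) * (⟦ hd μ ≤ᵇ a ⟧ * (⟦ c ≤ᵇ a ⟧ * ⟦ a ℕ.+ sumℕ κ ≡ᵇ s ⟧))
        ≡⟨ cong (_* (⟦ hd μ ≤ᵇ a ⟧ * (⟦ c ≤ᵇ a ⟧ * ⟦ a ℕ.+ sumℕ κ ≡ᵇ s ⟧)))
             (trans (⟦⟧-∧ (μ ≻ κ) ((c ∷ ν) ⊐ κ)) (cong (⟦ μ ≻ κ ⟧ *_) (⟦⟧-∧ (hd κ ≤ᵇ c) (κ ≻ ν)))) ⟨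
      ⟦ between μ c ν κ ⟧ * (⟦ hd μ ≤ᵇ a ⟧ * (⟦ c ≤ᵇ a ⟧ * ⟦ a ℕ.+ sumℕ κ ≡ᵇ s ⟧)) ∎

  Σ<-sizes : ∀ k p d (F : ℕ → ℚ) → Σ< (suc k) (λ j → ⟦ p ℕ.+ d ≡ᵇ p ℕ.+ j ⟧ * F j) ≡ ⟦ p ℕ.+ d ≤ᵇ k ℕ.+ p ⟧ * F d
  Σ<-sizes k p d F with ℕ.≤-<-connex d k
  ... | inj₁ d≤k = begin
    Σ< (suc k) (λ j → ⟦ p ℕ.+ d ≡ᵇ p ℕ.+ j ⟧ * F j)
      ≡⟨ Σ<-single (suc k) d _ (s≤s d≤k) (λ j _ j≢d → *-zeroˡ′ (F j) (⟦⟧-false (λ t → j≢d (sym (ℕ.+-cancelˡ-≡ p d j (ℕ.≡ᵇ⇒≡ (p ℕ.+ d) _ t)))))) ⟩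
    ⟦ p ℕ.+ d ≡ᵇ p ℕ.+ d ⟧ * F d
      ≡⟨ cong (_* F d) (trans (⟦⟧-true (ℕ.≡⇒≡ᵇ (p ℕ.+ d) _ refl)) (sym (⟦⟧-true (ℕ.≤⇒≤ᵇ (ℕ.≤-trans (ℕ.+-monoʳ-≤ p d≤k) (ℕ.≤-reflexive (ℕ.+-comm p k))))))) ⟩
    ⟦ p ℕ.+ d ≤ᵇ k ℕ.+ p ⟧ * F d ∎
  ... | inj₂ k<d = begin
    Σ< (suc k) (λ j → ⟦ p ℕ.+ d ≡ᵇ p ℕ.+ j ⟧ * F j)
      ≡⟨ Σ<-cong (suc k) (λ j j≤k → *-zeroˡ′ (F j) (⟦⟧-false (λ t → ℕ.<⇒≢ (ℕ.≤-trans j≤k k<d) (sym (ℕ.+-cancelˡ-≡ p d j (ℕ.≡ᵇ⇒≡ (p ℕ.+ d) _ t)))))) ⟩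
    Σ< (suc k) (λ _ → 0ℚ)
      ≡⟨ Σ<-0 (suc k) ⟩
    0ℚ
      ≡⟨ *-zeroˡ′ (F d) (⟦⟧-false (λ t → ℕ.<⇒≱ k<d (ℕ.+-cancelˡ-≤ p d k (ℕ.≤-trans (ℕ.≤ᵇ⇒≤ (p ℕ.+ d) _ t) (ℕ.≤-reflexive (ℕ.+-comm k p)))))) ⟨
    ⟦ p ℕ.+ d ≤ᵇ k ℕ.+ p ⟧ * F d ∎

  module PieriRule (x q : ℚ) (xq≡1 : x * q ≡ 1ℚ) (ρ : ℕ → ℚ)
                   (ρ-inverse : ∀ k → (1ℚ - (x ^ℚ suc k)) * ρ (suc k) ≡ 1ℚ) (M : ℕ) where

    open Specialisation x q xq≡1 ρ ρ-inverse public

    Up : ℕ → ℕ → List ℕ → ℚ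
    Up ℓ k μ = ΣBox M (suc ℓ) (λ κ → ⟦ κ ⊐ μ ⟧ * (⟦ sumℕ κ ≡ᵇ sumℕ μ ℕ.+ k ⟧ * g κ))

    -- In generating functions, h(u) = h(xu) / (1 - u); it is also branching for a one-row shape.
    h-sum : ∀ k → Σ< (suc k) (λ j → (x ^ℚ j) * h j) ≡ h k
    h-sum zero    = refl
    h-sum (suc k) = begin
      Σ< (suc (suc k)) (λ j → (x ^ℚ j) * h j)             ≡⟨ Σ<-last (suc k) (λ j → (x ^ℚ j) * h j) ⟩
      Σ< (suc k) (λ j → (x ^ℚ j) * h j) + (x ^ℚ suc k) * h (suc k)
        ≡⟨ cong (_+ (x ^ℚ suc k) * h (suc k)) (trans (h-sum k) (sym (h-step k))) ⟩
      (1ℚ - (x ^ℚ suc k)) * h (suc k) + (x ^ℚ suc k) * h (suc k) ≡⟨ collect (x ^ℚ suc k) (h (suc k)) ⟩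
      h (suc k) ∎
      where
      collect : ∀ y h → (1ℚ - y) * h + y * h ≡ h
      collect = solve-∀ ℚ-ring

    Y : List ℕ → ℚ
    Y ν = (x ^ℚ sumℕ ν) * g ν

    -- Branching is applied to each g κ, the local rule to the pair (μ, ν), and the result is sorted
    -- by the size j of the strip from the lower neighbour to ν, which splits x^|ν| into x^|κ| x^j.
    Up-recursion : ∀ {ℓ μ} k → Box M ℓ μ → sumℕ μ ℕ.+ k ℕ.< M →
      Up ℓ k μ ≡ ΣBox M ℓ (λ κ → ⟦ μ ≻ κ ⟧ * ((x ^ℚ sumℕ κ) * Σ< (suc k) (λ j → (x ^ℚ j) * Up ℓ j κ)))
    Up-recursion {ℓ} {μ} k bμ s<M = begin
      ΣBox M (suc ℓ) (λ κ → ⟦ κ ⊐ μ ⟧ * (⟦ sumℕ κ ≡ᵇ s ⟧ * g κ))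
        ≡⟨ ΣBox-⟦⟧-cong M (suc ℓ) (_⊐ μ) expand ⟩
      ΣBox M (suc ℓ) (λ κ → ⟦ κ ⊐ μ ⟧ * (⟦ sumℕ κ ≡ᵇ s ⟧ * ΣBox M (suc ℓ) (λ ν → ⟦ κ ≻ ν ⟧ * Y ν)))
        ≡⟨ ΣBox-ext M (suc ℓ) (λ κ → trans (sym (*-assoc ⟦ κ ⊐ μ ⟧ ⟦ sumℕ κ ≡ᵇ s ⟧ _))
             (trans (sym (ΣBox-* M (suc ℓ) (⟦ κ ⊐ μ ⟧ * ⟦ sumℕ κ ≡ᵇ s ⟧) (λ ν → ⟦ κ ≻ ν ⟧ * Y ν)))
                    (ΣBox-ext M (suc ℓ) (λ ν → rearrange₁ ⟦ κ ⊐ μ ⟧ ⟦ sumℕ κ ≡ᵇ s ⟧ ⟦ κ ≻ ν ⟧ (Y ν))))) ⟩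
      ΣBox M (suc ℓ) (λ κ → ΣBox M (suc ℓ) (λ ν → Y ν * (⟦ κ ⊐ μ ⟧ * (⟦ sumℕ κ ≡ᵇ s ⟧ * ⟦ κ ≻ ν ⟧))))
        ≡⟨ ΣBox-swap M (suc ℓ) (suc ℓ) (λ κ ν → Y ν * (⟦ κ ⊐ μ ⟧ * (⟦ sumℕ κ ≡ᵇ s ⟧ * ⟦ κ ≻ ν ⟧))) ⟩
      ΣBox M (suc ℓ) (λ ν → ΣBox M (suc ℓ) (λ κ → Y ν * (⟦ κ ⊐ μ ⟧ * (⟦ sumℕ κ ≡ᵇ s ⟧ * ⟦ κ ≻ ν ⟧))))
        ≡⟨ ΣBox-cong M (suc ℓ) exchange ⟩
      ΣBox M (suc ℓ) (λ ν → ΣBox M ℓ (λ κ → Y ν * (⟦ μ ≻ κ ⟧ * (⟦ ν ⊐ κ ⟧ * ⟦ sumℕ ν ≤ᵇ k ℕ.+ sumℕ κ ⟧))))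
        ≡⟨ ΣBox-swap M (suc ℓ) ℓ (λ ν κ → Y ν * (⟦ μ ≻ κ ⟧ * (⟦ ν ⊐ κ ⟧ * ⟦ sumℕ ν ≤ᵇ k ℕ.+ sumℕ κ ⟧))) ⟩
      ΣBox M ℓ (λ κ → ΣBox M (suc ℓ) (λ ν → Y ν * (⟦ μ ≻ κ ⟧ * (⟦ ν ⊐ κ ⟧ * ⟦ sumℕ ν ≤ᵇ k ℕ.+ sumℕ κ ⟧))))
        ≡⟨ ΣBox-ext M ℓ (λ κ → trans (ΣBox-ext M (suc ℓ) (λ ν → rearrange₂ (Y ν) ⟦ μ ≻ κ ⟧ ⟦ ν ⊐ κ ⟧ ⟦ sumℕ ν ≤ᵇ k ℕ.+ sumℕ κ ⟧))
                                     (trans (ΣBox-* M (suc ℓ) ⟦ μ ≻ κ ⟧ (λ ν → ⟦ ν ⊐ κ ⟧ * (⟦ sumℕ ν ≤ᵇ k ℕ.+ sumℕ κ ⟧ * Y ν))) (cong (⟦ μ ≻ κ ⟧ *_) (by-size κ)))) ⟩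
      ΣBox M ℓ (λ κ → ⟦ μ ≻ κ ⟧ * ((x ^ℚ sumℕ κ) * Σ< (suc k) (λ j → (x ^ℚ j) * Up ℓ j κ))) ∎
      where
      s = sumℕ μ ℕ.+ k
      rearrange₁ : ∀ a b c y → a * b * (c * y) ≡ y * (a * (b * c))
      rearrange₁ = solve-∀ ℚ-ring
      rearrange₂ : ∀ y a b c → y * (a * (b * c)) ≡ a * (b * (c * y))
      rearrange₂ = solve-∀ ℚ-ring
      expand : ∀ κ → Box M (suc ℓ) κ → T (κ ⊐ μ) →
               ⟦ sumℕ κ ≡ᵇ s ⟧ * g κ ≡ ⟦ sumℕ κ ≡ᵇ s ⟧ * ΣBox M (suc ℓ) (λ ν → ⟦ κ ≻ ν ⟧ * Y ν)
      expand κ@(a ∷ _) b@(a<M ∷ _) t = cong (⟦ sumℕ κ ≡ᵇ s ⟧ *_)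
        (sym (trans (cong (λ n → ΣBox M n (λ ν → ⟦ κ ≻ ν ⟧ * Y ν)) (sym (Box-length b))) (branching M κ (⊐-decreasingˡ κ μ t) a<M)))
      exchange : ∀ ν → Box M (suc ℓ) ν →
        ΣBox M (suc ℓ) (λ κ → Y ν * (⟦ κ ⊐ μ ⟧ * (⟦ sumℕ κ ≡ᵇ s ⟧ * ⟦ κ ≻ ν ⟧)))
        ≡ ΣBox M ℓ (λ κ → Y ν * (⟦ μ ≻ κ ⟧ * (⟦ ν ⊐ κ ⟧ * ⟦ sumℕ ν ≤ᵇ k ℕ.+ sumℕ κ ⟧)))
      exchange ν@(c ∷ _) (_ ∷ bν) = trans (ΣBox-* M (suc ℓ) (Y ν) (λ κ → ⟦ κ ⊐ μ ⟧ * (⟦ sumℕ κ ≡ᵇ s ⟧ * ⟦ κ ≻ ν ⟧)))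
        (trans (cong (Y ν *_) (upper-neighbours M c k bμ bν s<M)) (sym (ΣBox-* M ℓ (Y ν) (λ κ → ⟦ μ ≻ κ ⟧ * (⟦ ν ⊐ κ ⟧ * ⟦ sumℕ ν ≤ᵇ k ℕ.+ sumℕ κ ⟧)))))
      rearrange₃ : ∀ b e u v g → b * (e * (u * v * g)) ≡ u * (v * (b * (e * g)))
      rearrange₃ = solve-∀ ℚ-ring
      sizes : ∀ κ ν → T (ν ⊐ κ) → ⟦ sumℕ ν ≤ᵇ k ℕ.+ sumℕ κ ⟧ * Y ν
                                  ≡ Σ< (suc k) (λ j → ⟦ sumℕ ν ≡ᵇ sumℕ κ ℕ.+ j ⟧ * ((x ^ℚ sumℕ κ) * (x ^ℚ j) * g ν))
      sizes κ ν t with sumℕ ν | ℕ.m≤n⇒∃[o]m+o≡n (⊐-size ν κ t)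
      ... | .(sumℕ κ ℕ.+ d) | d , refl = trans
        (cong (λ z → ⟦ sumℕ κ ℕ.+ d ≤ᵇ k ℕ.+ sumℕ κ ⟧ * (z * g ν)) (^ℚ-+ x (sumℕ κ) d))
        (sym (Σ<-sizes k (sumℕ κ) d (λ j → (x ^ℚ sumℕ κ) * (x ^ℚ j) * g ν)))
      by-size : ∀ κ → ΣBox M (suc ℓ) (λ ν → ⟦ ν ⊐ κ ⟧ * (⟦ sumℕ ν ≤ᵇ k ℕ.+ sumℕ κ ⟧ * Y ν))
                      ≡ (x ^ℚ sumℕ κ) * Σ< (suc k) (λ j → (x ^ℚ j) * Up ℓ j κ)
      by-size κ = begin
        ΣBox M (suc ℓ) (λ ν → ⟦ ν ⊐ κ ⟧ * (⟦ sumℕ ν ≤ᵇ k ℕ.+ sumℕ κ ⟧ * Y ν))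
          ≡⟨ ΣBox-⟦⟧-cong M (suc ℓ) (_⊐ κ) (λ ν _ t → sizes κ ν t) ⟩
        ΣBox M (suc ℓ) (λ ν → ⟦ ν ⊐ κ ⟧ * Σ< (suc k) (λ j → ⟦ sumℕ ν ≡ᵇ sumℕ κ ℕ.+ j ⟧ * ((x ^ℚ sumℕ κ) * (x ^ℚ j) * g ν)))
          ≡⟨ ΣBox-ext M (suc ℓ) (λ ν → trans (sym (Σ<-* (suc k) ⟦ ν ⊐ κ ⟧ (λ j → ⟦ sumℕ ν ≡ᵇ sumℕ κ ℕ.+ j ⟧ * ((x ^ℚ sumℕ κ) * (x ^ℚ j) * g ν))))
               (Σ<-ext (suc k) (λ j → rearrange₃ ⟦ ν ⊐ κ ⟧ ⟦ sumℕ ν ≡ᵇ sumℕ κ ℕ.+ j ⟧ (x ^ℚ sumℕ κ) (x ^ℚ j) (g ν)))) ⟩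
        ΣBox M (suc ℓ) (λ ν → Σ< (suc k) (λ j → (x ^ℚ sumℕ κ) * ((x ^ℚ j) * (⟦ ν ⊐ κ ⟧ * (⟦ sumℕ ν ≡ᵇ sumℕ κ ℕ.+ j ⟧ * g ν)))))
          ≡⟨ ΣBox-Σ< M (suc ℓ) (suc k) (λ ν j → (x ^ℚ sumℕ κ) * ((x ^ℚ j) * U j ν)) ⟩
        Σ< (suc k) (λ j → ΣBox M (suc ℓ) (λ ν → (x ^ℚ sumℕ κ) * ((x ^ℚ j) * (⟦ ν ⊐ κ ⟧ * (⟦ sumℕ ν ≡ᵇ sumℕ κ ℕ.+ j ⟧ * g ν)))))
          ≡⟨ Σ<-ext (suc k) (λ j → trans (ΣBox-* M (suc ℓ) (x ^ℚ sumℕ κ) (λ ν → (x ^ℚ j) * U j ν)) (cong ((x ^ℚ sumℕ κ) *_) (ΣBox-* M (suc ℓ) (x ^ℚ j) (U j)))) ⟩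
        Σ< (suc k) (λ j → (x ^ℚ sumℕ κ) * ((x ^ℚ j) * Up ℓ j κ))
          ≡⟨ Σ<-* (suc k) (x ^ℚ sumℕ κ) (λ j → (x ^ℚ j) * Up ℓ j κ) ⟩
        (x ^ℚ sumℕ κ) * Σ< (suc k) (λ j → (x ^ℚ j) * Up ℓ j κ) ∎
        where
        U : ℕ → List ℕ → ℚ
        U j ν = ⟦ ν ⊐ κ ⟧ * (⟦ sumℕ ν ≡ᵇ sumℕ κ ℕ.+ j ⟧ * g ν)

    branching-Box : ∀ {ℓ μ} → Box M ℓ μ → 0 ℕ.< M → Decreasing μ → ΣBox M ℓ (λ κ → ⟦ μ ≻ κ ⟧ * Y κ) ≡ g μ
    branching-Box {μ = μ} b 0<M d = trans (cong (λ n → ΣBox M n (λ κ → ⟦ μ ≻ κ ⟧ * Y κ)) (sym (Box-length b))) (branching M μ d (hd< b 0<M))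
      where
      hd< : ∀ {ℓ μ} → Box M ℓ μ → 0 ℕ.< M → hd μ ℕ.< M
      hd< []        p = p
      hd< (a<M ∷ _) p = a<M

    defect : ℕ → ℕ → List ℕ → ℚ
    defect ℓ k μ = Up ℓ k μ - h k * g μ

    -- The expected value `h k * g μ` satisfies the recursion of `Up`: branching produces the factor
    -- g and `h-sum` the factor h.
    defect-recursion : ∀ {ℓ μ} k → Box M ℓ μ → Decreasing μ → sumℕ μ ℕ.+ k ℕ.< M →
      defect ℓ k μ ≡ ΣBox M ℓ (λ κ → ⟦ μ ≻ κ ⟧ * ((x ^ℚ sumℕ κ) * Σ< (suc k) (λ j → (x ^ℚ j) * defect ℓ j κ)))
    defect-recursion {ℓ} {μ} k bμ d s<M = begin
      Up ℓ k μ - h k * g μ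
        ≡⟨ cong₂ (λ a b → a - h k * b) (Up-recursion k bμ s<M) (sym (branching-Box bμ (ℕ.≤-<-trans z≤n s<M) d)) ⟩
      ΣBox M ℓ A - h k * ΣBox M ℓ B
        ≡⟨ cong (λ z → ΣBox M ℓ A - z) (ΣBox-* M ℓ (h k) B) ⟨
      ΣBox M ℓ A - ΣBox M ℓ (λ κ → h k * B κ)
        ≡⟨ minus (ΣBox M ℓ A) (ΣBox M ℓ (λ κ → h k * B κ)) ⟩
      ΣBox M ℓ A + (- 1ℚ) * ΣBox M ℓ (λ κ → h k * B κ)
        ≡⟨ cong (ΣBox M ℓ A +_) (ΣBox-* M ℓ (- 1ℚ) (λ κ → h k * B κ)) ⟨
      ΣBox M ℓ A + ΣBox M ℓ (λ κ → (- 1ℚ) * (h k * B κ))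
        ≡⟨ ΣBox-+ M ℓ A (λ κ → (- 1ℚ) * (h k * B κ)) ⟨
      ΣBox M ℓ (λ κ → A κ + (- 1ℚ) * (h k * B κ))
        ≡⟨ ΣBox-ext M ℓ (λ κ → trans (combine ⟦ μ ≻ κ ⟧ (x ^ℚ sumℕ κ) (S κ) (h k) (g κ)) (cong (λ z → ⟦ μ ≻ κ ⟧ * ((x ^ℚ sumℕ κ) * z)) (inner κ))) ⟩
      ΣBox M ℓ (λ κ → ⟦ μ ≻ κ ⟧ * ((x ^ℚ sumℕ κ) * Σ< (suc k) (λ j → (x ^ℚ j) * defect ℓ j κ))) ∎
      where
      S A B : List ℕ → ℚ
      S κ = Σ< (suc k) (λ j → (x ^ℚ j) * Up ℓ j κ)
      A κ = ⟦ μ ≻ κ ⟧ * ((x ^ℚ sumℕ κ) * S κ)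
      B κ = ⟦ μ ≻ κ ⟧ * Y κ
      minus : ∀ a b → a - b ≡ a + (- 1ℚ) * b
      minus = solve-∀ ℚ-ring
      combine : ∀ b y s h g → b * (y * s) + (- 1ℚ) * (h * (b * (y * g))) ≡ b * (y * (s + - g * h))
      combine = solve-∀ ℚ-ring
      summand : ∀ y u g h → y * u + - g * (y * h) ≡ y * (u - h * g)
      summand = solve-∀ ℚ-ring
      inner : ∀ κ → S κ + - g κ * h k ≡ Σ< (suc k) (λ j → (x ^ℚ j) * defect ℓ j κ)
      inner κ = begin
        S κ + - g κ * h k                                              ≡⟨ cong (λ z → S κ + - g κ * z) (h-sum k) ⟨
        S κ + - g κ * Σ< (suc k) (λ j → (x ^ℚ j) * h j)                 ≡⟨ cong (S κ +_) (Σ<-* (suc k) (- g κ) (λ j → (x ^ℚ j) * h j)) ⟨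
        S κ + Σ< (suc k) (λ j → - g κ * ((x ^ℚ j) * h j))              ≡⟨ Σ<-+ (suc k) (λ j → (x ^ℚ j) * Up ℓ j κ) (λ j → - g κ * ((x ^ℚ j) * h j)) ⟨
        Σ< (suc k) (λ j → (x ^ℚ j) * Up ℓ j κ + - g κ * ((x ^ℚ j) * h j)) ≡⟨ Σ<-ext (suc k) (λ j → summand (x ^ℚ j) (Up ℓ j κ) (g κ) (h j)) ⟩
        Σ< (suc k) (λ j → (x ^ℚ j) * defect ℓ j κ) ∎

    zeros-unique : ∀ {ℓ κ ν} → Box M ℓ κ → Box M ℓ ν → sumℕ κ ≡ 0 → sumℕ ν ≡ 0 → κ ≡ ν
    zeros-unique []      []      p q = refl
    zeros-unique (_∷_ {a = zero} _ b) (_∷_ {a = zero} _ b′) p q = cong (0 ∷_) (zeros-unique b b′ p q)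

    Up-zero : ∀ {ℓ μ} → Box M ℓ μ → Decreasing μ → sumℕ μ ≡ 0 → 0 ℕ.< M → Up ℓ 0 μ ≡ g μ
    Up-zero {ℓ} {μ} b d s≡0 0<M = begin
      Up ℓ 0 μ ≡⟨ ΣBox-single M (suc ℓ) (0 ∷ μ) (λ κ → ⟦ κ ⊐ μ ⟧ * (⟦ sumℕ κ ≡ᵇ sumℕ μ ℕ.+ 0 ⟧ * g κ)) (0<M ∷ b) other ⟩
      ⟦ (0 ∷ μ) ⊐ μ ⟧ * (⟦ sumℕ μ ≡ᵇ sumℕ μ ℕ.+ 0 ⟧ * (X * 1ℚ * g μ))
        ≡⟨ cong₂ (λ u v → u * (v * (X * 1ℚ * g μ))) (⟦⟧-true (T-∧⁺ (hd μ ≤ᵇ 0) (ℕ.≤⇒≤ᵇ (hd≤ μ s≡0)) (≻-refl d)))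
             (⟦⟧-true (ℕ.≡⇒≡ᵇ (sumℕ μ) _ (sym (ℕ.+-identityʳ (sumℕ μ))))) ⟩
      1ℚ * (1ℚ * (X * 1ℚ * g μ)) ≡⟨ cong (λ z → 1ℚ * (1ℚ * ((x ^ℚ z) * 1ℚ * g μ))) s≡0 ⟩
      1ℚ * (1ℚ * (1ℚ * 1ℚ * g μ)) ≡⟨ tidy (g μ) ⟩
      g μ ∎
      where
      X = x ^ℚ sumℕ μ
      tidy : ∀ z → 1ℚ * (1ℚ * (1ℚ * 1ℚ * z)) ≡ z
      tidy = solve-∀ ℚ-ring
      hd≤ : ∀ μ → sumℕ μ ≡ 0 → hd μ ℕ.≤ 0
      hd≤ []         _ = z≤n
      hd≤ (zero ∷ _) _ = z≤n
      other : ∀ κ → Box M (suc ℓ) κ → ¬ (κ ≡ 0 ∷ μ) → ⟦ κ ⊐ μ ⟧ * (⟦ sumℕ κ ≡ᵇ sumℕ μ ℕ.+ 0 ⟧ * g κ) ≡ 0ℚ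
      other κ bκ κ≢ = *-zeroʳ′ ⟦ κ ⊐ μ ⟧ (*-zeroˡ′ (g κ) (⟦⟧-false λ t →
        κ≢ (zeros-unique bκ (0<M ∷ b) (trans (ℕ.≡ᵇ⇒≡ (sumℕ κ) _ t) (trans (ℕ.+-identityʳ (sumℕ μ)) s≡0)) s≡0)))

    private
      Claim : ℕ → Set
      Claim n = ∀ {ℓ μ} k → sumℕ μ ℕ.+ k ≡ n → Box M ℓ μ → Decreasing μ → n ℕ.< M → defect ℓ k μ ≡ 0ℚ

      claim : ∀ n → (∀ {m} → m ℕ.< n → Claim m) → Claim n
      -- For n = 0 the factor 1 - x^n is 0 and the recursion gives no information; the empty shape
      -- is computed directly.
      claim zero rec {ℓ} {μ} k e b d n<M with ℕ.m+n≡0⇒m≡0 (sumℕ μ) e | ℕ.m+n≡0⇒n≡0 (sumℕ μ) e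
      ... | s≡0 | refl = trans (cong (λ z → z - 1ℚ * g μ) (Up-zero b d s≡0 n<M)) (cancel (g μ))
        where
        cancel : ∀ z → z - 1ℚ * z ≡ 0ℚ
        cancel = solve-∀ ℚ-ring
      claim (suc n) rec {ℓ} {μ} k e b d n<M = begin
        D                                                      ≡⟨ *-identityˡ D ⟨
        1ℚ * D                                                 ≡⟨ cong (_* D) (ρ-inverse n) ⟨
        (1ℚ - (x ^ℚ suc n)) * ρ (suc n) * D                    ≡⟨ rearrange (x ^ℚ suc n) (ρ (suc n)) D ⟩
        ρ (suc n) * (D - (x ^ℚ suc n) * D)                     ≡⟨ cong (λ z → ρ (suc n) * (z - (x ^ℚ suc n) * D)) fixed ⟩
        ρ (suc n) * ((x ^ℚ suc n) * D - (x ^ℚ suc n) * D)      ≡⟨ cancel (ρ (suc n)) ((x ^ℚ suc n) * D) ⟩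
        0ℚ ∎
        where
        D = defect ℓ k μ
        rearrange : ∀ y r d → (1ℚ - y) * r * d ≡ r * (d - y * d)
        rearrange = solve-∀ ℚ-ring
        cancel : ∀ r z → r * (z - z) ≡ 0ℚ
        cancel = solve-∀ ℚ-ring
        bound : sumℕ μ ℕ.+ k ℕ.< M
        bound = subst (ℕ._< M) (sym e) n<M
        smaller : ∀ κ j → Box M ℓ κ → T (μ ≻ κ) → sumℕ κ ℕ.+ j ℕ.< suc n → defect ℓ j κ ≡ 0ℚ
        smaller κ j bκ t lt = rec lt j refl bκ (≻-decreasingʳ μ κ t) (ℕ.<-trans lt n<M)
        other : ∀ κ → Box M ℓ κ → ¬ (κ ≡ μ) → ⟦ μ ≻ κ ⟧ * ((x ^ℚ sumℕ κ) * Σ< (suc k) (λ j → (x ^ℚ j) * defect ℓ j κ)) ≡ 0ℚ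
        other κ bκ κ≢μ = trans (⟦⟧-cong (μ ≻ κ) {q = 0ℚ} λ t → *-zeroʳ′ (x ^ℚ sumℕ κ) (trans (Σ<-cong (suc k) (λ j j≤k →
            *-zeroʳ′ (x ^ℚ j) (smaller κ j bκ t (subst (sumℕ κ ℕ.+ j ℕ.<_) e
              (ℕ.+-mono-<-≤ (ℕ.≤∧≢⇒< (≻-size μ κ t) (κ≢μ ∘ ≻-size-≡ μ κ t)) (ℕ.≤-pred j≤k)))))) (Σ<-0 (suc k)))) (*-zeroʳ ⟦ μ ≻ κ ⟧)
        fixed : D ≡ (x ^ℚ suc n) * D
        fixed = begin
          D ≡⟨ defect-recursion k b d bound ⟩
          ΣBox M ℓ (λ κ → ⟦ μ ≻ κ ⟧ * ((x ^ℚ sumℕ κ) * Σ< (suc k) (λ j → (x ^ℚ j) * defect ℓ j κ)))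
            -- Any other κ below μ is strictly smaller, so with j at most k its defects vanish by
            -- induction; for κ = μ the same holds for j < k, and only j = k is left.
            ≡⟨ ΣBox-single M ℓ μ _ b other ⟩
          ⟦ μ ≻ μ ⟧ * ((x ^ℚ sumℕ μ) * Σ< (suc k) (λ j → (x ^ℚ j) * defect ℓ j μ))
            ≡⟨ cong₂ (λ u v → u * ((x ^ℚ sumℕ μ) * v)) (⟦⟧-true (≻-refl d)) (Σ<-last k (λ j → (x ^ℚ j) * defect ℓ j μ)) ⟩
          1ℚ * ((x ^ℚ sumℕ μ) * (Σ< k (λ j → (x ^ℚ j) * defect ℓ j μ) + (x ^ℚ k) * D))
            ≡⟨ cong (λ z → 1ℚ * ((x ^ℚ sumℕ μ) * (z + (x ^ℚ k) * D))) (trans (Σ<-cong k (λ j j<k → *-zeroʳ′ (x ^ℚ j)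
                 (smaller μ j b (≻-refl d) (subst (sumℕ μ ℕ.+ j ℕ.<_) e (ℕ.+-monoʳ-< (sumℕ μ) j<k))))) (Σ<-0 k)) ⟩
          1ℚ * ((x ^ℚ sumℕ μ) * (0ℚ + (x ^ℚ k) * D))
            ≡⟨ tidy (x ^ℚ sumℕ μ) (x ^ℚ k) D ⟩
          (x ^ℚ sumℕ μ) * (x ^ℚ k) * D
            ≡⟨ cong (_* D) (trans (sym (^ℚ-+ x (sumℕ μ) k)) (cong (x ^ℚ_) e)) ⟩
          (x ^ℚ suc n) * D ∎
          where
          tidy : ∀ u v d → 1ℚ * (u * (0ℚ + v * d)) ≡ u * v * d
          tidy = solve-∀ ℚ-ring

    -- The defect satisfies a homogeneous recursion in which only 1 − x^(|μ|+k) can obstruct its vanishing.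
    pieri : ∀ {ℓ μ} k → Box M ℓ μ → Decreasing μ → sumℕ μ ℕ.+ k ℕ.< M → Up ℓ k μ ≡ h k * g μ
    pieri {ℓ} {μ} k b d lt = trans (restore (Up ℓ k μ) (h k * g μ))
        (trans (cong (_+ h k * g μ) (<-rec Claim claim (sumℕ μ ℕ.+ k) k refl b d lt)) (+-identityˡ (h k * g μ)))
      where
      restore : ∀ a b → a ≡ a - b + b
      restore = solve-∀ ℚ-ring

-- The sum of g² over the partitions of n and its recursion.

module Cauchy where

  open Base
  open import Defs using (_^ℚ_; sumℕ; countGt; allPos)
  open Partition
  open Principal
  open Pieri
  open import Data.Bool using (true; false; _∧_; T)
  open import Data.List using (List; []; _∷_; _∷ʳ_; length)
  open import Data.Nat as ℕ using (ℕ; zero; suc; z≤n; s≤s; _≤ᵇ_; _<ᵇ_; _≡ᵇ_)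
  import Data.Nat.Properties as ℕ
  open import Data.Nat.Induction using (<-rec)
  open import Data.Product using (_,_)
  open import Data.Sum using (inj₁; inj₂)
  open import Data.Rational using (ℚ; 0ℚ; 1ℚ; _+_; _*_; _-_; -_)
  open import Data.Rational.Properties using (*-zeroˡ; *-zeroʳ; *-identityˡ; +-identityʳ; +-identityˡ; *-assoc)
  open import Data.Unit using (tt)
  open import Data.Empty using (⊥; ⊥-elim)
  open import Function using (_∘_)
  open import Relation.Binary.PropositionalEquality
  open import Relation.Nullary using (¬_)
  open import Tactic.RingSolver using (solve-∀)
  open ≡-Reasoning

  data LastZero : List ℕ → Set where
    [0] : LastZero (0 ∷ [])
    _∷_ : ∀ a {b r} → LastZero (b ∷ r) → LastZero (a ∷ b ∷ r)

  sum-zero : ∀ {r} → Decreasing r → hd r ≡ 0 → sumℕ r ≡ 0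
  sum-zero []                _    = refl
  sum-zero (_∷_ {r = r} p d) refl = sum-zero d (ℕ.n≤0⇒n≡0 p)

  -- There are more rows than boxes. A positive first row uses up at least one box together with its
  -- row; an empty one makes all later rows empty.
  last-zero : ∀ {a r} → Decreasing (a ∷ r) → a ℕ.+ sumℕ r ℕ.≤ length r → LastZero (a ∷ r)
  last-zero {zero}  {[]}    d       p = [0]
  last-zero {suc a} {[]}    d       ()
  last-zero {zero}  {b ∷ r} (q ∷ d) p = zero ∷ last-zero d (ℕ.≤-trans (ℕ.≤-reflexive (sum-zero d (ℕ.n≤0⇒n≡0 q))) z≤n)
  last-zero {suc a} {b ∷ r} (q ∷ d) p = suc a ∷ last-zero d (ℕ.≤-trans (ℕ.m≤n+m _ a) (ℕ.≤-pred p))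

  -- If the last row of (a ∷ κ) is empty, so is that of every partition below it.
  Σ≻-Σ⊐ : ∀ M {ℓ} a κ (F : List ℕ → ℚ) → Box M ℓ κ → a ℕ.< M → LastZero (a ∷ κ) →
    ΣBox M (suc ℓ) (λ ν → ⟦ (a ∷ κ) ≻ ν ⟧ * F ν) ≡ ΣBox M ℓ (λ μ → ⟦ (a ∷ κ) ⊐ μ ⟧ * F (μ ∷ʳ 0))
  Σ≻-Σ⊐ (suc m) .0 [] F [] _ [0] = begin
    ΣBox (suc m) 1 (λ ν → ⟦ (0 ∷ []) ≻ ν ⟧ * F ν)
      ≡⟨ Σ≻-∷ (suc m) 0 0 [] F ⟩
    Σ< (suc m) (λ c → ⟦ range 0 0 c ⟧ * (1ℚ * F (c ∷ [])))
      ≡⟨ Σ<-range 0 0 m (λ c → 1ℚ * F (c ∷ [])) ⟩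
    1ℚ * F (0 ∷ []) + 0ℚ
      ≡⟨ +-identityʳ (1ℚ * F (0 ∷ [])) ⟩
    1ℚ * F (0 ∷ []) ∎
  Σ≻-Σ⊐ M {suc ℓ} a (b ∷ r) F (b<M ∷ bx) a<M (_ ∷ z) = begin
    ΣBox M (suc (suc ℓ)) (λ ν → ⟦ (a ∷ b ∷ r) ≻ ν ⟧ * F ν)
      ≡⟨ Σ≻-∷ M (suc ℓ) a (b ∷ r) F ⟩
    Σ< M (λ c → ⟦ range b a c ⟧ * ΣBox M (suc ℓ) (λ ν → ⟦ (b ∷ r) ≻ ν ⟧ * F (c ∷ ν)))
      ≡⟨ Σ<-ext M (λ c → trans (cong (⟦ range b a c ⟧ *_) (Σ≻-Σ⊐ M b r (F ∘ (c ∷_)) bx b<M z)) (sym (ΣBox-* M ℓ ⟦ range b a c ⟧ (λ μ → ⟦ (b ∷ r) ⊐ μ ⟧ * F (c ∷ (μ ∷ʳ 0)))))) ⟩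
    Σ< M (λ c → ΣBox M ℓ (λ μ → ⟦ range b a c ⟧ * (⟦ (b ∷ r) ⊐ μ ⟧ * F (c ∷ (μ ∷ʳ 0)))))
      ≡⟨ Σ<-ext M (λ c → ΣBox-ext M ℓ (λ μ → trans (sym (*-assoc ⟦ range b a c ⟧ ⟦ (b ∷ r) ⊐ μ ⟧ (F (c ∷ (μ ∷ʳ 0))))) (cong (_* F (c ∷ (μ ∷ʳ 0))) (indicator c μ)))) ⟩
    Σ< M (λ c → ΣBox M ℓ (λ μ → ⟦ (a ∷ b ∷ r) ⊐ (c ∷ μ) ⟧ * F (c ∷ (μ ∷ʳ 0)))) ∎
    where
    rearrange : ∀ bc ca mb mr → bc * ca * (mb * mr) ≡ ca * (mb * bc * mr)
    rearrange = solve-∀ ℚ-ring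
    indicator : ∀ c μ → ⟦ range b a c ⟧ * ⟦ (b ∷ r) ⊐ μ ⟧ ≡ ⟦ (a ∷ b ∷ r) ⊐ (c ∷ μ) ⟧
    indicator c μ = begin
      ⟦ range b a c ⟧ * ⟦ (b ∷ r) ⊐ μ ⟧
        ≡⟨ cong₂ _*_ (⟦⟧-∧ (b ≤ᵇ c) (c ≤ᵇ a)) (⟦⟧-∧ (hd μ ≤ᵇ b) (μ ≻ r)) ⟩
      ⟦ b ≤ᵇ c ⟧ * ⟦ c ≤ᵇ a ⟧ * (⟦ hd μ ≤ᵇ b ⟧ * ⟦ μ ≻ r ⟧)
        ≡⟨ rearrange ⟦ b ≤ᵇ c ⟧ ⟦ c ≤ᵇ a ⟧ ⟦ hd μ ≤ᵇ b ⟧ ⟦ μ ≻ r ⟧ ⟩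
      ⟦ c ≤ᵇ a ⟧ * (⟦ hd μ ≤ᵇ b ⟧ * ⟦ b ≤ᵇ c ⟧ * ⟦ μ ≻ r ⟧)
        ≡⟨ cong (λ w → ⟦ c ≤ᵇ a ⟧ * (w * ⟦ μ ≻ r ⟧)) (⟦⟧-∧ (hd μ ≤ᵇ b) (b ≤ᵇ c)) ⟨
      ⟦ c ≤ᵇ a ⟧ * (⟦ range (hd μ) c b ⟧ * ⟦ μ ≻ r ⟧)
        ≡⟨ cong (⟦ c ≤ᵇ a ⟧ *_) (⟦⟧-∧ (range (hd μ) c b) (μ ≻ r)) ⟨
      ⟦ c ≤ᵇ a ⟧ * ⟦ (c ∷ μ) ≻ (b ∷ r) ⟧
        ≡⟨ ⟦⟧-∧ (c ≤ᵇ a) ((c ∷ μ) ≻ (b ∷ r)) ⟨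
      ⟦ (a ∷ b ∷ r) ⊐ (c ∷ μ) ⟧ ∎

  ΣBox-∷ʳ : ∀ M ℓ (F : List ℕ → ℚ) → ΣBox M (suc ℓ) F ≡ ΣBox M ℓ (λ κ → Σ< M (λ a → F (κ ∷ʳ a)))
  ΣBox-∷ʳ M zero    F = refl
  ΣBox-∷ʳ M (suc ℓ) F = Σ<-ext M (λ a → ΣBox-∷ʳ M ℓ (F ∘ (a ∷_)))

  allPos-∷ʳ0 : ∀ κ → allPos (κ ∷ʳ 0) ≡ false
  allPos-∷ʳ0 []          = refl
  allPos-∷ʳ0 (zero ∷ κ)  = refl
  allPos-∷ʳ0 (suc a ∷ κ) = allPos-∷ʳ0 κ

  allPos-∷ʳ : ∀ κ a → Decreasing (κ ∷ʳ suc a) → T (allPos (κ ∷ʳ suc a))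
  allPos-∷ʳ []          a d       = tt
  allPos-∷ʳ (suc b ∷ κ) a (_ ∷ d) = allPos-∷ʳ κ a d
  allPos-∷ʳ (zero ∷ κ)  a (p ∷ d) = ⊥-elim (bad κ a d p)
    where
    bad : ∀ κ a → Decreasing (κ ∷ʳ suc a) → hd (κ ∷ʳ suc a) ℕ.≤ 0 → ⊥
    bad []          a d       ()
    bad (zero ∷ κ)  a (q ∷ d) p = bad κ a d q

  allPos-length : ∀ κ → T (allPos κ) → length κ ℕ.≤ sumℕ κ
  allPos-length []          t = z≤n
  allPos-length (suc a ∷ κ) t = s≤s (ℕ.≤-trans (allPos-length κ t) (ℕ.m≤n+m (sumℕ κ) a))

  module _ (m : ℕ) (W : List ℕ → ℚ) (W-∷ʳ0 : ∀ κ → W (κ ∷ʳ 0) ≡ W κ) (W-dec : ∀ κ → ¬ Decreasing κ → W κ ≡ 0ℚ) where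

    private
      M = suc m
      P : ℕ → ℚ
      P ℓ = ΣBox M ℓ (λ κ → ⟦ allPos κ ⟧ * W κ)

    strip-step : ∀ ℓ → ΣBox M (suc ℓ) W ≡ ΣBox M ℓ W + P (suc ℓ)
    strip-step ℓ = begin
      ΣBox M (suc ℓ) W
        ≡⟨ ΣBox-∷ʳ M ℓ W ⟩
      ΣBox M ℓ (λ κ → W (κ ∷ʳ 0) + Σ< m (λ a → W (κ ∷ʳ suc a)))
        ≡⟨ ΣBox-ext M ℓ (λ κ → cong₂ _+_ (W-∷ʳ0 κ) (positive κ)) ⟩
      ΣBox M ℓ (λ κ → W κ + Σ< M (λ a → ⟦ allPos (κ ∷ʳ a) ⟧ * W (κ ∷ʳ a)))
        ≡⟨ ΣBox-+ M ℓ W (λ κ → Σ< M (λ a → ⟦ allPos (κ ∷ʳ a) ⟧ * W (κ ∷ʳ a))) ⟩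
      ΣBox M ℓ W + ΣBox M ℓ (λ κ → Σ< M (λ a → ⟦ allPos (κ ∷ʳ a) ⟧ * W (κ ∷ʳ a)))
        ≡⟨ cong (ΣBox M ℓ W +_) (ΣBox-∷ʳ M ℓ (λ κ → ⟦ allPos κ ⟧ * W κ)) ⟨
      ΣBox M ℓ W + P (suc ℓ) ∎
      where
      last-positive : ∀ κ a → W (κ ∷ʳ suc a) ≡ ⟦ allPos (κ ∷ʳ suc a) ⟧ * W (κ ∷ʳ suc a)
      last-positive κ a with decreasing? (κ ∷ʳ suc a) in eq
      ... | true  = sym (trans (cong (_* W (κ ∷ʳ suc a)) (⟦⟧-true (allPos-∷ʳ κ a (decreasing?⁻ _ (subst T (sym eq) tt))))) (*-identityˡ (W (κ ∷ʳ suc a))))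
      ... | false = trans zero-W (sym (*-zeroʳ′ ⟦ allPos (κ ∷ʳ suc a) ⟧ zero-W))
        where
        zero-W : W (κ ∷ʳ suc a) ≡ 0ℚ
        zero-W = W-dec _ (λ d → subst T eq (decreasing?⁺ d))
      positive : ∀ κ → Σ< m (λ a → W (κ ∷ʳ suc a)) ≡ Σ< M (λ a → ⟦ allPos (κ ∷ʳ a) ⟧ * W (κ ∷ʳ a))
      positive κ = sym (trans
        (cong₂ _+_ (*-zeroˡ′ (W (κ ∷ʳ 0)) (cong ⟦_⟧ (allPos-∷ʳ0 κ))) (sym (Σ<-ext m (last-positive κ))))
        (+-identityˡ (Σ< m (λ a → W (κ ∷ʳ suc a)))))

    -- Translates between padded partitions, which suit horizontal strips, and the partitions
    -- without zero parts, listed by length, over which `J` is summed.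
    strip : ∀ ℓ → ΣBox M ℓ W ≡ Σ< (suc ℓ) P
    strip zero    = sym (trans (+-identityʳ (1ℚ * W [])) (*-identityˡ (W [])))
    strip (suc ℓ) = trans (strip-step ℓ) (trans (cong (_+ P (suc ℓ)) (strip ℓ)) (sym (Σ<-last (suc ℓ) P)))

  module CauchySum (x q : ℚ) (xq≡1 : x * q ≡ 1ℚ) (ρ : ℕ → ℚ)
                   (ρ-inverse : ∀ k → (1ℚ - (x ^ℚ suc k)) * ρ (suc k) ≡ 1ℚ) (m : ℕ) where

    M : ℕ
    M = suc m

    open PieriRule x q xq≡1 ρ ρ-inverse M public

    countGt-∷ʳ0 : ∀ j r → countGt j (r ∷ʳ 0) ≡ countGt j r
    countGt-∷ʳ0 j []      = refl
    countGt-∷ʳ0 j (a ∷ r) with j <ᵇ a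
    ... | true  = cong suc (countGt-∷ʳ0 j r)
    ... | false = countGt-∷ʳ0 j r

    sum-∷ʳ0 : ∀ r → sumℕ (r ∷ʳ 0) ≡ sumℕ r
    sum-∷ʳ0 []      = refl
    sum-∷ʳ0 (a ∷ r) = cong (a ℕ.+_) (sum-∷ʳ0 r)

    g-∷ʳ0 : ∀ κ → g (κ ∷ʳ 0) ≡ g κ
    g-∷ʳ0 []      = refl
    g-∷ʳ0 (a ∷ κ) = cong₂ _*_ (cong₂ _*_ (cong (x ^ℚ_) (sum-∷ʳ0 κ)) (∏<-cong ρ a (λ j _ → cong (a ℕ.∸ j ℕ.+_) (countGt-∷ʳ0 j κ)))) (g-∷ʳ0 κ)

    decreasing-∷ʳ0 : ∀ κ → decreasing? (κ ∷ʳ 0) ≡ decreasing? κ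
    decreasing-∷ʳ0 []          = refl
    decreasing-∷ʳ0 (a ∷ [])    = refl
    decreasing-∷ʳ0 (a ∷ b ∷ κ) = cong ((b ≤ᵇ a) ∧_) (decreasing-∷ʳ0 (b ∷ κ))

    weight : ℕ → List ℕ → ℚ
    weight n κ = ⟦ decreasing? κ ⟧ * (⟦ sumℕ κ ≡ᵇ n ⟧ * (g κ * g κ))

    K : ℕ → ℕ → ℚ
    K ℓ n = ΣBox M ℓ (weight n)

    weight-∷ʳ0 : ∀ n κ → weight n (κ ∷ʳ 0) ≡ weight n κ
    weight-∷ʳ0 n κ = cong₂ _*_ (cong ⟦_⟧ (decreasing-∷ʳ0 κ))
      (cong₂ _*_ (cong (λ s → ⟦ s ≡ᵇ n ⟧) (sum-∷ʳ0 κ)) (cong₂ _*_ (g-∷ʳ0 κ) (g-∷ʳ0 κ)))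

    weight-decreasing : ∀ n κ → ¬ Decreasing κ → weight n κ ≡ 0ℚ
    weight-decreasing n κ ¬d = *-zeroˡ′ _ (⟦⟧-false (¬d ∘ decreasing?⁻ κ))

    K-strip : ∀ ℓ n → K ℓ n ≡ Σ< (suc ℓ) (λ k → ΣBox M k (λ κ → ⟦ allPos κ ⟧ * weight n κ))
    K-strip ℓ n = strip m (weight n) (weight-∷ʳ0 n) (weight-decreasing n) ℓ

    -- A partition of n has at most n positive parts, so an additional row stays empty.
    K-stable : ∀ ℓ n → n ℕ.≤ ℓ → K (suc ℓ) n ≡ K ℓ n
    K-stable ℓ n n≤ℓ = trans (strip-step m (weight n) (weight-∷ʳ0 n) (weight-decreasing n) ℓ)
      (trans (cong (K ℓ n +_) (trans (ΣBox-cong M (suc ℓ) vanish) (ΣBox-0 M (suc ℓ)))) (+-identityʳ (K ℓ n)))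
      where
      vanish : ∀ κ → Box M (suc ℓ) κ → ⟦ allPos κ ⟧ * weight n κ ≡ 0ℚ
      vanish κ b = trans (⟦⟧-cong (allPos κ) {q = 0ℚ} λ t → *-zeroʳ′ ⟦ decreasing? κ ⟧ (*-zeroˡ′ (g κ * g κ) (⟦⟧-false λ e →
        ℕ.<⇒≱ (s≤s n≤ℓ) (ℕ.≤-trans (ℕ.≤-reflexive (sym (Box-length b))) (ℕ.≤-trans (allPos-length κ t) (ℕ.≤-reflexive (ℕ.≡ᵇ⇒≡ (sumℕ κ) n e))))))) (*-zeroʳ ⟦ allPos κ ⟧)

    -- Branching preserves the number of rows while `pieri` raises it by one. For |κ| at most `ℓ`
    -- the last row is empty, and branching can be restated between the row counts that `pieri`
    -- relates.
    branching-⊐ : ∀ {ℓ} κ → Box M (suc ℓ) κ → Decreasing κ → sumℕ κ ℕ.≤ ℓ → ΣBox M ℓ (λ μ → ⟦ κ ⊐ μ ⟧ * Y μ) ≡ g κ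
    branching-⊐ {ℓ} (a ∷ κ) (a<M ∷ b) d s≤ℓ = begin
      ΣBox M ℓ (λ μ → ⟦ (a ∷ κ) ⊐ μ ⟧ * Y μ)
        ≡⟨ ΣBox-ext M ℓ (λ μ → cong (⟦ (a ∷ κ) ⊐ μ ⟧ *_) (cong₂ (λ s z → (x ^ℚ s) * z) (sum-∷ʳ0 μ) (g-∷ʳ0 μ))) ⟨
      ΣBox M ℓ (λ μ → ⟦ (a ∷ κ) ⊐ μ ⟧ * Y (μ ∷ʳ 0))
        ≡⟨ Σ≻-Σ⊐ M a κ Y b a<M (last-zero d (ℕ.≤-trans s≤ℓ (ℕ.≤-reflexive (sym (Box-length b))))) ⟨
      ΣBox M (suc ℓ) (λ ν → ⟦ (a ∷ κ) ≻ ν ⟧ * Y ν)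
        ≡⟨ branching-Box (a<M ∷ b) (s≤s z≤n) d ⟩
      g (a ∷ κ) ∎

    -- The Pieri rule for a prescribed size n of the upper shape. The sum over k has one nonzero
    -- term, k = n - |μ|, but this form permits interchange with the sum over μ.
    above : ∀ {ℓ} n μ → n ℕ.≤ m → Box M ℓ μ →
      ΣBox M (suc ℓ) (λ κ → ⟦ κ ⊐ μ ⟧ * (⟦ sumℕ κ ≡ᵇ n ⟧ * g κ))
      ≡ ⟦ decreasing? μ ⟧ * Σ< (suc n) (λ k → ⟦ sumℕ μ ≡ᵇ n ℕ.∸ k ⟧ * (h k * g μ))
    above {ℓ} n μ n≤m b with decreasing? μ in eq
    ... | false = trans (trans (ΣBox-ext M (suc ℓ) (λ κ → *-zeroˡ′ (⟦ sumℕ κ ≡ᵇ n ⟧ * g κ) (⟦⟧-false (λ t → subst T eq (decreasing?⁺ (⊐-decreasingʳ κ μ t)))))) (ΣBox-0 M (suc ℓ)))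
                        (sym (*-zeroˡ (Σ< (suc n) (λ k → ⟦ sumℕ μ ≡ᵇ n ℕ.∸ k ⟧ * (h k * g μ)))))
    ... | true with ℕ.≤-<-connex (sumℕ μ) n
    ...   | inj₂ n<s = trans
      (trans (ΣBox-ext M (suc ℓ) (λ κ → trans (⟦⟧-cong (κ ⊐ μ) {q = 0ℚ} λ t → *-zeroˡ′ (g κ) (⟦⟧-false λ e →
         ℕ.<⇒≱ n<s (ℕ.≤-trans (⊐-size κ μ t) (ℕ.≤-reflexive (ℕ.≡ᵇ⇒≡ (sumℕ κ) n e))))) (*-zeroʳ ⟦ κ ⊐ μ ⟧))) (ΣBox-0 M (suc ℓ)))
      (sym (*-zeroʳ′ 1ℚ (trans (Σ<-ext (suc n) (λ k → *-zeroˡ′ (h k * g μ) (⟦⟧-false λ e →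
         ℕ.<⇒≱ n<s (ℕ.≤-trans (ℕ.≤-reflexive (ℕ.≡ᵇ⇒≡ (sumℕ μ) _ e)) (ℕ.m∸n≤m n k))))) (Σ<-0 (suc n)))))
    ...   | inj₁ s≤n with ℕ.m≤n⇒∃[o]m+o≡n s≤n
    ...     | d , refl = begin
      Up ℓ d μ ≡⟨ pieri d b (decreasing?⁻ μ (subst T (sym eq) tt)) (s≤s n≤m) ⟩
      h d * g μ ≡⟨ trans (*-identityˡ (1ℚ * (h d * g μ))) (*-identityˡ (h d * g μ)) ⟨
      1ℚ * (1ℚ * (h d * g μ)) ≡⟨ cong (λ z → 1ℚ * (z * (h d * g μ))) (⟦⟧-true (ℕ.≡⇒≡ᵇ (sumℕ μ) _ (sym (ℕ.m+n∸n≡m (sumℕ μ) d)))) ⟨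
      1ℚ * (⟦ sumℕ μ ≡ᵇ sumℕ μ ℕ.+ d ℕ.∸ d ⟧ * (h d * g μ))
        ≡⟨ cong (1ℚ *_) (Σ<-single (suc (sumℕ μ ℕ.+ d)) d (λ k → ⟦ sumℕ μ ≡ᵇ sumℕ μ ℕ.+ d ℕ.∸ k ⟧ * (h k * g μ)) (s≤s (ℕ.m≤n+m d (sumℕ μ))) other) ⟨
      1ℚ * Σ< (suc (sumℕ μ ℕ.+ d)) (λ k → ⟦ sumℕ μ ≡ᵇ sumℕ μ ℕ.+ d ℕ.∸ k ⟧ * (h k * g μ)) ∎
      where
      other : ∀ k → k ℕ.< suc (sumℕ μ ℕ.+ d) → ¬ (k ≡ d) → ⟦ sumℕ μ ≡ᵇ sumℕ μ ℕ.+ d ℕ.∸ k ⟧ * (h k * g μ) ≡ 0ℚ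
      other k k≤ k≢d = *-zeroˡ′ (h k * g μ) (⟦⟧-false λ e → k≢d (ℕ.+-cancelˡ-≡ (sumℕ μ) k d
        (trans (cong (ℕ._+ k) (ℕ.≡ᵇ⇒≡ (sumℕ μ) _ e)) (ℕ.m∸n+n≡m (ℕ.≤-pred k≤)))))

    -- Of the two factors g κ, one is expanded by branching into shapes μ below κ; the other is then
    -- summed over the κ above each μ by Pieri.
    K-recursion : ∀ ℓ n → n ℕ.≤ m → n ℕ.≤ ℓ → K (suc ℓ) n ≡ Σ< (suc n) (λ k → h k * ((x ^ℚ (n ℕ.∸ k)) * K ℓ (n ℕ.∸ k)))
    K-recursion ℓ n n≤m n≤ℓ = begin
      ΣBox M (suc ℓ) (weight n)
        ≡⟨ ΣBox-⟦⟧-cong M (suc ℓ) decreasing? expand ⟩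
      ΣBox M (suc ℓ) (λ κ → ⟦ decreasing? κ ⟧ * (⟦ sumℕ κ ≡ᵇ n ⟧ * (g κ * ΣBox M ℓ (λ μ → ⟦ κ ⊐ μ ⟧ * Y μ))))
        ≡⟨ ΣBox-ext M (suc ℓ) push ⟩
      ΣBox M (suc ℓ) (λ κ → ΣBox M ℓ (λ μ → Y μ * (⟦ κ ⊐ μ ⟧ * (⟦ sumℕ κ ≡ᵇ n ⟧ * g κ))))
        ≡⟨ ΣBox-swap M (suc ℓ) ℓ (λ κ μ → Y μ * (⟦ κ ⊐ μ ⟧ * (⟦ sumℕ κ ≡ᵇ n ⟧ * g κ))) ⟩
      ΣBox M ℓ (λ μ → ΣBox M (suc ℓ) (λ κ → Y μ * (⟦ κ ⊐ μ ⟧ * (⟦ sumℕ κ ≡ᵇ n ⟧ * g κ))))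
        ≡⟨ ΣBox-cong M ℓ (λ μ b → trans (ΣBox-* M (suc ℓ) (Y μ) (λ κ → ⟦ κ ⊐ μ ⟧ * (⟦ sumℕ κ ≡ᵇ n ⟧ * g κ))) (cong (Y μ *_) (above n μ n≤m b))) ⟩
      ΣBox M ℓ (λ μ → Y μ * (⟦ decreasing? μ ⟧ * Σ< (suc n) (λ k → ⟦ sumℕ μ ≡ᵇ n ℕ.∸ k ⟧ * (h k * g μ))))
        ≡⟨ ΣBox-ext M ℓ (λ μ → trans (sym (*-assoc (Y μ) ⟦ decreasing? μ ⟧ _)) (trans (sym (Σ<-* (suc n) (Y μ * ⟦ decreasing? μ ⟧) (λ k → ⟦ sumℕ μ ≡ᵇ n ℕ.∸ k ⟧ * (h k * g μ)))) (Σ<-ext (suc n) (term μ)))) ⟩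
      ΣBox M ℓ (λ μ → Σ< (suc n) (λ k → h k * ((x ^ℚ (n ℕ.∸ k)) * weight (n ℕ.∸ k) μ)))
        ≡⟨ ΣBox-Σ< M ℓ (suc n) (λ μ k → h k * ((x ^ℚ (n ℕ.∸ k)) * weight (n ℕ.∸ k) μ)) ⟩
      Σ< (suc n) (λ k → ΣBox M ℓ (λ μ → h k * ((x ^ℚ (n ℕ.∸ k)) * weight (n ℕ.∸ k) μ)))
        ≡⟨ Σ<-ext (suc n) (λ k → trans (ΣBox-* M ℓ (h k) (λ μ → (x ^ℚ (n ℕ.∸ k)) * weight (n ℕ.∸ k) μ)) (cong (h k *_) (ΣBox-* M ℓ (x ^ℚ (n ℕ.∸ k)) (weight (n ℕ.∸ k))))) ⟩
      Σ< (suc n) (λ k → h k * ((x ^ℚ (n ℕ.∸ k)) * K ℓ (n ℕ.∸ k))) ∎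
      where
      expand : ∀ κ → Box M (suc ℓ) κ → T (decreasing? κ) →
               ⟦ sumℕ κ ≡ᵇ n ⟧ * (g κ * g κ) ≡ ⟦ sumℕ κ ≡ᵇ n ⟧ * (g κ * ΣBox M ℓ (λ μ → ⟦ κ ⊐ μ ⟧ * Y μ))
      expand κ b d = ⟦⟧-cong (sumℕ κ ≡ᵇ n) (λ t → cong (g κ *_) (sym (branching-⊐ κ b (decreasing?⁻ κ d)
        (ℕ.≤-trans (ℕ.≤-reflexive (ℕ.≡ᵇ⇒≡ (sumℕ κ) n t)) n≤ℓ))))
      rearrange₁ : ∀ d e g z → d * (e * (g * z)) ≡ e * g * (d * z)
      rearrange₁ = solve-∀ ℚ-ring
      rearrange₂ : ∀ e g b y → e * g * (b * y) ≡ y * (b * (e * g))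
      rearrange₂ = solve-∀ ℚ-ring
      push : ∀ κ → ⟦ decreasing? κ ⟧ * (⟦ sumℕ κ ≡ᵇ n ⟧ * (g κ * ΣBox M ℓ (λ μ → ⟦ κ ⊐ μ ⟧ * Y μ)))
                   ≡ ΣBox M ℓ (λ μ → Y μ * (⟦ κ ⊐ μ ⟧ * (⟦ sumℕ κ ≡ᵇ n ⟧ * g κ)))
      push κ = begin
        ⟦ decreasing? κ ⟧ * (⟦ sumℕ κ ≡ᵇ n ⟧ * (g κ * Z))
          ≡⟨ rearrange₁ ⟦ decreasing? κ ⟧ ⟦ sumℕ κ ≡ᵇ n ⟧ (g κ) Z ⟩
        ⟦ sumℕ κ ≡ᵇ n ⟧ * g κ * (⟦ decreasing? κ ⟧ * Z)
          ≡⟨ cong (⟦ sumℕ κ ≡ᵇ n ⟧ * g κ *_) redundant ⟩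
        ⟦ sumℕ κ ≡ᵇ n ⟧ * g κ * Z
          ≡⟨ ΣBox-* M ℓ (⟦ sumℕ κ ≡ᵇ n ⟧ * g κ) (λ μ → ⟦ κ ⊐ μ ⟧ * Y μ) ⟨
        ΣBox M ℓ (λ μ → ⟦ sumℕ κ ≡ᵇ n ⟧ * g κ * (⟦ κ ⊐ μ ⟧ * Y μ))
          ≡⟨ ΣBox-ext M ℓ (λ μ → rearrange₂ ⟦ sumℕ κ ≡ᵇ n ⟧ (g κ) ⟦ κ ⊐ μ ⟧ (Y μ)) ⟩
        ΣBox M ℓ (λ μ → Y μ * (⟦ κ ⊐ μ ⟧ * (⟦ sumℕ κ ≡ᵇ n ⟧ * g κ))) ∎
        where
        Z = ΣBox M ℓ (λ μ → ⟦ κ ⊐ μ ⟧ * Y μ)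
        -- The relation `κ ⊐ μ` already makes κ decreasing.
        redundant : ⟦ decreasing? κ ⟧ * Z ≡ Z
        redundant with decreasing? κ in eq
        ... | true  = *-identityˡ Z
        ... | false = trans (*-zeroˡ Z) (sym (trans (ΣBox-ext M ℓ (λ μ → *-zeroˡ′ (Y μ) (⟦⟧-false λ t →
                        subst T eq (decreasing?⁺ (⊐-decreasingˡ κ μ t))))) (ΣBox-0 M ℓ)))
      rearrange₃ : ∀ y g d e h → y * g * d * (e * (h * g)) ≡ h * (e * (y * (d * (g * g))))
      rearrange₃ = solve-∀ ℚ-ring
      rearrange₄ : ∀ h e y d g → h * (e * (y * (d * g))) ≡ h * (y * (d * (e * g)))
      rearrange₄ = solve-∀ ℚ-ring
      term : ∀ μ k → Y μ * ⟦ decreasing? μ ⟧ * (⟦ sumℕ μ ≡ᵇ n ℕ.∸ k ⟧ * (h k * g μ)) ≡ h k * ((x ^ℚ (n ℕ.∸ k)) * weight (n ℕ.∸ k) μ)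
      term μ k = trans (rearrange₃ (x ^ℚ sumℕ μ) (g μ) ⟦ decreasing? μ ⟧ ⟦ sumℕ μ ≡ᵇ n ℕ.∸ k ⟧ (h k))
        (trans (cong (h k *_) (⟦⟧-cong (sumℕ μ ≡ᵇ n ℕ.∸ k) (λ t → cong (λ s → (x ^ℚ s) * (⟦ decreasing? μ ⟧ * (g μ * g μ))) (ℕ.≡ᵇ⇒≡ (sumℕ μ) _ t))))
               (rearrange₄ (h k) ⟦ sumℕ μ ≡ᵇ n ℕ.∸ k ⟧ (x ^ℚ (n ℕ.∸ k)) ⟦ decreasing? μ ⟧ (g μ * g μ)))

    -- f(u) = h(u) f(xu) for the generating functions of f and h.
    Recursive : (ℕ → ℚ) → ℕ → Set
    Recursive f n = f n ≡ Σ< (suc n) (λ k → h k * ((x ^ℚ (n ℕ.∸ k)) * f (n ℕ.∸ k)))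

    -- The term k = 0 contains f n itself with coefficient x^n; for positive n, 1 - x^n is
    -- invertible, so the smaller values determine f n.
    recursive-unique : ∀ N (f f′ : ℕ → ℚ) → f 0 ≡ f′ 0 → (∀ n → n ℕ.≤ N → Recursive f n) → (∀ n → Recursive f′ n) →
                       ∀ n → n ℕ.≤ N → f n ≡ f′ n
    recursive-unique N f f′ f₀ rec rec′ = <-rec (λ n → n ℕ.≤ N → f n ≡ f′ n) step
      where
      step : ∀ n → (∀ {i} → i ℕ.< n → i ℕ.≤ N → f i ≡ f′ i) → n ℕ.≤ N → f n ≡ f′ n
      step zero    ih _   = f₀
      step (suc n) ih n<N = begin
        f (suc n)                                  ≡⟨ *-identityˡ (f (suc n)) ⟨
        1ℚ * f (suc n)                             ≡⟨ cong (_* f (suc n)) (ρ-inverse n) ⟨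
        (1ℚ - X) * ρ (suc n) * f (suc n)           ≡⟨ rearrange X (ρ (suc n)) (f (suc n)) ⟩
        ρ (suc n) * (f (suc n) - X * f (suc n))    ≡⟨ cong (ρ (suc n) *_) (solve-for (f (suc n)) (tail f) (rec (suc n) n<N)) ⟩
        ρ (suc n) * tail f                         ≡⟨ cong (ρ (suc n) *_) (Σ<-cong (suc n) (λ k _ → cong (λ z → h (suc k) * ((x ^ℚ (n ℕ.∸ k)) * z))
                                                        (ih (s≤s (ℕ.m∸n≤m n k)) (ℕ.≤-trans (ℕ.m∸n≤m n k) (ℕ.≤-trans (ℕ.n≤1+n n) n<N))))) ⟩
        ρ (suc n) * tail f′                        ≡⟨ cong (ρ (suc n) *_) (solve-for (f′ (suc n)) (tail f′) (rec′ (suc n))) ⟨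
        ρ (suc n) * (f′ (suc n) - X * f′ (suc n))  ≡⟨ rearrange X (ρ (suc n)) (f′ (suc n)) ⟨
        (1ℚ - X) * ρ (suc n) * f′ (suc n)          ≡⟨ cong (_* f′ (suc n)) (ρ-inverse n) ⟩
        1ℚ * f′ (suc n)                            ≡⟨ *-identityˡ (f′ (suc n)) ⟩
        f′ (suc n) ∎
        where
        X = x ^ℚ suc n
        tail : (ℕ → ℚ) → ℚ
        tail f = Σ< (suc n) (λ k → h (suc k) * ((x ^ℚ (n ℕ.∸ k)) * f (n ℕ.∸ k)))
        rearrange : ∀ y r d → (1ℚ - y) * r * d ≡ r * (d - y * d)
        rearrange = solve-∀ ℚ-ring
        cancel : ∀ y t → 1ℚ * y + t - y ≡ t
        cancel = solve-∀ ℚ-ring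
        solve-for : ∀ a t → a ≡ 1ℚ * (X * a) + t → a - X * a ≡ t
        solve-for a t e = trans (cong (_- X * a) e) (cancel (X * a) t)

    K-unique : ∀ (f : ℕ → ℚ) → f 0 ≡ 1ℚ → (∀ n → Recursive f n) → ∀ n → n ℕ.≤ m → K m n ≡ f n
    K-unique f f₀ rec = recursive-unique m (K m) f (trans (K₀ m) (sym f₀))
      (λ n n≤m → trans (sym (K-stable m n n≤m)) (K-recursion m n n≤m n≤m)) rec
      where
      K₀ : ∀ ℓ → K ℓ 0 ≡ 1ℚ
      K₀ zero    = refl
      K₀ (suc ℓ) = trans (K-stable ℓ 0 z≤n) (K₀ ℓ)

-- The generating polynomial of inv + maj as a list of coefficients.

module Mahonian where

  open Base
  open import Defs using (_^ℚ_; fromℕ; evalPoly)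
  open Principal using (module Specialisation)
  open import Data.Bool using (true; false; T; if_then_else_; not)
  open import Data.List using (List; []; _∷_; _++_; _∷ʳ_; length; reverse; last; replicate; zipWith)
  open import Data.List.Properties using (reverse-++; unfold-reverse; length-++; length-replicate; length-zipWith; zipWith-comm; ++-assoc; length-reverse)
  open import Data.Maybe using (just)
  open import Data.Nat as ℕ using (ℕ; zero; suc; z≤n; s≤s; _≤ᵇ_; _<ᵇ_; _!)
  import Data.Nat.Properties as ℕ
  open import Data.Nat.Combinatorics using (_C_; nC1≡n; nCk+nC[k+1]≡[n+1]C[k+1])
  open import Data.Nat.Tactic.RingSolver using () renaming (solve-∀ to ℕ-solve-∀)
  import Data.Integer as ℤ
  import Data.Integer.Properties as ℤ
  open import Data.Product using (∃; _,_; proj₂)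
  open import Data.Rational using (ℚ; 0ℚ; 1ℚ; _+_; _*_; _-_; -_; toℚᵘ)
  open import Data.Rational.Properties using (*-zeroˡ; *-zeroʳ; *-identityˡ; *-identityʳ; +-identityʳ; +-identityˡ; *-assoc; +-assoc; +-comm; *-distribˡ-+; toℚᵘ-injective; toℚᵘ-fromℚᵘ; toℚᵘ-homo-+)
  import Data.Rational.Unnormalised as ℚᵘ
  import Data.Rational.Unnormalised.Properties as ℚᵘ
  open import Data.Unit using (tt)
  open import Data.Empty using (⊥-elim)
  open import Function using (_∘_)
  open import Relation.Binary.PropositionalEquality
  open import Tactic.RingSolver using (solve-∀)
  open ≡-Reasoning

  fromℕ-toℚᵘ : ∀ n → toℚᵘ (fromℕ n) ℚᵘ.≃ ℚᵘ.mkℚᵘ (ℤ.+ n) 0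
  fromℕ-toℚᵘ n = toℚᵘ-fromℚᵘ (ℚᵘ.mkℚᵘ (ℤ.+ n) 0)

  fromℕ-+ : ∀ m n → fromℕ (m ℕ.+ n) ≡ fromℕ m + fromℕ n
  fromℕ-+ m n = toℚᵘ-injective (ℚᵘ.≃-trans (fromℕ-toℚᵘ (m ℕ.+ n))
    (ℚᵘ.≃-trans (ℚᵘ.*≡* (cong (ℤ._* ℤ.+ 1) (cong₂ ℤ._+_ (sym (ℤ.*-identityʳ (ℤ.+ m))) (sym (ℤ.*-identityʳ (ℤ.+ n))))))
    (ℚᵘ.≃-sym (ℚᵘ.≃-trans (toℚᵘ-homo-+ (fromℕ m) (fromℕ n)) (ℚᵘ.+-cong (fromℕ-toℚᵘ m) (fromℕ-toℚᵘ n))))))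

  fromℕ-* : ∀ m n → fromℕ (m ℕ.* n) ≡ fromℕ m * fromℕ n
  fromℕ-* zero    n = sym (*-zeroˡ (fromℕ n))
  fromℕ-* (suc m) n = begin
    fromℕ (n ℕ.+ m ℕ.* n)               ≡⟨ trans (fromℕ-+ n (m ℕ.* n)) (cong (fromℕ n +_) (fromℕ-* m n)) ⟩
    fromℕ n + fromℕ m * fromℕ n         ≡⟨ collect (fromℕ n) (fromℕ m) ⟩
    (1ℚ + fromℕ m) * fromℕ n            ≡⟨ cong (_* fromℕ n) (fromℕ-+ 1 m) ⟨
    fromℕ (suc m) * fromℕ n             ∎
    where
    collect : ∀ a b → a + b * a ≡ (1ℚ + b) * a
    collect = solve-∀ ℚ-ring

  infixl 6 _⊕_
  -- `zipWith` cuts to the shorter list, so this is polynomial addition for lists of equal length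
  -- only. Hence the padding in `shift` and the length hypotheses below.
  _⊕_ : List ℕ → List ℕ → List ℕ
  _⊕_ = zipWith ℕ._+_

  ⊕-assoc : ∀ a b c → (a ⊕ b) ⊕ c ≡ a ⊕ (b ⊕ c)
  ⊕-assoc []      b       c       = refl
  ⊕-assoc (x ∷ a) []      c       = refl
  ⊕-assoc (x ∷ a) (y ∷ b) []      = refl
  ⊕-assoc (x ∷ a) (y ∷ b) (z ∷ c) = cong₂ _∷_ (ℕ.+-assoc x y z) (⊕-assoc a b c)

  ⊕-comm : ∀ a b → a ⊕ b ≡ b ⊕ a
  ⊕-comm = zipWith-comm ℕ._+_ ℕ.+-comm

  ⊕-length : ∀ {k} a b → length a ≡ k → length b ≡ k → length (a ⊕ b) ≡ k
  ⊕-length a b p q = trans (length-zipWith ℕ._+_ a b) (trans (cong₂ ℕ._⊓_ p q) (ℕ.⊓-idem _))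

  ⊕-∷ʳ : ∀ a b x y → length a ≡ length b → (a ∷ʳ x) ⊕ (b ∷ʳ y) ≡ (a ⊕ b) ∷ʳ (x ℕ.+ y)
  ⊕-∷ʳ []      []      x y e = refl
  ⊕-∷ʳ (u ∷ a) (v ∷ b) x y e = cong (u ℕ.+ v ∷_) (⊕-∷ʳ a b x y (ℕ.suc-injective e))

  reverse-⊕ : ∀ a b → length a ≡ length b → reverse (a ⊕ b) ≡ reverse a ⊕ reverse b
  reverse-⊕ []      []      e = refl
  reverse-⊕ (x ∷ a) (y ∷ b) e = begin
    reverse (x ℕ.+ y ∷ a ⊕ b)             ≡⟨ unfold-reverse (x ℕ.+ y) (a ⊕ b) ⟩
    reverse (a ⊕ b) ∷ʳ (x ℕ.+ y)          ≡⟨ cong (_∷ʳ (x ℕ.+ y)) (reverse-⊕ a b e′) ⟩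
    (reverse a ⊕ reverse b) ∷ʳ (x ℕ.+ y)  ≡⟨ ⊕-∷ʳ (reverse a) (reverse b) x y (trans (length-reverse a) (trans e′ (sym (length-reverse b)))) ⟨
    (reverse a ∷ʳ x) ⊕ (reverse b ∷ʳ y)   ≡⟨ cong₂ _⊕_ (unfold-reverse x a) (unfold-reverse y b) ⟨
    reverse (x ∷ a) ⊕ reverse (y ∷ b)     ∎
    where
    e′ = ℕ.suc-injective e

  -- x^s · c, padded with t zero coefficients on top.
  shift : ℕ → ℕ → List ℕ → List ℕ
  shift s t c = replicate s 0 ++ (c ++ replicate t 0)

  length-shift : ∀ s t c → length (shift s t c) ≡ s ℕ.+ t ℕ.+ length c
  length-shift s t c = begin
    length (shift s t c)                 ≡⟨ length-++ (replicate s 0) ⟩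
    length (replicate s 0) ℕ.+ length (c ++ replicate t 0)
      ≡⟨ cong₂ ℕ._+_ (length-replicate s) (trans (length-++ c) (cong (length c ℕ.+_) (length-replicate t))) ⟩
    s ℕ.+ (length c ℕ.+ t)               ≡⟨ rearrange s (length c) t ⟩
    s ℕ.+ t ℕ.+ length c                 ∎
    where
    rearrange : ∀ s l t → s ℕ.+ (l ℕ.+ t) ≡ s ℕ.+ t ℕ.+ l
    rearrange = ℕ-solve-∀

  reverse-replicate : ∀ n → reverse (replicate n 0) ≡ replicate n 0
  reverse-replicate zero    = refl
  reverse-replicate (suc n) = trans (unfold-reverse 0 (replicate n 0)) (trans (cong (_∷ʳ 0) (reverse-replicate n)) (commute n))
    where
    commute : ∀ n → replicate n 0 ∷ʳ 0 ≡ 0 ∷ replicate n 0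
    commute zero    = refl
    commute (suc n) = cong (0 ∷_) (commute n)

  reverse-shift : ∀ s t c → reverse (shift s t c) ≡ shift t s (reverse c)
  reverse-shift s t c = begin
    reverse (replicate s 0 ++ (c ++ replicate t 0))                    ≡⟨ reverse-++ (replicate s 0) (c ++ replicate t 0) ⟩
    reverse (c ++ replicate t 0) ++ reverse (replicate s 0)            ≡⟨ cong₂ _++_ (reverse-++ c (replicate t 0)) (reverse-replicate s) ⟩
    (reverse (replicate t 0) ++ reverse c) ++ replicate s 0            ≡⟨ cong (λ z → (z ++ reverse c) ++ replicate s 0) (reverse-replicate t) ⟩
    (replicate t 0 ++ reverse c) ++ replicate s 0                      ≡⟨ ++-assoc (replicate t 0) (reverse c) (replicate s 0) ⟩
    shift t s (reverse c) ∎

  sumTo : ℕ → (ℕ → List ℕ) → List ℕ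
  sumTo zero    f = f 0
  sumTo (suc n) f = sumTo n f ⊕ f (suc n)

  sumTo-cong : ∀ n {f f′ : ℕ → List ℕ} → (∀ j → j ℕ.≤ n → f j ≡ f′ j) → sumTo n f ≡ sumTo n f′
  sumTo-cong zero    e = e 0 z≤n
  sumTo-cong (suc n) e = cong₂ _⊕_ (sumTo-cong n (λ j j≤n → e j (ℕ.≤-trans j≤n (ℕ.n≤1+n n)))) (e (suc n) ℕ.≤-refl)

  sumTo-length : ∀ {k} n f → (∀ j → j ℕ.≤ n → length (f j) ≡ k) → length (sumTo n f) ≡ k
  sumTo-length zero    f e = e 0 z≤n
  sumTo-length (suc n) f e = ⊕-length (sumTo n f) (f (suc n)) (sumTo-length n f (λ j j≤n → e j (ℕ.≤-trans j≤n (ℕ.n≤1+n n)))) (e (suc n) ℕ.≤-refl)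

  reverse-sumTo : ∀ {k} n f → (∀ j → j ℕ.≤ n → length (f j) ≡ k) → reverse (sumTo n f) ≡ sumTo n (reverse ∘ f)
  reverse-sumTo zero    f e = refl
  reverse-sumTo (suc n) f e = trans (reverse-⊕ (sumTo n f) (f (suc n)) (trans (sumTo-length n f e′) (sym (e (suc n) ℕ.≤-refl))))
    (cong (_⊕ reverse (f (suc n))) (reverse-sumTo n f e′))
    where
    e′ : ∀ j → j ℕ.≤ n → length (f j) ≡ _
    e′ j j≤n = e j (ℕ.≤-trans j≤n (ℕ.n≤1+n n))

  sumTo-first : ∀ n f → sumTo (suc n) f ≡ f 0 ⊕ sumTo n (f ∘ suc)
  sumTo-first zero    f = refl
  sumTo-first (suc n) f = trans (cong (_⊕ f (suc (suc n))) (sumTo-first n f)) (⊕-assoc (f 0) (sumTo n (f ∘ suc)) (f (suc (suc n))))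

  sumTo-reflect : ∀ n f → sumTo n f ≡ sumTo n (λ j → f (n ℕ.∸ j))
  sumTo-reflect zero    f = refl
  sumTo-reflect (suc n) f = begin
    sumTo (suc n) f                                                ≡⟨ sumTo-first n f ⟩
    f 0 ⊕ sumTo n (f ∘ suc)                                        ≡⟨ ⊕-comm (f 0) (sumTo n (f ∘ suc)) ⟩
    sumTo n (f ∘ suc) ⊕ f 0                                        ≡⟨ cong (_⊕ f 0) (sumTo-reflect n (f ∘ suc)) ⟩
    sumTo n (λ j → f (suc (n ℕ.∸ j))) ⊕ f 0                        ≡⟨ cong₂ _⊕_ (sumTo-cong n (λ j j≤n → cong f (ℕ.+-∸-assoc 1 j≤n))) (cong f (ℕ.n∸n≡0 n)) ⟨
    sumTo n (λ j → f (suc n ℕ.∸ j)) ⊕ f (suc n ℕ.∸ suc n) ∎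

  -- `up` is the increase of inv + maj, and `down` its complement in 2(n + 1), the increase of the
  -- top degree. All summands thus have equal length, and reversing a list exchanges the two.
  up down : ℕ → ℕ → ℕ → ℕ
  up   n i j = i ℕ.+ (if j <ᵇ i then suc n else 0)
  down n i j = (suc n ℕ.∸ i) ℕ.+ (if j <ᵇ i then 0 else suc n)

  up+down : ∀ n i j → i ℕ.≤ suc n → up n i j ℕ.+ down n i j ≡ suc n ℕ.+ suc n
  up+down n i j i≤ with j <ᵇ i
  ... | true  = trans (rearrange i (suc n ℕ.∸ i) (suc n)) (cong (ℕ._+ suc n) (ℕ.m+[n∸m]≡n i≤))
    where
    rearrange : ∀ i d n → i ℕ.+ n ℕ.+ (d ℕ.+ 0) ≡ i ℕ.+ d ℕ.+ n
    rearrange = ℕ-solve-∀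
  ... | false = trans (rearrange i (suc n ℕ.∸ i) (suc n)) (cong (ℕ._+ suc n) (ℕ.m+[n∸m]≡n i≤))
    where
    rearrange : ∀ i d n → i ℕ.+ 0 ℕ.+ (d ℕ.+ n) ≡ i ℕ.+ d ℕ.+ n
    rearrange = ℕ-solve-∀

  -- mahonian n i is the sum of x^(inv π + maj π) over the permutations π of
  -- {0,…,n} with last letter n − i: appending that letter creates i inversions,
  -- and a descent at position n exactly when the previous letter is larger.
  mahonian : ℕ → ℕ → List ℕ
  mahonian zero    i = 1 ∷ []
  mahonian (suc n) i = sumTo n (λ j → shift (up n i j) (down n i j) (mahonian n j))

  total : ℕ → List ℕ
  total zero    = 1 ∷ []
  total (suc n) = sumTo n (mahonian n)

  size : ℕ → ℕ
  size zero    = 1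
  size (suc n) = (suc n ℕ.+ suc n) ℕ.+ size n

  mahonian-length : ∀ n i → i ℕ.≤ n → length (mahonian n i) ≡ size n
  mahonian-length zero    i _   = refl
  mahonian-length (suc n) i i≤n = sumTo-length n _ (λ j j≤n → trans (length-shift (up n i j) (down n i j) (mahonian n j))
    (cong₂ ℕ._+_ (up+down n i j i≤n) (mahonian-length n j j≤n)))

  total-length : ∀ n → length (total n) ≡ 2 ℕ.* (n C 2) ℕ.+ 1
  total-length zero    = refl
  total-length (suc n) = trans (sumTo-length n (mahonian n) (mahonian-length n)) (size-C n)
    where
    rearrange : ∀ n c → (suc n ℕ.+ suc n) ℕ.+ (2 ℕ.* c ℕ.+ 1) ≡ 2 ℕ.* (suc n ℕ.+ c) ℕ.+ 1
    rearrange = ℕ-solve-∀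
    size-C : ∀ n → size n ≡ 2 ℕ.* (suc n C 2) ℕ.+ 1
    size-C zero    = refl
    size-C (suc n) = begin
      (suc n ℕ.+ suc n) ℕ.+ size n                       ≡⟨ cong ((suc n ℕ.+ suc n) ℕ.+_) (size-C n) ⟩
      (suc n ℕ.+ suc n) ℕ.+ (2 ℕ.* (suc n C 2) ℕ.+ 1)    ≡⟨ rearrange n (suc n C 2) ⟩
      2 ℕ.* (suc n ℕ.+ suc n C 2) ℕ.+ 1                  ≡⟨ cong (λ z → 2 ℕ.* (z ℕ.+ suc n C 2) ℕ.+ 1) (nC1≡n (suc n)) ⟨
      2 ℕ.* (suc n C 1 ℕ.+ suc n C 2) ℕ.+ 1              ≡⟨ cong (λ z → 2 ℕ.* z ℕ.+ 1) (nCk+nC[k+1]≡[n+1]C[k+1] (suc n) 1) ⟩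
      2 ℕ.* (suc (suc n) C 2) ℕ.+ 1 ∎

  -- Complementing letters replaces i by n + 1 - i and j by n - j, and turns a descent at the end
  -- into an ascent.
  opposite : ∀ n i j → i ℕ.≤ suc n → j ℕ.≤ n → (j <ᵇ (suc n ℕ.∸ i)) ≡ not (n ℕ.∸ j <ᵇ i)
  opposite n i j i≤ j≤ with j <ᵇ (suc n ℕ.∸ i) in p | n ℕ.∸ j <ᵇ i in r
  ... | true  | false = refl
  ... | false | true  = refl
  ... | true  | true  = ⊥-elim (ℕ.<-irrefl refl (ℕ.≤-trans lt₂ (ℕ.≤-pred lt₁)))
    where
    lt₁ : suc (i ℕ.+ j) ℕ.≤ suc n
    lt₁ = ℕ.≤-trans (ℕ.≤-reflexive (sym (ℕ.+-suc i j))) (ℕ.≤-trans (ℕ.+-monoʳ-≤ i (ℕ.<ᵇ⇒< j _ (subst T (sym p) tt))) (ℕ.≤-reflexive (ℕ.m+[n∸m]≡n i≤)))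
    lt₂ : suc n ℕ.≤ i ℕ.+ j
    lt₂ = ℕ.≤-trans (ℕ.≤-reflexive (cong suc (sym (ℕ.m∸n+n≡m j≤)))) (ℕ.+-monoˡ-≤ j (ℕ.<ᵇ⇒< (n ℕ.∸ j) i (subst T (sym r) tt)))
  ... | false | false = ⊥-elim (ℕ.<-irrefl refl (ℕ.≤-trans ge₂ ge₁))
    where
    i≤n∸j : i ℕ.≤ n ℕ.∸ j
    i≤n∸j = ℕ.≮⇒≥ (λ lt → subst T r (ℕ.<⇒<ᵇ lt))
    1+n∸i≤j : suc n ℕ.∸ i ℕ.≤ j
    1+n∸i≤j = ℕ.≮⇒≥ (λ lt → subst T p (ℕ.<⇒<ᵇ lt))
    ge₁ : i ℕ.+ j ℕ.≤ n
    ge₁ = ℕ.≤-trans (ℕ.+-monoˡ-≤ j i≤n∸j) (ℕ.≤-reflexive (ℕ.m∸n+n≡m j≤))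
    ge₂ : suc n ℕ.≤ i ℕ.+ j
    ge₂ = ℕ.≤-trans (ℕ.≤-reflexive (sym (ℕ.m+[n∸m]≡n i≤))) (ℕ.+-monoʳ-≤ i 1+n∸i≤j)

  -- Complementing the letters of a permutation.
  mahonian-reverse : ∀ n i → i ℕ.≤ n → reverse (mahonian n i) ≡ mahonian n (n ℕ.∸ i)
  mahonian-reverse zero    i _   = refl
  mahonian-reverse (suc n) i i≤n = begin
    reverse (sumTo n (λ j → shift (up n i j) (down n i j) (mahonian n j)))
      ≡⟨ reverse-sumTo n _ (λ j j≤n → trans (length-shift (up n i j) (down n i j) (mahonian n j)) (cong₂ ℕ._+_ (up+down n i j i≤n) (mahonian-length n j j≤n))) ⟩
    sumTo n (λ j → reverse (shift (up n i j) (down n i j) (mahonian n j)))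
      ≡⟨ sumTo-cong n (λ j j≤n → trans (reverse-shift (up n i j) (down n i j) (mahonian n j)) (cong (shift (down n i j) (up n i j)) (mahonian-reverse n j j≤n))) ⟩
    sumTo n (λ j → shift (down n i j) (up n i j) (mahonian n (n ℕ.∸ j)))
      ≡⟨ sumTo-reflect n (λ j → shift (down n i j) (up n i j) (mahonian n (n ℕ.∸ j))) ⟩
    sumTo n (λ j → shift (down n i (n ℕ.∸ j)) (up n i (n ℕ.∸ j)) (mahonian n (n ℕ.∸ (n ℕ.∸ j))))
      ≡⟨ sumTo-cong n (λ j j≤n → trans (cong (shift (down n i (n ℕ.∸ j)) (up n i (n ℕ.∸ j)) ∘ mahonian n) (ℕ.m∸[m∸n]≡n j≤n)) (cong₂ (λ s t → shift s t (mahonian n j)) (exponent₁ j j≤n) (exponent₂ j j≤n))) ⟩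
    sumTo n (λ j → shift (up n (suc n ℕ.∸ i) j) (down n (suc n ℕ.∸ i) j) (mahonian n j)) ∎
    where
    if-not : ∀ b (u v : ℕ) → (if b then u else v) ≡ (if not b then v else u)
    if-not true  u v = refl
    if-not false u v = refl
    flip : ∀ j → j ℕ.≤ n → ∀ (u v : ℕ) → (if n ℕ.∸ j <ᵇ i then u else v) ≡ (if j <ᵇ suc n ℕ.∸ i then v else u)
    flip j j≤n u v = trans (if-not (n ℕ.∸ j <ᵇ i) u v) (cong (if_then v else u) (sym (opposite n i j i≤n j≤n)))
    exponent₁ : ∀ j → j ℕ.≤ n → down n i (n ℕ.∸ j) ≡ up n (suc n ℕ.∸ i) j
    exponent₁ j j≤n = cong (suc n ℕ.∸ i ℕ.+_) (flip j j≤n 0 (suc n))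
    exponent₂ : ∀ j → j ℕ.≤ n → up n i (n ℕ.∸ j) ≡ down n (suc n ℕ.∸ i) j
    exponent₂ j j≤n = cong₂ ℕ._+_ (sym (ℕ.m∸[m∸n]≡n i≤n)) (flip j j≤n (suc n) 0)

  total-reverse : ∀ n → reverse (total n) ≡ total n
  total-reverse zero    = refl
  total-reverse (suc n) = begin
    reverse (sumTo n (mahonian n))          ≡⟨ reverse-sumTo n (mahonian n) (mahonian-length n) ⟩
    sumTo n (reverse ∘ mahonian n)          ≡⟨ sumTo-cong n (mahonian-reverse n) ⟩
    sumTo n (λ i → mahonian n (n ℕ.∸ i))    ≡⟨ sumTo-reflect n (mahonian n) ⟨
    sumTo n (mahonian n) ∎

  PositiveHead : List ℕ → Set
  PositiveHead c = ∃ λ k → ∃ λ cs → c ≡ suc k ∷ cs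

  sumTo-head : ∀ {k} n f → PositiveHead (f 0) → (∀ j → j ℕ.≤ n → length (f j) ≡ suc k) → PositiveHead (sumTo n f)
  sumTo-head zero    f p e = p
  sumTo-head (suc n) f p e with sumTo n f | sumTo-head n f p (λ j j≤n → e j (ℕ.≤-trans j≤n (ℕ.n≤1+n n))) | f (suc n) | e (suc n) ℕ.≤-refl
  ... | _ | k , cs , refl | d ∷ ds | _ = k ℕ.+ d , cs ⊕ ds , refl

  size-suc : ∀ n → ∃ λ k → size n ≡ suc k
  size-suc zero    = 0 , refl
  size-suc (suc n) = _ , refl

  -- The identity permutation ends in its largest letter and has inv + maj = 0, so the constant term
  -- is positive; by symmetry the top coefficient will be too.
  mahonian-head : ∀ n → PositiveHead (mahonian n 0)
  mahonian-head zero    = 0 , [] , refl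
  mahonian-head (suc n) = sumTo-head n _ first (λ j j≤n → trans (length-shift (up n 0 j) (down n 0 j) (mahonian n j))
      (cong₂ ℕ._+_ (up+down n 0 j z≤n) (mahonian-length n j j≤n)))
    where
    first : PositiveHead (shift 0 (down n 0 0) (mahonian n 0))
    first with mahonian n 0 | mahonian-head n
    ... | _ | k , cs , refl = k , _ , refl

  total-head : ∀ n → PositiveHead (total n)
  total-head zero    = 0 , [] , refl
  total-head (suc n) = sumTo-head n (mahonian n) (mahonian-head n) (λ j j≤n → trans (mahonian-length n j j≤n) (proj₂ (size-suc n)))

  last-∷ʳ : ∀ (c : List ℕ) x → last (c ∷ʳ x) ≡ just x
  last-∷ʳ []          x = refl
  last-∷ʳ (y ∷ [])    x = refl
  last-∷ʳ (y ∷ z ∷ c) x = last-∷ʳ (z ∷ c) x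

  total-last : ∀ n → ∃ λ k → last (total n) ≡ just (suc k)
  total-last n with total-head n
  ... | k , cs , e = k , (begin
    last (total n)               ≡⟨ cong last (total-reverse n) ⟨
    last (reverse (total n))     ≡⟨ cong (last ∘ reverse) e ⟩
    last (reverse (suc k ∷ cs))  ≡⟨ cong last (unfold-reverse (suc k) cs) ⟩
    last (reverse cs ∷ʳ suc k)   ≡⟨ last-∷ʳ (reverse cs) (suc k) ⟩
    just (suc k) ∎)

  evalPoly-⊕ : ∀ x a b → length a ≡ length b → evalPoly (a ⊕ b) x ≡ evalPoly a x + evalPoly b x
  evalPoly-⊕ x []      []      e = refl
  evalPoly-⊕ x (u ∷ a) (v ∷ b) e = trans (cong₂ (λ s t → s + x * t) (fromℕ-+ u v) (evalPoly-⊕ x a b (ℕ.suc-injective e)))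
    (rearrange (fromℕ u) (fromℕ v) x (evalPoly a x) (evalPoly b x))
    where
    rearrange : ∀ u v x a b → u + v + x * (a + b) ≡ u + x * a + (v + x * b)
    rearrange = solve-∀ ℚ-ring

  evalPoly-padding : ∀ x c t → evalPoly (c ++ replicate t 0) x ≡ evalPoly c x
  evalPoly-padding x []      zero    = refl
  evalPoly-padding x []      (suc t) = trans (cong (λ z → 0ℚ + x * z) (evalPoly-padding x [] t)) (zero-tail x)
    where
    zero-tail : ∀ x → 0ℚ + x * 0ℚ ≡ 0ℚ
    zero-tail = solve-∀ ℚ-ring
  evalPoly-padding x (u ∷ c) t       = cong (λ z → fromℕ u + x * z) (evalPoly-padding x c t)

  evalPoly-shift : ∀ x s t c → evalPoly (shift s t c) x ≡ (x ^ℚ s) * evalPoly c x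
  evalPoly-shift x zero    t c = trans (evalPoly-padding x c t) (sym (*-identityˡ (evalPoly c x)))
  evalPoly-shift x (suc s) t c = trans (+-identityˡ (x * evalPoly (shift s t c) x))
    (trans (cong (x *_) (evalPoly-shift x s t c)) (sym (*-assoc x (x ^ℚ s) (evalPoly c x))))

  evalPoly-sumTo : ∀ x {k} n f → (∀ j → j ℕ.≤ n → length (f j) ≡ k) → evalPoly (sumTo n f) x ≡ Σ< (suc n) (λ j → evalPoly (f j) x)
  evalPoly-sumTo x zero    f e = sym (+-identityʳ (evalPoly (f 0) x))
  evalPoly-sumTo x (suc n) f e = begin
    evalPoly (sumTo n f ⊕ f (suc n)) x
      ≡⟨ evalPoly-⊕ x (sumTo n f) (f (suc n)) (trans (sumTo-length n f e′) (sym (e (suc n) ℕ.≤-refl))) ⟩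
    evalPoly (sumTo n f) x + evalPoly (f (suc n)) x
      ≡⟨ cong (_+ evalPoly (f (suc n)) x) (evalPoly-sumTo x n f e′) ⟩
    Σ< (suc n) (λ j → evalPoly (f j) x) + evalPoly (f (suc n)) x
      ≡⟨ Σ<-last (suc n) (λ j → evalPoly (f j) x) ⟨
    Σ< (suc (suc n)) (λ j → evalPoly (f j) x) ∎
    where
    e′ : ∀ j → j ℕ.≤ n → length (f j) ≡ _
    e′ j j≤n = e j (ℕ.≤-trans j≤n (ℕ.n≤1+n n))

  evalPoly-mahonian : ∀ x n i → i ℕ.≤ suc n → evalPoly (mahonian (suc n) i) x ≡ Σ< (suc n) (λ j → (x ^ℚ up n i j) * evalPoly (mahonian n j) x)
  evalPoly-mahonian x n i i≤ = trans
    (evalPoly-sumTo x n _ (λ j j≤n → trans (length-shift (up n i j) (down n i j) (mahonian n j)) (cong₂ ℕ._+_ (up+down n i j i≤) (mahonian-length n j j≤n))))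
    (Σ<-ext (suc n) (λ j → evalPoly-shift x (up n i j) (down n i j) (mahonian n j)))

  evalPoly-total : ∀ x n → evalPoly (total (suc n)) x ≡ Σ< (suc n) (λ j → evalPoly (mahonian n j) x)
  evalPoly-total x n = evalPoly-sumTo x n (mahonian n) (mahonian-length n)

  Σ<-const : ∀ n c → Σ< n (λ _ → c) ≡ fromℕ n * c
  Σ<-const zero    c = sym (*-zeroˡ c)
  Σ<-const (suc n) c = trans (cong (c +_) (Σ<-const n c)) (trans (collect c (fromℕ n)) (cong (_* c) (sym (fromℕ-+ 1 n))))
    where
    collect : ∀ a b → a + b * a ≡ (1ℚ + b) * a
    collect = solve-∀ ℚ-ring

  -- At x = 1 the weights disappear and each of the n + 2 choices of last letter contributes the
  -- whole previous total.
  total-at-1 : ∀ n → evalPoly (total n) 1ℚ ≡ fromℕ (n !)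
  total-at-1 zero          = refl
  total-at-1 (suc zero)    = refl
  total-at-1 (suc (suc n)) = begin
    evalPoly (total (suc (suc n))) 1ℚ
      ≡⟨ evalPoly-total 1ℚ (suc n) ⟩
    Σ< (suc (suc n)) (λ i → evalPoly (mahonian (suc n) i) 1ℚ)
      ≡⟨ Σ<-cong (suc (suc n)) (λ i i< → trans (evalPoly-mahonian 1ℚ n i (ℕ.≤-pred i<))
           (trans (Σ<-ext (suc n) (λ j → trans (cong (_* evalPoly (mahonian n j) 1ℚ) (1^ℚ (up n i j))) (*-identityˡ (evalPoly (mahonian n j) 1ℚ))))
                  (sym (evalPoly-total 1ℚ n)))) ⟩
    Σ< (suc (suc n)) (λ _ → evalPoly (total (suc n)) 1ℚ)
      ≡⟨ Σ<-const (suc (suc n)) (evalPoly (total (suc n)) 1ℚ) ⟩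
    fromℕ (suc (suc n)) * evalPoly (total (suc n)) 1ℚ
      ≡⟨ cong (fromℕ (suc (suc n)) *_) (total-at-1 (suc n)) ⟩
    fromℕ (suc (suc n)) * fromℕ (suc n !)
      ≡⟨ fromℕ-* (suc (suc n)) (suc n !) ⟨
    fromℕ (suc (suc n) !) ∎

  evalPoly-∷ʳ : ∀ x c u → evalPoly (c ∷ʳ u) x ≡ evalPoly c x + (x ^ℚ length c) * fromℕ u
  evalPoly-∷ʳ x []      u = base (fromℕ u) x
    where
    base : ∀ u x → u + x * 0ℚ ≡ 0ℚ + 1ℚ * u
    base = solve-∀ ℚ-ring
  evalPoly-∷ʳ x (v ∷ c) u = trans (cong (λ z → fromℕ v + x * z) (evalPoly-∷ʳ x c u)) (rearrange (fromℕ v) x (evalPoly c x) (x ^ℚ length c) (fromℕ u))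
    where
    rearrange : ∀ v x e y u → v + x * (e + y * u) ≡ v + x * e + x * y * u
    rearrange = solve-∀ ℚ-ring

  -- The extra factor `q` on the left avoids the exponent `length c - 1`, so that the empty list is
  -- no exception.
  evalPoly-reverse : ∀ x q c → x * q ≡ 1ℚ → q * evalPoly (reverse c) q ≡ (q ^ℚ length c) * evalPoly c x
  evalPoly-reverse x q []      e = zero-both q
    where
    zero-both : ∀ q → q * 0ℚ ≡ 1ℚ * 0ℚ
    zero-both = solve-∀ ℚ-ring
  evalPoly-reverse x q (u ∷ c) e = begin
    q * evalPoly (reverse (u ∷ c)) q
      ≡⟨ cong (λ z → q * evalPoly z q) (unfold-reverse u c) ⟩
    q * evalPoly (reverse c ∷ʳ u) q
      ≡⟨ cong (q *_) (evalPoly-∷ʳ q (reverse c) u) ⟩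
    q * (evalPoly (reverse c) q + (q ^ℚ length (reverse c)) * fromℕ u)
      ≡⟨ cong (λ z → q * (evalPoly (reverse c) q + (q ^ℚ z) * fromℕ u)) (length-reverse c) ⟩
    q * (evalPoly (reverse c) q + Q * fromℕ u)
      ≡⟨ *-distribˡ-+ q (evalPoly (reverse c) q) (Q * fromℕ u) ⟩
    q * evalPoly (reverse c) q + q * (Q * fromℕ u)
      ≡⟨ cong (_+ q * (Q * fromℕ u)) (evalPoly-reverse x q c e) ⟩
    Q * evalPoly c x + q * (Q * fromℕ u)
      ≡⟨ cong (λ z → z + q * (Q * fromℕ u)) (trans (sym (*-identityˡ (Q * evalPoly c x))) (cong (_* (Q * evalPoly c x)) (sym e))) ⟩
    x * q * (Q * evalPoly c x) + q * (Q * fromℕ u)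
      ≡⟨ rearrange q x Q (evalPoly c x) (fromℕ u) ⟩
    q * Q * (fromℕ u + x * evalPoly c x) ∎
    where
    Q = q ^ℚ length c
    rearrange : ∀ q x y e u → x * q * (y * e) + q * (y * u) ≡ q * y * (u + x * e)
    rearrange = solve-∀ ℚ-ring

  -- Gaussian binomials and the recursion for the permutation sums.

  qbinomial : ℚ → ℕ → ℕ → ℚ
  qbinomial x N       zero    = 1ℚ
  qbinomial x zero    (suc k) = 0ℚ
  qbinomial x (suc N) (suc k) = qbinomial x N k + (x ^ℚ suc k) * qbinomial x N (suc k)

  module Recursion (x q : ℚ) (xq≡1 : x * q ≡ 1ℚ) (ρ : ℕ → ℚ)
                   (ρ-inverse : ∀ k → (1ℚ - (x ^ℚ suc k)) * ρ (suc k) ≡ 1ℚ) where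

    open Specialisation x q xq≡1 ρ ρ-inverse

    p : ℕ → ℚ
    p zero    = 1ℚ
    p (suc k) = (1ℚ - (x ^ℚ suc k)) * p k

    p*h : ∀ k → p k * h k ≡ 1ℚ
    p*h zero    = refl
    p*h (suc k) = trans (rearrange (1ℚ - (x ^ℚ suc k)) (p k) (h (suc k))) (trans (cong (p k *_) (h-step k)) (p*h k))
      where
      rearrange : ∀ a b c → a * b * c ≡ b * (a * c)
      rearrange = solve-∀ ℚ-ring

    qbinomial-zero : ∀ N k → qbinomial x N (suc (N ℕ.+ k)) ≡ 0ℚ
    qbinomial-zero zero    k = refl
    qbinomial-zero (suc N) k = trans (cong₂ _+_ (qbinomial-zero N k) (*-zeroʳ′ (x ^ℚ suc (suc (N ℕ.+ k)))
        (trans (cong (λ z → qbinomial x N (suc z)) (sym (ℕ.+-suc N k))) (qbinomial-zero N (suc k))))) refl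

    -- The quotient formula for Gaussian binomials, cleared of denominators. The induction rests on
    -- (1 - X) + X (1 - Z) = 1 - XZ.
    qbinomial-p : ∀ k m → qbinomial x (k ℕ.+ m) k * (p k * p m) ≡ p (k ℕ.+ m)
    qbinomial-p zero    m       = trans (*-identityˡ (1ℚ * p m)) (*-identityˡ (p m))
    qbinomial-p (suc k) zero    = begin
      (b + X * qbinomial x (k ℕ.+ 0) (suc k)) * (((1ℚ - X) * p k) * 1ℚ)
        ≡⟨ cong (λ z → (b + X * z) * (((1ℚ - X) * p k) * 1ℚ)) (trans (cong (λ z → qbinomial x z (suc k)) (ℕ.+-identityʳ k))
             (trans (cong (λ z → qbinomial x k (suc z)) (sym (ℕ.+-identityʳ k))) (qbinomial-zero k 0))) ⟩
      (b + X * 0ℚ) * (((1ℚ - X) * p k) * 1ℚ)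
        ≡⟨ rearrange b X (p k) ⟩
      (1ℚ - X) * (b * (p k * 1ℚ))
        ≡⟨ cong ((1ℚ - X) *_) (qbinomial-p k 0) ⟩
      (1ℚ - X) * p (k ℕ.+ 0)
        ≡⟨ cong (λ z → (1ℚ - (x ^ℚ suc z)) * p (k ℕ.+ 0)) (ℕ.+-identityʳ k) ⟨
      p (suc (k ℕ.+ 0)) ∎
      where
      b = qbinomial x (k ℕ.+ 0) k
      X = x ^ℚ suc k
      rearrange : ∀ b y p → (b + y * 0ℚ) * (((1ℚ - y) * p) * 1ℚ) ≡ (1ℚ - y) * (b * (p * 1ℚ))
      rearrange = solve-∀ ℚ-ring
    qbinomial-p (suc k) (suc m) = begin
      (b + X * b′) * (((1ℚ - X) * p k) * ((1ℚ - Z) * p m))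
        ≡⟨ rearrange b b′ X (p k) Z (p m) ⟩
      (1ℚ - X) * (b * (p k * ((1ℚ - Z) * p m))) + X * (1ℚ - Z) * (b′ * (((1ℚ - X) * p k) * p m))
        ≡⟨ cong₂ (λ u v → (1ℚ - X) * u + X * (1ℚ - Z) * v) (qbinomial-p k (suc m))
             (trans (cong (λ z → qbinomial x z (suc k) * (p (suc k) * p m)) (ℕ.+-suc k m))
               (trans (qbinomial-p (suc k) m) (cong p (sym (ℕ.+-suc k m))))) ⟩
      (1ℚ - X) * P + X * (1ℚ - Z) * P
        ≡⟨ collect X Z P ⟩
      (1ℚ - X * Z) * P
        ≡⟨ cong (λ z → (1ℚ - z) * P) (^ℚ-+ x (suc k) (suc m)) ⟨
      p (suc (k ℕ.+ suc m)) ∎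
      where
      b  = qbinomial x (k ℕ.+ suc m) k
      b′ = qbinomial x (k ℕ.+ suc m) (suc k)
      X = x ^ℚ suc k
      Z = x ^ℚ suc m
      P = p (k ℕ.+ suc m)
      rearrange : ∀ b c y p z r → (b + y * c) * (((1ℚ - y) * p) * ((1ℚ - z) * r))
                  ≡ (1ℚ - y) * (b * (p * ((1ℚ - z) * r))) + y * (1ℚ - z) * (c * (((1ℚ - y) * p) * r))
      rearrange = solve-∀ ℚ-ring
      collect : ∀ y z p → (1ℚ - y) * p + y * (1ℚ - z) * p ≡ (1ℚ - y * z) * p
      collect = solve-∀ ℚ-ring

    qbinomial-h : ∀ k m → h (k ℕ.+ m) * qbinomial x (k ℕ.+ m) k ≡ h k * h m
    qbinomial-h k m = begin
      hN * b                                                 ≡⟨ *-identityʳ (hN * b) ⟨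
      hN * b * 1ℚ                                            ≡⟨ cong₂ (λ u v → hN * b * (u * v)) (p*h k) (p*h m) ⟨
      hN * b * (p k * h k * (p m * h m))                     ≡⟨ rearrange hN b (p k) (h k) (p m) (h m) ⟩
      b * (p k * p m) * hN * (h k * h m)                     ≡⟨ cong (λ z → z * hN * (h k * h m)) (qbinomial-p k m) ⟩
      p (k ℕ.+ m) * hN * (h k * h m)                         ≡⟨ cong (_* (h k * h m)) (p*h (k ℕ.+ m)) ⟩
      1ℚ * (h k * h m)                                       ≡⟨ *-identityˡ (h k * h m) ⟩
      h k * h m ∎
      where
      hN = h (k ℕ.+ m)
      b = qbinomial x (k ℕ.+ m) k
      rearrange : ∀ n b p h r i → n * b * (p * h * (r * i)) ≡ b * (p * r) * n * (h * i)
      rearrange = solve-∀ ℚ-ring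

    b : ℕ → ℕ → ℚ
    b n i = evalPoly (mahonian n i) x

    t : ℕ → ℚ
    t n = evalPoly (total n) x

    -- The permutations of {0,…,N−1} whose last letter is at most N − 1 − i
    R : ℕ → ℕ → ℚ
    R zero    i = 0ℚ
    R (suc n) i = Σ< (suc n) (λ j → ⟦ i ≤ᵇ j ⟧ * b n j)

    -- The weight of a transition is x^i times x^n for a descent and 1 otherwise. Writing the latter
    -- as x^n + (1 - x^n)[no descent] separates a full sum from the tail sum `R`.
    b-R : ∀ n i → i ℕ.≤ n → b n i ≡ (x ^ℚ i) * ((x ^ℚ n) * t n + (1ℚ - (x ^ℚ n)) * R n i)
    b-R zero    zero z≤n = constant x
      where
      constant : ∀ x → 1ℚ + x * 0ℚ ≡ 1ℚ * (1ℚ * (1ℚ + x * 0ℚ) + (1ℚ - 1ℚ) * 0ℚ)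
      constant = solve-∀ ℚ-ring
    b-R (suc n) i    i≤  = begin
      b (suc n) i
        ≡⟨ evalPoly-mahonian x n i i≤ ⟩
      Σ< (suc n) (λ j → (x ^ℚ up n i j) * b n j)
        ≡⟨ Σ<-ext (suc n) term ⟩
      Σ< (suc n) (λ j → (x ^ℚ i) * (X * b n j + (1ℚ - X) * (⟦ i ≤ᵇ j ⟧ * b n j)))
        ≡⟨ trans (Σ<-* (suc n) (x ^ℚ i) (λ j → X * b n j + (1ℚ - X) * (⟦ i ≤ᵇ j ⟧ * b n j))) (cong ((x ^ℚ i) *_) (Σ<-+ (suc n) (λ j → X * b n j) (λ j → (1ℚ - X) * (⟦ i ≤ᵇ j ⟧ * b n j)))) ⟩
      (x ^ℚ i) * (Σ< (suc n) (λ j → X * b n j) + Σ< (suc n) (λ j → (1ℚ - X) * (⟦ i ≤ᵇ j ⟧ * b n j)))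
        ≡⟨ cong ((x ^ℚ i) *_) (cong₂ _+_ (trans (Σ<-* (suc n) X (b n)) (cong (X *_) (sym (evalPoly-total x n)))) (Σ<-* (suc n) (1ℚ - X) (λ j → ⟦ i ≤ᵇ j ⟧ * b n j))) ⟩
      (x ^ℚ i) * (X * t (suc n) + (1ℚ - X) * R (suc n) i) ∎
      where
      X = x ^ℚ suc n
      below : ∀ y z c → y * z * c ≡ y * (z * c + (1ℚ - z) * (0ℚ * c))
      below = solve-∀ ℚ-ring
      above : ∀ y z c → y * 1ℚ * c ≡ y * (z * c + (1ℚ - z) * (1ℚ * c))
      above = solve-∀ ℚ-ring
      cases : ∀ j → (j <ᵇ i) ≡ not (i ≤ᵇ j)
      cases j with j <ᵇ i in e₁ | i ≤ᵇ j in e₂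
      ... | true  | false = refl
      ... | false | true  = refl
      ... | true  | true  = ⊥-elim (ℕ.<⇒≱ (ℕ.<ᵇ⇒< j i (subst T (sym e₁) tt)) (ℕ.≤ᵇ⇒≤ i j (subst T (sym e₂) tt)))
      ... | false | false = ⊥-elim (subst T e₂ (ℕ.≤⇒≤ᵇ {i} {j} (ℕ.≮⇒≥ (λ lt → subst T e₁ (ℕ.<⇒<ᵇ lt)))))
      term : ∀ j → (x ^ℚ up n i j) * b n j ≡ (x ^ℚ i) * (X * b n j + (1ℚ - X) * (⟦ i ≤ᵇ j ⟧ * b n j))
      term j rewrite cases j with i ≤ᵇ j
      ... | true  = trans (cong (_* b n j) (^ℚ-+ x i 0)) (above (x ^ℚ i) X (b n j))
      ... | false = trans (cong (_* b n j) (^ℚ-+ x i (suc n))) (below (x ^ℚ i) X (b n j))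

    R-end : ∀ n → R (suc n) (suc n) ≡ 0ℚ
    R-end n = trans (Σ<-cong (suc n) (λ j j≤n → *-zeroˡ′ (b n j) (bad j (ℕ.≤-pred j≤n)))) (Σ<-0 (suc n))
      where
      bad : ∀ j → j ℕ.≤ n → ⟦ suc n ≤ᵇ j ⟧ ≡ 0ℚ
      bad j j≤n with suc n ≤ᵇ j in e
      ... | true  = ⊥-elim (ℕ.<⇒≱ (s≤s j≤n) (ℕ.≤ᵇ⇒≤ (suc n) j (subst T (sym e) tt)))
      ... | false = refl

    R-step : ∀ n i → i ℕ.≤ n → R (suc n) i ≡ b n i + R (suc n) (suc i)
    R-step n i i≤n = peel (suc n) i (b n) (s≤s i≤n)
      where
      zero-first : ∀ a s → 1ℚ * a + s ≡ a + (0ℚ * a + s)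
      zero-first = solve-∀ ℚ-ring
      swap : ∀ a u s → 0ℚ * a + (u + s) ≡ u + (0ℚ * a + s)
      swap = solve-∀ ℚ-ring
      ≤ᵇ-suc : ∀ i j → (suc i ≤ᵇ suc j) ≡ (i ≤ᵇ j)
      ≤ᵇ-suc zero    j = refl
      ≤ᵇ-suc (suc i) j = refl
      peel : ∀ N i (f : ℕ → ℚ) → i ℕ.< N → Σ< N (λ j → ⟦ i ≤ᵇ j ⟧ * f j) ≡ f i + Σ< N (λ j → ⟦ suc i ≤ᵇ j ⟧ * f j)
      peel (suc N) zero    f _       = zero-first (f 0) _
      peel (suc N) (suc i) f (s≤s p) = trans
        (cong (0ℚ * f 0 +_) (trans (Σ<-ext N (λ j → cong (λ z → ⟦ z ⟧ * f (suc j)) (≤ᵇ-suc i j))) (peel N i (f ∘ suc) p)))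
        (trans (swap (f 0) (f (suc i)) (Σ< N (λ j → ⟦ suc i ≤ᵇ j ⟧ * f (suc j))))
               (cong (λ z → f (suc i) + (0ℚ * f 0 + z)) (Σ<-ext N (λ j → cong (λ z → ⟦ z ⟧ * f (suc j)) (sym (≤ᵇ-suc (suc i) j))))))

    z : ℕ → ℚ
    z m = (x ^ℚ m) * (h m * t m)

    suffix : ℕ → ℕ → ℕ → ℕ → ℚ
    suffix N M i k = qbinomial x M (suc k) * ((x ^ℚ (i ℕ.* suc k)) * z (N ℕ.∸ suc k))

    -- b-R iterated: the k-th term collects the permutations with k + 1 increasing last letters.
    R-formula : ∀ n M i → M ℕ.+ i ≡ suc n → R (suc n) i ≡ p n * Σ< (suc n) (suffix (suc n) M i)
    R-scaled : ∀ n M i → M ℕ.+ i ≡ n → (1ℚ - (x ^ℚ n)) * R n i ≡ p n * Σ< n (suffix n M i)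

    R-scaled zero    M i e = refl
    R-scaled (suc n) M i e = trans (cong ((1ℚ - (x ^ℚ suc n)) *_) (R-formula n M i e)) (sym (*-assoc (1ℚ - (x ^ℚ suc n)) (p n) _))

    R-formula n zero    i refl = trans (R-end n) (sym (*-zeroʳ′ (p n)
      (trans (Σ<-ext (suc n) (λ k → *-zeroˡ ((x ^ℚ (suc n ℕ.* suc k)) * z (n ℕ.∸ k)))) (Σ<-0 (suc n)))))
    R-formula n (suc M) i e = begin
      R (suc n) i
        ≡⟨ R-step n i i≤n ⟩
      b n i + R (suc n) (suc i)
        ≡⟨ cong₂ _+_ (b-R n i i≤n) (R-formula n M (suc i) (trans (ℕ.+-suc M i) e)) ⟩
      (x ^ℚ i) * ((x ^ℚ n) * t n + (1ℚ - (x ^ℚ n)) * R n i) + p n * Σ< (suc n) (suffix (suc n) M (suc i))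
        ≡⟨ cong₂ (λ u v → (x ^ℚ i) * (u + v) + p n * Σ< (suc n) (suffix (suc n) M (suc i))) first (R-scaled n M i M+i≡n) ⟩
      (x ^ℚ i) * (p n * z n + p n * Σ< n (suffix n M i)) + p n * Σ< (suc n) (suffix (suc n) M (suc i))
        ≡⟨ factor (x ^ℚ i) (p n) (z n) (Σ< n (suffix n M i)) (Σ< (suc n) (suffix (suc n) M (suc i))) ⟩
      p n * ((x ^ℚ i) * (1ℚ * (1ℚ * z n) + Σ< n (suffix n M i)) + Σ< (suc n) (suffix (suc n) M (suc i)))
        -- The isolated `z n` is the term k = 0 of `A`, and `suffix n M i` supplies its later terms;
        -- the two sums then match under the Pascal rule.
        ≡⟨ cong (λ w → p n * ((x ^ℚ i) * (1ℚ * ((x ^ℚ w) * z n) + Σ< n (suffix n M i)) + Σ< (suc n) (suffix (suc n) M (suc i)))) (ℕ.*-zeroʳ i) ⟨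
      p n * ((x ^ℚ i) * Σ< (suc n) A + Σ< (suc n) (suffix (suc n) M (suc i)))
        ≡⟨ cong (p n *_) (trans (cong (_+ Σ< (suc n) (suffix (suc n) M (suc i))) (sym (Σ<-* (suc n) (x ^ℚ i) A))) (sym (Σ<-+ (suc n) (λ k → (x ^ℚ i) * A k) (suffix (suc n) M (suc i))))) ⟩
      p n * Σ< (suc n) (λ k → (x ^ℚ i) * A k + suffix (suc n) M (suc i) k)
        ≡⟨ cong (p n *_) (Σ<-ext (suc n) pascal) ⟩
      p n * Σ< (suc n) (suffix (suc n) (suc M) i) ∎
      where
      M+i≡n : M ℕ.+ i ≡ n
      M+i≡n = ℕ.suc-injective e
      i≤n : i ℕ.≤ n
      i≤n = subst (i ℕ.≤_) M+i≡n (ℕ.m≤n+m i M)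
      A : ℕ → ℚ
      A k = qbinomial x M k * ((x ^ℚ (i ℕ.* k)) * z (n ℕ.∸ k))
      first : (x ^ℚ n) * t n ≡ p n * z n
      first = begin
        (x ^ℚ n) * t n                    ≡⟨ *-identityˡ ((x ^ℚ n) * t n) ⟨
        1ℚ * ((x ^ℚ n) * t n)             ≡⟨ cong (_* ((x ^ℚ n) * t n)) (p*h n) ⟨
        p n * h n * ((x ^ℚ n) * t n)      ≡⟨ rearrange (p n) (h n) (x ^ℚ n) (t n) ⟩
        p n * z n ∎
        where
        rearrange : ∀ p h y t → p * h * (y * t) ≡ p * (y * (h * t))
        rearrange = solve-∀ ℚ-ring
      factor : ∀ y p z s u → y * (p * z + p * s) + p * u ≡ p * (y * (1ℚ * (1ℚ * z) + s) + u)
      factor = solve-∀ ℚ-ring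
      rearrange : ∀ y b c w k z → y * (b * (w * z)) + c * ((k * (y * w)) * z) ≡ (b + k * c) * ((y * w) * z)
      rearrange = solve-∀ ℚ-ring
      pascal : ∀ k → (x ^ℚ i) * A k + suffix (suc n) M (suc i) k ≡ suffix (suc n) (suc M) i k
      pascal k = begin
        (x ^ℚ i) * A k + qbinomial x M (suc k) * ((x ^ℚ (suc i ℕ.* suc k)) * z (n ℕ.∸ k))
          ≡⟨ cong (λ w → (x ^ℚ i) * A k + qbinomial x M (suc k) * (w * z (n ℕ.∸ k))) (trans (^ℚ-+ x (suc k) (i ℕ.* suc k)) (cong ((x ^ℚ suc k) *_) split)) ⟩
        (x ^ℚ i) * A k + qbinomial x M (suc k) * (((x ^ℚ suc k) * ((x ^ℚ i) * (x ^ℚ (i ℕ.* k)))) * z (n ℕ.∸ k))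
          ≡⟨ rearrange (x ^ℚ i) (qbinomial x M k) (qbinomial x M (suc k)) (x ^ℚ (i ℕ.* k)) (x ^ℚ suc k) (z (n ℕ.∸ k)) ⟩
        (qbinomial x M k + (x ^ℚ suc k) * qbinomial x M (suc k)) * (((x ^ℚ i) * (x ^ℚ (i ℕ.* k))) * z (n ℕ.∸ k))
          ≡⟨ cong (λ w → qbinomial x (suc M) (suc k) * (w * z (n ℕ.∸ k))) split ⟨
        suffix (suc n) (suc M) i k ∎
        where
        split : (x ^ℚ (i ℕ.* suc k)) ≡ (x ^ℚ i) * (x ^ℚ (i ℕ.* k))
        split = trans (cong (x ^ℚ_) (ℕ.*-suc i k)) (^ℚ-+ x i (i ℕ.* k))

    -- The permutation sum divided by (x)_n²; `H-recursive` shows that it obeys the recursion that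
    -- determines the Cauchy sum.
    H : ℕ → ℚ
    H n = h n * h n * t n

    H-zero : H 0 ≡ 1ℚ
    H-zero = constant x
      where
      constant : ∀ x → 1ℚ * 1ℚ * (1ℚ + x * 0ℚ) ≡ 1ℚ
      constant = solve-∀ ℚ-ring

    p*p*H : ∀ n → p n * p n * H n ≡ t n
    p*p*H n = trans (rearrange (p n) (h n) (t n)) (trans (cong (λ w → w * w * t n) (p*h n)) (tidy (t n)))
      where
      rearrange : ∀ p h t → p * p * (h * h * t) ≡ p * h * (p * h) * t
      rearrange = solve-∀ ℚ-ring
      tidy : ∀ t → 1ℚ * 1ℚ * t ≡ t
      tidy = solve-∀ ℚ-ring

    H-recursive : ∀ n → H n ≡ Σ< (suc n) (λ k → h k * ((x ^ℚ (n ℕ.∸ k)) * H (n ℕ.∸ k)))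
    H-recursive zero    = constant (H 0)
      where
      constant : ∀ a → a ≡ 1ℚ * (1ℚ * a) + 0ℚ
      constant = solve-∀ ℚ-ring
    H-recursive (suc n) = begin
      H (suc n)                                   ≡⟨ split X (H (suc n)) ⟩
      -- The first summand is the term k = 0 of the recursion; the factor 1 - x^(n+1) in the second
      -- lowers one of the two factors `h (suc n)` to `h n`, which `p n` cancels.
      1ℚ * (X * H (suc n)) + (1ℚ - X) * H (suc n) ≡⟨ cong (1ℚ * (X * H (suc n)) +_) rest ⟩
      1ℚ * (X * H (suc n)) + Σ< (suc n) (λ k → h (suc k) * ((x ^ℚ (n ℕ.∸ k)) * H (n ℕ.∸ k))) ∎
      where
      X = x ^ℚ suc n
      split : ∀ y a → a ≡ 1ℚ * (y * a) + (1ℚ - y) * a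
      split = solve-∀ ℚ-ring
      rearrange₁ : ∀ y g t → (1ℚ - y) * (g * g * t) ≡ (1ℚ - y) * g * (g * t)
      rearrange₁ = solve-∀ ℚ-ring
      rearrange₂ : ∀ h g p s → h * (g * (p * s)) ≡ p * h * (g * s)
      rearrange₂ = solve-∀ ℚ-ring
      rearrange₃ : ∀ g b z → g * (b * (1ℚ * z)) ≡ g * b * z
      rearrange₃ = solve-∀ ℚ-ring
      rearrange₄ : ∀ h g y t → h * g * (y * (g * t)) ≡ h * (y * (g * g * t))
      rearrange₄ = solve-∀ ℚ-ring
      -- At i = 0 the tail sum is over all last letters, so `R-formula` gives the total in terms of
      -- smaller totals.
      t-formula : t (suc n) ≡ p n * Σ< (suc n) (suffix (suc n) (suc n) 0)
      t-formula = trans (evalPoly-total x n) (trans (Σ<-ext (suc n) (λ j → sym (*-identityˡ (b n j)))) (R-formula n (suc n) 0 (ℕ.+-identityʳ (suc n))))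
      term : ∀ k → k ℕ.< suc n → h (suc n) * suffix (suc n) (suc n) 0 k ≡ h (suc k) * ((x ^ℚ (n ℕ.∸ k)) * H (n ℕ.∸ k))
      term k k≤n = begin
        h (suc n) * (qbinomial x (suc n) (suc k) * (1ℚ * z (n ℕ.∸ k)))
          ≡⟨ rearrange₃ (h (suc n)) (qbinomial x (suc n) (suc k)) (z (n ℕ.∸ k)) ⟩
        h (suc n) * qbinomial x (suc n) (suc k) * z (n ℕ.∸ k)
          ≡⟨ cong (_* z (n ℕ.∸ k)) (trans (cong (λ w → h (suc w) * qbinomial x (suc w) (suc k)) (sym (ℕ.m+[n∸m]≡n (ℕ.≤-pred k≤n)))) (qbinomial-h (suc k) (n ℕ.∸ k))) ⟩
        h (suc k) * h (n ℕ.∸ k) * ((x ^ℚ (n ℕ.∸ k)) * (h (n ℕ.∸ k) * t (n ℕ.∸ k)))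
          ≡⟨ rearrange₄ (h (suc k)) (h (n ℕ.∸ k)) (x ^ℚ (n ℕ.∸ k)) (t (n ℕ.∸ k)) ⟩
        h (suc k) * ((x ^ℚ (n ℕ.∸ k)) * H (n ℕ.∸ k)) ∎
      rest : (1ℚ - X) * H (suc n) ≡ Σ< (suc n) (λ k → h (suc k) * ((x ^ℚ (n ℕ.∸ k)) * H (n ℕ.∸ k)))
      rest = begin
        (1ℚ - X) * H (suc n)
          ≡⟨ rearrange₁ X (h (suc n)) (t (suc n)) ⟩
        (1ℚ - X) * h (suc n) * (h (suc n) * t (suc n))
          ≡⟨ cong₂ (λ u v → u * (h (suc n) * v)) (h-step n) t-formula ⟩
        h n * (h (suc n) * (p n * Σ< (suc n) (suffix (suc n) (suc n) 0)))
          ≡⟨ rearrange₂ (h n) (h (suc n)) (p n) (Σ< (suc n) (suffix (suc n) (suc n) 0)) ⟩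
        p n * h n * (h (suc n) * Σ< (suc n) (suffix (suc n) (suc n) 0))
          ≡⟨ trans (cong (_* (h (suc n) * Σ< (suc n) (suffix (suc n) (suc n) 0))) (p*h n)) (*-identityˡ (h (suc n) * Σ< (suc n) (suffix (suc n) (suc n) 0))) ⟩
        h (suc n) * Σ< (suc n) (suffix (suc n) (suc n) 0)
          ≡⟨ Σ<-* (suc n) (h (suc n)) (suffix (suc n) (suc n) 0) ⟨
        Σ< (suc n) (λ k → h (suc n) * suffix (suc n) (suc n) 0 k)
          ≡⟨ Σ<-cong (suc n) term ⟩
        Σ< (suc n) (λ k → h (suc k) * ((x ^ℚ (n ℕ.∸ k)) * H (n ℕ.∸ k))) ∎

-- Power series in u and the counting of multiplicities by weight.

module Series where

  open Base
  open import Defs using (_^ℚ_; fromℕ; sumℕ; sumQ; ways; pairWeights; coef; partialSum)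
  open Mahonian using (fromℕ-+; fromℕ-toℚᵘ)
  open import Data.Bool using (true; false; T; if_then_else_)
  open import Data.List using (List; []; _∷_; _++_; map; concatMap; applyUpTo; upTo)
  open import Data.List.Properties using (map-upTo)
  open import Data.Nat as ℕ using (ℕ; zero; suc; z≤n; s≤s; _≤ᵇ_)
  import Data.Nat.Properties as ℕ
  import Data.Integer as ℤ
  import Data.Integer.Properties as ℤ
  open import Data.Product using (∃; _,_)
  open import Data.Sum using (inj₁; inj₂)
  open import Data.Rational using (ℚ; 0ℚ; 1ℚ; _+_; _*_; _≤_; _<_; ∣_∣; nonNegative; mkℚ)
  import Data.Rational as ℚ
  import Data.Rational.Properties as ℚ
  open import Data.Rational.Properties using (*-zeroˡ; *-zeroʳ; *-identityˡ; *-identityʳ; +-identityʳ; +-identityˡ; *-assoc; *-comm; +-comm)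
  import Data.Rational.Unnormalised as ℚᵘ
  import Data.Rational.Unnormalised.Properties as ℚᵘ
  open import Data.Unit using (tt)
  open import Data.Empty using (⊥-elim)
  open import Function using (_∘_; id)
  open import Relation.Binary.PropositionalEquality
  open import Tactic.RingSolver using (solve-∀)
  open ≡-Reasoning

  0≤1 : 0ℚ ≤ 1ℚ
  0≤1 = ℚ.*≤* (ℤ.+≤+ z≤n)

  0≤+ : ∀ {a b} → 0ℚ ≤ a → 0ℚ ≤ b → 0ℚ ≤ a + b
  0≤+ p r = ℚ.+-mono-≤ p r

  *-monoˡ : ∀ {c a b} → 0ℚ ≤ c → a ≤ b → c * a ≤ c * b
  *-monoˡ {c} p = ℚ.*-monoˡ-≤-nonNeg c {{nonNegative p}}

  0≤* : ∀ {a b} → 0ℚ ≤ a → 0ℚ ≤ b → 0ℚ ≤ a * b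
  0≤* {a} p r = ℚ.≤-trans (ℚ.≤-reflexive (sym (*-zeroʳ a))) (*-monoˡ p r)

  *-mono : ∀ {a b c d} → 0ℚ ≤ a → a ≤ b → 0ℚ ≤ d → c ≤ d → a * c ≤ b * d
  *-mono {a} {b} {c} {d} 0≤a a≤b 0≤d c≤d = ℚ.≤-trans (*-monoˡ 0≤a c≤d) (ℚ.*-monoʳ-≤-nonNeg d {{nonNegative 0≤d}} a≤b)

  0≤^ : ∀ {a} n → 0ℚ ≤ a → 0ℚ ≤ a ^ℚ n
  0≤^ zero    p = 0≤1
  0≤^ (suc n) p = 0≤* p (0≤^ n p)

  ^-mono : ∀ {a b} n → 0ℚ ≤ a → a ≤ b → a ^ℚ n ≤ b ^ℚ n
  ^-mono zero    p r = ℚ.≤-refl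
  ^-mono (suc n) p r = *-mono p r (0≤^ n (ℚ.≤-trans p r)) (^-mono n p r)

  ≤-+ʳ : ∀ a {b} → 0ℚ ≤ b → a ≤ a + b
  ≤-+ʳ a p = ℚ.≤-trans (ℚ.≤-reflexive (sym (+-identityʳ a))) (ℚ.+-monoʳ-≤ a p)

  ≤-+ˡ : ∀ {a} b → 0ℚ ≤ a → b ≤ a + b
  ≤-+ˡ {a} b p = ℚ.≤-trans (≤-+ʳ b p) (ℚ.≤-reflexive (+-comm b a))

  0≤fromℕ : ∀ n → 0ℚ ≤ fromℕ n
  0≤fromℕ zero    = ℚ.≤-refl
  0≤fromℕ (suc n) = ℚ.≤-trans (0≤+ 0≤1 (0≤fromℕ n)) (ℚ.≤-reflexive (sym (fromℕ-+ 1 n)))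

  fromℕ-mono : ∀ {m n} → m ℕ.≤ n → fromℕ m ≤ fromℕ n
  fromℕ-mono {m} m≤n with ℕ.m≤n⇒∃[o]m+o≡n m≤n
  ... | o , refl = ℚ.≤-trans (≤-+ʳ (fromℕ m) (0≤fromℕ o)) (ℚ.≤-reflexive (sym (fromℕ-+ m o)))

  archimedean : ∀ p → ∃ λ n → p ≤ fromℕ (suc n)
  archimedean p@(mkℚ num d-1 _) = ℤ.∣ num ∣ , ℚ.toℚᵘ-cancel-≤ (ℚᵘ.≤-respʳ-≃ (ℚᵘ.≃-sym (fromℕ-toℚᵘ (suc ℤ.∣ num ∣))) (ℚᵘ.*≤* bound))
    where
    N = ℤ.∣ num ∣
    i≤∣i∣ : ∀ i → i ℤ.≤ ℤ.+ ℤ.∣ i ∣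
    i≤∣i∣ (ℤ.+ n)    = ℤ.≤-refl
    i≤∣i∣ ℤ.-[1+ n ] = ℤ.-≤+
    bound : num ℤ.* ℤ.+ 1 ℤ.≤ ℤ.+ (suc N) ℤ.* ℤ.+ (suc d-1)
    bound = ℤ.≤-trans (ℤ.≤-reflexive (ℤ.*-identityʳ num)) (ℤ.≤-trans (i≤∣i∣ num)
      (ℤ.≤-trans (ℤ.+≤+ (ℕ.≤-trans (ℕ.n≤1+n N) (ℕ.m≤m*n (suc N) (suc d-1)))) (ℤ.≤-reflexive (ℤ.pos-* (suc N) (suc d-1)))))

  Σ<-mono : ∀ n {f f′ : ℕ → ℚ} → (∀ i → i ℕ.< n → f i ≤ f′ i) → Σ< n f ≤ Σ< n f′
  Σ<-mono zero    e = ℚ.≤-refl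
  Σ<-mono (suc n) e = ℚ.+-mono-≤ (e 0 (s≤s z≤n)) (Σ<-mono n (λ i i<n → e (suc i) (s≤s i<n)))

  0≤Σ< : ∀ n {f : ℕ → ℚ} → (∀ i → i ℕ.< n → 0ℚ ≤ f i) → 0ℚ ≤ Σ< n f
  0≤Σ< n e = ℚ.≤-trans (ℚ.≤-reflexive (sym (Σ<-0 n))) (Σ<-mono n e)

  sumQ-applyUpTo : ∀ n (f : ℕ → ℚ) → sumQ (applyUpTo f n) ≡ Σ< n f
  sumQ-applyUpTo zero    f = refl
  sumQ-applyUpTo (suc n) f = cong (f 0 +_) (sumQ-applyUpTo n (f ∘ suc))

  sumQ-upTo : ∀ n (f : ℕ → ℚ) → sumQ (map f (upTo n)) ≡ Σ< n f
  sumQ-upTo n f = trans (cong sumQ (map-upTo f n)) (sumQ-applyUpTo n f)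

  fromℕ-sum : ∀ n (f : ℕ → ℕ) → fromℕ (sumℕ (map f (upTo n))) ≡ Σ< n (fromℕ ∘ f)
  fromℕ-sum n f = trans (cong (fromℕ ∘ sumℕ) (map-upTo f n)) (go n f)
    where
    go : ∀ n f → fromℕ (sumℕ (applyUpTo f n)) ≡ Σ< n (fromℕ ∘ f)
    go zero    f = refl
    go (suc n) f = trans (fromℕ-+ (f 0) (sumℕ (applyUpTo (f ∘ suc) n))) (cong (fromℕ (f 0) +_) (go n (f ∘ suc)))

  -- Power series in u, as coefficient sequences.
  Seq : Set
  Seq = ℕ → ℚ

  infixl 7 _⋆_
  _⋆_ : Seq → Seq → Seq
  (f ⋆ k) n = Σ< (suc n) (λ i → f i * k (n ℕ.∸ i))

  ⋆-cong : ∀ {f f′ k k′ : Seq} n → (∀ i → f i ≡ f′ i) → (∀ i → k i ≡ k′ i) → (f ⋆ k) n ≡ (f′ ⋆ k′) n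
  ⋆-cong n e₁ e₂ = Σ<-ext (suc n) (λ i → cong₂ _*_ (e₁ i) (e₂ (n ℕ.∸ i)))

  ⋆-comm : ∀ f k n → (f ⋆ k) n ≡ (k ⋆ f) n
  ⋆-comm f k n = trans (Σ<-reverse n (λ i → f i * k (n ℕ.∸ i)))
    (Σ<-cong (suc n) (λ i i≤n → trans (cong (λ z → f (n ℕ.∸ i) * k z) (ℕ.m∸[m∸n]≡n (ℕ.≤-pred i≤n))) (*-comm (f (n ℕ.∸ i)) (k i))))

  ⋆-linear : ∀ c (a b k : Seq) n → ((λ i → c * a i + b i) ⋆ k) n ≡ c * (a ⋆ k) n + (b ⋆ k) n
  ⋆-linear c a b k n = trans (Σ<-ext (suc n) (λ i → expand c (a i) (b i) (k (n ℕ.∸ i))))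
    (trans (Σ<-+ (suc n) (λ i → c * (a i * k (n ℕ.∸ i))) (λ i → b i * k (n ℕ.∸ i))) (cong (_+ (b ⋆ k) n) (Σ<-* (suc n) c (λ i → a i * k (n ℕ.∸ i)))))
    where
    expand : ∀ c a b k → (c * a + b) * k ≡ c * (a * k) + b * k
    expand = solve-∀ ℚ-ring

  ⋆-assoc : ∀ f k l n → ((f ⋆ k) ⋆ l) n ≡ (f ⋆ (k ⋆ l)) n
  ⋆-assoc f k l zero    = base (f 0) (k 0) (l 0)
    where
    base : ∀ a b c → (a * b + 0ℚ) * c + 0ℚ ≡ a * (b * c + 0ℚ) + 0ℚ
    base = solve-∀ ℚ-ring
  ⋆-assoc f k l (suc n) = begin
    (f 0 * k 0 + 0ℚ) * l (suc n) + ((λ i → f 0 * k (suc i) + ((f ∘ suc) ⋆ k) i) ⋆ l) n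
      ≡⟨ cong ((f 0 * k 0 + 0ℚ) * l (suc n) +_) (⋆-linear (f 0) (k ∘ suc) ((f ∘ suc) ⋆ k) l n) ⟩
    (f 0 * k 0 + 0ℚ) * l (suc n) + (f 0 * ((k ∘ suc) ⋆ l) n + (((f ∘ suc) ⋆ k) ⋆ l) n)
      ≡⟨ cong (λ z → (f 0 * k 0 + 0ℚ) * l (suc n) + (f 0 * ((k ∘ suc) ⋆ l) n + z)) (⋆-assoc (f ∘ suc) k l n) ⟩
    (f 0 * k 0 + 0ℚ) * l (suc n) + (f 0 * ((k ∘ suc) ⋆ l) n + ((f ∘ suc) ⋆ (k ⋆ l)) n)
      ≡⟨ rearrange (f 0) (k 0) (l (suc n)) (((k ∘ suc) ⋆ l) n) (((f ∘ suc) ⋆ (k ⋆ l)) n) ⟩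
    f 0 * (k 0 * l (suc n) + ((k ∘ suc) ⋆ l) n) + ((f ∘ suc) ⋆ (k ⋆ l)) n ∎
    where
    rearrange : ∀ a b c d e → (a * b + 0ℚ) * c + (a * d + e) ≡ a * (b * c + d) + e
    rearrange = solve-∀ ℚ-ring

  one : Seq
  one zero    = 1ℚ
  one (suc n) = 0ℚ

  ⋆-identityˡ : ∀ f n → (one ⋆ f) n ≡ f n
  ⋆-identityˡ f n = trans (cong₂ _+_ (*-identityˡ (f n)) (trans (tail n) refl)) (+-identityʳ (f n))
    where
    tail : ∀ n → Σ< n (λ i → 0ℚ * f (n ℕ.∸ suc i)) ≡ 0ℚ
    tail n = trans (Σ<-ext n (λ i → *-zeroˡ (f (n ℕ.∸ suc i)))) (Σ<-0 n)

  ⋆-exchange : ∀ a b c d n → ((a ⋆ b) ⋆ (c ⋆ d)) n ≡ ((a ⋆ c) ⋆ (b ⋆ d)) n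
  ⋆-exchange a b c d n = begin
    ((a ⋆ b) ⋆ (c ⋆ d)) n   ≡⟨ ⋆-assoc a b (c ⋆ d) n ⟩
    (a ⋆ (b ⋆ (c ⋆ d))) n   ≡⟨ ⋆-cong {a} n (λ _ → refl) (λ i → trans (sym (⋆-assoc b c d i)) (trans (⋆-cong {b ⋆ c} {c ⋆ b} {d} i (⋆-comm b c) (λ _ → refl)) (⋆-assoc c b d i))) ⟩
    (a ⋆ (c ⋆ (b ⋆ d))) n   ≡⟨ ⋆-assoc a c (b ⋆ d) n ⟨
    ((a ⋆ c) ⋆ (b ⋆ d)) n ∎

  scaled : ℚ → Seq → Seq
  scaled y f n = (y ^ℚ n) * f n

  scaled-⋆ : ∀ y f k n → scaled y (f ⋆ k) n ≡ (scaled y f ⋆ scaled y k) n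
  scaled-⋆ y f k n = trans (sym (Σ<-* (suc n) (y ^ℚ n) (λ i → f i * k (n ℕ.∸ i))))
    (Σ<-cong (suc n) (λ i i≤n → trans (cong (_* (f i * k (n ℕ.∸ i))) (trans (cong (y ^ℚ_) (sym (ℕ.m+[n∸m]≡n (ℕ.≤-pred i≤n)))) (^ℚ-+ y i (n ℕ.∸ i))))
                                      (rearrange (y ^ℚ i) (y ^ℚ (n ℕ.∸ i)) (f i) (k (n ℕ.∸ i)))))
    where
    rearrange : ∀ y z a b → y * z * (a * b) ≡ y * a * (z * b)
    rearrange = solve-∀ ℚ-ring

  *-^ℚ : ∀ y z n → (y * z) ^ℚ n ≡ (y ^ℚ n) * (z ^ℚ n)
  *-^ℚ y z zero    = refl
  *-^ℚ y z (suc n) = trans (cong (y * z *_) (*-^ℚ y z n)) (rearrange y z (y ^ℚ n) (z ^ℚ n))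
    where
    rearrange : ∀ a b c d → a * b * (c * d) ≡ a * c * (b * d)
    rearrange = solve-∀ ℚ-ring

  scaled-scaled : ∀ y z f n → scaled y (scaled z f) n ≡ scaled (z * y) f n
  scaled-scaled y z f n = trans (sym (*-assoc (y ^ℚ n) (z ^ℚ n) (f n)))
    (cong (_* f n) (trans (*-comm (y ^ℚ n) (z ^ℚ n)) (sym (*-^ℚ z y n))))

  geometric : ℚ → Seq
  geometric y n = y ^ℚ n

  ⋆-mono : ∀ {f f′ k k′ : Seq} n → (∀ i → 0ℚ ≤ f i) → (∀ i → i ℕ.≤ n → f i ≤ f′ i) →
           (∀ i → 0ℚ ≤ k′ i) → (∀ i → i ℕ.≤ n → k i ≤ k′ i) → (f ⋆ k) n ≤ (f′ ⋆ k′) n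
  ⋆-mono n 0≤f f≤ 0≤k′ k≤ = Σ<-mono (suc n) (λ i i≤n → *-mono (0≤f i) (f≤ i (ℕ.≤-pred i≤n)) (0≤k′ (n ℕ.∸ i)) (k≤ (n ℕ.∸ i) (ℕ.m∸n≤m n i)))

  0≤⋆ : ∀ {f k : Seq} n → (∀ i → 0ℚ ≤ f i) → (∀ i → 0ℚ ≤ k i) → 0ℚ ≤ (f ⋆ k) n
  0≤⋆ n 0≤f 0≤k = 0≤Σ< (suc n) (λ i _ → 0≤* (0≤f i) (0≤k (n ℕ.∸ i)))

  -- The convolution has every monomial of the binomial expansion with coefficient 1. This collapses
  -- a product of many geometric bounds into one.
  geometric-⋆ : ∀ b s n → 0ℚ ≤ b → 0ℚ ≤ s → (geometric b ⋆ geometric s) n ≤ geometric (b + s) n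
  geometric-⋆ b s zero    0≤b 0≤s = ℚ.≤-refl
  geometric-⋆ b s (suc n) 0≤b 0≤s = ℚ.≤-trans (ℚ.≤-reflexive step)
    (ℚ.≤-trans (ℚ.+-mono-≤ (*-monoˡ 0≤s (^-mono n 0≤s (≤-+ˡ s 0≤b))) (*-monoˡ 0≤b (geometric-⋆ b s n 0≤b 0≤s)))
               (ℚ.≤-reflexive (collect s b ((b + s) ^ℚ n))))
    where
    collect : ∀ s b w → s * w + b * w ≡ (b + s) * w
    collect = solve-∀ ℚ-ring
    step : (geometric b ⋆ geometric s) (suc n) ≡ s * (s ^ℚ n) + b * (geometric b ⋆ geometric s) n
    step = cong₂ _+_ (*-identityˡ (s * (s ^ℚ n)))
      (trans (Σ<-ext (suc n) (λ i → *-assoc b (b ^ℚ i) (s ^ℚ (n ℕ.∸ i)))) (Σ<-* (suc n) b (λ i → (b ^ℚ i) * (s ^ℚ (n ℕ.∸ i)))))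

  -- The second list arises from the first by deleting some weights, all exceeding `m`. Such weights
  -- cannot take part in a total of at most `m`, so `coef`, whose weight list varies with N, can be
  -- computed from one common list.
  data Thin (m : ℕ) : List ℕ → List ℕ → Set where
    []   : Thin m [] []
    keep : ∀ w {ws ws′} → Thin m ws ws′ → Thin m (w ∷ ws) (w ∷ ws′)
    drop : ∀ {w ws ws′} → m ℕ.< w → Thin m ws ws′ → Thin m (w ∷ ws) ws′

  Thin-++ : ∀ {m a b c d} → Thin m a b → Thin m c d → Thin m (a ++ c) (b ++ d)
  Thin-++ []         u = u
  Thin-++ (keep w t) u = keep w (Thin-++ t u)
  Thin-++ (drop p t) u = drop p (Thin-++ t u)

  Thin-applyUpTo : ∀ {m} (f : ℕ → ℕ) a e → (∀ s → a ℕ.≤ s → m ℕ.< f s) → Thin m (applyUpTo f (a ℕ.+ e)) (applyUpTo f a)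
  Thin-applyUpTo f zero    zero    p = []
  Thin-applyUpTo f zero    (suc e) p = drop (p 0 z≤n) (Thin-applyUpTo (f ∘ suc) zero e (λ s _ → p (suc s) z≤n))
  Thin-applyUpTo f (suc a) e       p = keep (f 0) (Thin-applyUpTo (f ∘ suc) a e (λ s a≤s → p (suc s) (s≤s a≤s)))

  row : ℕ → ℕ → List ℕ
  row m r = map (λ s → suc r ℕ.+ s) (upTo (m ℕ.∸ r))

  Thin-row : ∀ {m M} r → m ℕ.≤ M → Thin m (row M r) (row m r)
  Thin-row {m} {M} r m≤M with ℕ.m≤n⇒∃[o]m+o≡n (ℕ.∸-monoˡ-≤ r m≤M)
  ... | e , eq = subst₂ (Thin m) (sym (trans (map-upTo f (M ℕ.∸ r)) (cong (applyUpTo f) (sym eq)))) (sym (map-upTo f (m ℕ.∸ r)))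
    (Thin-applyUpTo f (m ℕ.∸ r) e (λ s p → s≤s (ℕ.≤-trans (ℕ.m≤n+m∸n m r) (ℕ.+-monoʳ-≤ r p))))
    where
    f : ℕ → ℕ
    f s = suc r ℕ.+ s

  -- `pairWeights m` is the case of the identity and m rows; a general index function permits
  -- induction on the number of rows.
  rows : ℕ → (ℕ → ℕ) → ℕ → List ℕ
  rows m f c = concatMap (row m) (applyUpTo f c)

  Thin-rows : ∀ {m M} f c → m ℕ.≤ M → Thin m (rows M f c) (rows m f c)
  Thin-rows f zero    m≤M = []
  Thin-rows f (suc c) m≤M = Thin-++ (Thin-row (f 0) m≤M) (Thin-rows (f ∘ suc) c m≤M)

  rows-beyond : ∀ m f d → (∀ i → m ℕ.≤ f i) → rows m f d ≡ []
  rows-beyond m f zero    p = refl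
  rows-beyond m f (suc d) p = cong₂ _++_ (cong (λ z → map (λ s → suc (f 0) ℕ.+ s) (upTo z)) (ℕ.m≤n⇒m∸n≡0 (p 0))) (rows-beyond m (f ∘ suc) d (p ∘ suc))

  rows-extend : ∀ m f c d → (∀ i → m ℕ.≤ f (c ℕ.+ i)) → rows m f (c ℕ.+ d) ≡ rows m f c
  rows-extend m f zero    d p = rows-beyond m f d p
  rows-extend m f (suc c) d p = cong (row m (f 0) ++_) (rows-extend m (f ∘ suc) c d p)

  Thin-pairWeights : ∀ {m M} → m ℕ.≤ M → Thin m (pairWeights M) (pairWeights m)
  Thin-pairWeights {m} m≤M with ℕ.m≤n⇒∃[o]m+o≡n m≤M
  ... | d , refl = subst (Thin m (pairWeights (m ℕ.+ d))) (rows-extend m id m d (ℕ.m≤m+n m)) (Thin-rows id (m ℕ.+ d) m≤M)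

  sumℕ-cong : ∀ n {f f′ : ℕ → ℕ} → (∀ i → i ℕ.< n → f i ≡ f′ i) → sumℕ (map f (upTo n)) ≡ sumℕ (map f′ (upTo n))
  sumℕ-cong n {f} {f′} e = trans (cong sumℕ (map-upTo f n)) (trans (go n e) (sym (cong sumℕ (map-upTo f′ n))))
    where
    go : ∀ n {f f′ : ℕ → ℕ} → (∀ i → i ℕ.< n → f i ≡ f′ i) → sumℕ (applyUpTo f n) ≡ sumℕ (applyUpTo f′ n)
    go zero    e = refl
    go (suc n) e = cong₂ ℕ._+_ (e 0 (s≤s z≤n)) (go n (λ i i<n → e (suc i) (s≤s i<n)))

  sumℕ-mono : ∀ n {f f′ : ℕ → ℕ} → (∀ i → f i ℕ.≤ f′ i) → sumℕ (map f (upTo n)) ℕ.≤ sumℕ (map f′ (upTo n))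
  sumℕ-mono n {f} {f′} e = subst₂ ℕ._≤_ (sym (cong sumℕ (map-upTo f n))) (sym (cong sumℕ (map-upTo f′ n))) (go n e)
    where
    go : ∀ n {f f′ : ℕ → ℕ} → (∀ i → f i ℕ.≤ f′ i) → sumℕ (applyUpTo f n) ℕ.≤ sumℕ (applyUpTo f′ n)
    go zero    e = z≤n
    go (suc n) e = ℕ.+-mono-≤ (e 0) (go n (e ∘ suc))

  ways-first : ∀ w ws n N → ways ws n N ℕ.≤ ways (w ∷ ws) n N
  ways-first w ws n N = ℕ.m≤m+n (ways ws n N) _

  sumℕ-zero : ∀ n (f : ℕ → ℕ) → (∀ i → f i ≡ 0) → sumℕ (applyUpTo f n) ≡ 0
  sumℕ-zero zero    f e = refl
  sumℕ-zero (suc n) f e = trans (cong (ℕ._+ sumℕ (applyUpTo (f ∘ suc) n)) (e 0)) (sumℕ-zero n (f ∘ suc) (e ∘ suc))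

  ways-thin-≤ : ∀ {m ws ws′} → Thin m ws ws′ → ∀ n N → ways ws′ n N ℕ.≤ ways ws n N
  ways-thin-≤ []                 n N = ℕ.≤-refl
  ways-thin-≤ (keep w {ws} {ws′} t) n N = sumℕ-mono (suc n) step
    where
    step : ∀ k → (if k ℕ.* w ≤ᵇ N then ways ws′ (n ℕ.∸ k) (N ℕ.∸ k ℕ.* w) else 0) ℕ.≤ (if k ℕ.* w ≤ᵇ N then ways ws (n ℕ.∸ k) (N ℕ.∸ k ℕ.* w) else 0)
    step k with k ℕ.* w ≤ᵇ N
    ... | true  = ways-thin-≤ t (n ℕ.∸ k) (N ℕ.∸ k ℕ.* w)
    ... | false = z≤n
  ways-thin-≤ (drop {w} {ws} p t) n N = ℕ.≤-trans (ways-thin-≤ t n N) (ways-first w ws n N)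

  ways-thin-≡ : ∀ {m ws ws′} → Thin m ws ws′ → ∀ n N → N ℕ.≤ m → ways ws n N ≡ ways ws′ n N
  ways-thin-≡ []                  n N p = refl
  ways-thin-≡ (keep w {ws} {ws′} t) n N p = sumℕ-cong (suc n) step
    where
    step : ∀ k → k ℕ.< suc n → (if k ℕ.* w ≤ᵇ N then ways ws (n ℕ.∸ k) (N ℕ.∸ k ℕ.* w) else 0) ≡ (if k ℕ.* w ≤ᵇ N then ways ws′ (n ℕ.∸ k) (N ℕ.∸ k ℕ.* w) else 0)
    step k _ with k ℕ.* w ≤ᵇ N
    ... | true  = ways-thin-≡ t (n ℕ.∸ k) (N ℕ.∸ k ℕ.* w) (ℕ.≤-trans (ℕ.m∸n≤m N (k ℕ.* w)) p)
    ... | false = refl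
  ways-thin-≡ {m} (drop {w} {ws} m<w t) n N p = trans
    (trans (cong (ways ws n N ℕ.+_) (trans (cong sumℕ rest) (sumℕ-zero n _ too-big))) (ℕ.+-identityʳ (ways ws n N))) (ways-thin-≡ t n N p)
    where
    term : ℕ → ℕ
    term k = if k ℕ.* w ≤ᵇ N then ways ws (n ℕ.∸ k) (N ℕ.∸ k ℕ.* w) else 0
    rest : map term (applyUpTo suc n) ≡ applyUpTo (term ∘ suc) n
    rest = go suc n
      where
      go : ∀ (g : ℕ → ℕ) n → map term (applyUpTo g n) ≡ applyUpTo (term ∘ g) n
      go g zero    = refl
      go g (suc n) = cong (term (g 0) ∷_) (go (g ∘ suc) n)
    too-big : ∀ k → term (suc k) ≡ 0
    too-big k with suc k ℕ.* w ≤ᵇ N in eq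
    ... | false = refl
    ... | true  = ⊥-elim (ℕ.<⇒≱ (ℕ.≤-<-trans p m<w) (ℕ.≤-trans (ℕ.m≤m+n w (k ℕ.* w)) (ℕ.≤ᵇ⇒≤ (suc k ℕ.* w) N (subst T (sym eq) tt))))

  data AllBelow (m : ℕ) : List ℕ → Set where
    []  : AllBelow m []
    _∷_ : ∀ {w ws} → w ℕ.≤ m → AllBelow m ws → AllBelow m (w ∷ ws)

  AllBelow-++ : ∀ {m a b} → AllBelow m a → AllBelow m b → AllBelow m (a ++ b)
  AllBelow-++ []      u = u
  AllBelow-++ (p ∷ t) u = p ∷ AllBelow-++ t u

  AllBelow-pairWeights : ∀ m → AllBelow m (pairWeights m)
  AllBelow-pairWeights m = go id m
    where
    applied : ∀ (f : ℕ → ℕ) c → (∀ s → s ℕ.< c → f s ℕ.≤ m) → AllBelow m (applyUpTo f c)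
    applied f zero    p = []
    applied f (suc c) p = p 0 (s≤s z≤n) ∷ applied (f ∘ suc) c (λ s s<c → p (suc s) (s≤s s<c))
    fits : ∀ r s → s ℕ.< m ℕ.∸ r → suc r ℕ.+ s ℕ.≤ m
    fits r s lt with ℕ.≤-total r m
    ... | inj₁ r≤m = ℕ.≤-trans (ℕ.≤-reflexive (sym (ℕ.+-suc r s))) (ℕ.≤-trans (ℕ.+-monoʳ-≤ r lt) (ℕ.≤-reflexive (ℕ.m+[n∸m]≡n r≤m)))
    ... | inj₂ m≤r with () ← subst (s ℕ.<_) (ℕ.m≤n⇒m∸n≡0 m≤r) lt
    go : ∀ f c → AllBelow m (rows m f c)
    go f zero    = []
    go f (suc c) = AllBelow-++ (subst (AllBelow m) (sym (map-upTo (λ s → suc (f 0) ℕ.+ s) (m ℕ.∸ f 0))) (applied (λ s → suc (f 0) ℕ.+ s) (m ℕ.∸ f 0) (fits (f 0)))) (go (f ∘ suc) c)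

  module Weights (x : ℚ) (0≤x : 0ℚ ≤ x) where

    product : List ℕ → Seq
    product []       = one
    product (w ∷ ws) = geometric (x ^ℚ w) ⋆ product ws

    truncated : ℕ → List ℕ → Seq
    truncated B ws n = Σ< B (λ N → fromℕ (ways ws n N) * (x ^ℚ N))

    Σ<-delay : ∀ c B (F : ℕ → ℕ) → Σ< B (λ N → fromℕ (if c ≤ᵇ N then F (N ℕ.∸ c) else 0) * (x ^ℚ N))
                                   ≡ (x ^ℚ c) * Σ< (B ℕ.∸ c) (λ N → fromℕ (F N) * (x ^ℚ N))
    Σ<-delay zero    B       F = sym (*-identityˡ _)
    Σ<-delay (suc c) zero    F = sym (*-zeroʳ (x * (x ^ℚ c)))
    Σ<-delay (suc c) (suc B) F = begin
      0ℚ * 1ℚ + Σ< B (λ N → fromℕ (if suc c ≤ᵇ suc N then F (N ℕ.∸ c) else 0) * (x * (x ^ℚ N)))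
        ≡⟨ +-identityˡ (Σ< B (λ N → fromℕ (if suc c ≤ᵇ suc N then F (N ℕ.∸ c) else 0) * (x * (x ^ℚ N)))) ⟩
      Σ< B (λ N → fromℕ (if suc c ≤ᵇ suc N then F (N ℕ.∸ c) else 0) * (x * (x ^ℚ N)))
        ≡⟨ Σ<-ext B (λ N → trans (cong (λ b → fromℕ (if b then F (N ℕ.∸ c) else 0) * (x * (x ^ℚ N))) (≤ᵇ-suc c N)) (rearrange (fromℕ (if c ≤ᵇ N then F (N ℕ.∸ c) else 0)) x (x ^ℚ N))) ⟩
      Σ< B (λ N → x * (fromℕ (if c ≤ᵇ N then F (N ℕ.∸ c) else 0) * (x ^ℚ N)))
        ≡⟨ trans (Σ<-* B x (λ N → fromℕ (if c ≤ᵇ N then F (N ℕ.∸ c) else 0) * (x ^ℚ N))) (cong (x *_) (Σ<-delay c B F)) ⟩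
      x * ((x ^ℚ c) * Σ< (B ℕ.∸ c) (λ N → fromℕ (F N) * (x ^ℚ N)))
        ≡⟨ *-assoc x (x ^ℚ c) (Σ< (B ℕ.∸ c) (λ N → fromℕ (F N) * (x ^ℚ N))) ⟨
      x * (x ^ℚ c) * Σ< (B ℕ.∸ c) (λ N → fromℕ (F N) * (x ^ℚ N)) ∎
      where
      rearrange : ∀ a x y → a * (x * y) ≡ x * (a * y)
      rearrange = solve-∀ ℚ-ring
      ≤ᵇ-suc : ∀ i j → (suc i ≤ᵇ suc j) ≡ (i ≤ᵇ j)
      ≤ᵇ-suc zero    j = refl
      ≤ᵇ-suc (suc i) j = refl

    truncated-∷ : ∀ B w ws n → truncated B (w ∷ ws) n ≡ Σ< (suc n) (λ k → geometric (x ^ℚ w) k * truncated (B ℕ.∸ k ℕ.* w) ws (n ℕ.∸ k))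
    truncated-∷ B w ws n = begin
      Σ< B (λ N → fromℕ (ways (w ∷ ws) n N) * (x ^ℚ N))
        ≡⟨ Σ<-ext B (λ N → trans (cong (_* (x ^ℚ N)) (fromℕ-sum (suc n) (term N))) (trans (*-comm (Σ< (suc n) (fromℕ ∘ term N)) (x ^ℚ N)) (sym (Σ<-* (suc n) (x ^ℚ N) (fromℕ ∘ term N))))) ⟩
      Σ< B (λ N → Σ< (suc n) (λ k → (x ^ℚ N) * fromℕ (term N k)))
        ≡⟨ Σ<-swap B (suc n) (λ N k → (x ^ℚ N) * fromℕ (term N k)) ⟩
      Σ< (suc n) (λ k → Σ< B (λ N → (x ^ℚ N) * fromℕ (term N k)))
        ≡⟨ Σ<-ext (suc n) (λ k → trans (Σ<-ext B (λ N → *-comm (x ^ℚ N) (fromℕ (term N k)))) (trans (Σ<-delay (k ℕ.* w) B (ways ws (n ℕ.∸ k))) (cong (_* truncated (B ℕ.∸ k ℕ.* w) ws (n ℕ.∸ k)) (^ℚ-* x w k)))) ⟩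
      Σ< (suc n) (λ k → geometric (x ^ℚ w) k * truncated (B ℕ.∸ k ℕ.* w) ws (n ℕ.∸ k)) ∎
      where
      term : ℕ → ℕ → ℕ
      term N k = if k ℕ.* w ≤ᵇ N then ways ws (n ℕ.∸ k) (N ℕ.∸ k ℕ.* w) else 0

    0≤product : ∀ ws n → 0ℚ ≤ product ws n
    0≤product []       zero    = 0≤1
    0≤product []       (suc n) = ℚ.≤-refl
    0≤product (w ∷ ws) n       = 0≤⋆ n (λ i → 0≤^ i (0≤^ w 0≤x)) (0≤product ws)

    truncated-[] : ∀ B n → truncated (suc B) [] n ≡ one n
    truncated-[] B zero    = trans (cong (1ℚ * 1ℚ +_) (trans (Σ<-ext B (λ N → *-zeroˡ (x * (x ^ℚ N)))) (Σ<-0 B))) refl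
    truncated-[] B (suc n) = trans (Σ<-ext (suc B) (λ N → *-zeroˡ (x ^ℚ N))) (Σ<-0 (suc B))

    truncated-≤ : ∀ B ws n → truncated B ws n ≤ product ws n
    truncated-≤ zero    []       n = 0≤product [] n
    truncated-≤ (suc B) []       n = ℚ.≤-reflexive (truncated-[] B n)
    truncated-≤ B       (w ∷ ws) n = ℚ.≤-trans (ℚ.≤-reflexive (truncated-∷ B w ws n))
      (Σ<-mono (suc n) (λ k _ → *-monoˡ (0≤^ k (0≤^ w 0≤x)) (truncated-≤ (B ℕ.∸ k ℕ.* w) ws (n ℕ.∸ k))))

    -- A choice of n weights, each at most `m`, has total at most n m, so nothing lies beyond the
    -- cut.
    truncated-≡ : ∀ m {ws} → AllBelow m ws → ∀ B n → n ℕ.* m ℕ.< B → truncated B ws n ≡ product ws n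
    truncated-≡ m []                     (suc B) n _  = truncated-[] B n
    truncated-≡ m (_∷_ {w} {ws} w≤m all) B       n lt = trans (truncated-∷ B w ws n)
      (Σ<-cong (suc n) (λ k k≤n → cong (geometric (x ^ℚ w) k *_) (truncated-≡ m all (B ℕ.∸ k ℕ.* w) (n ℕ.∸ k) (enough k (ℕ.≤-pred k≤n)))))
      where
      enough : ∀ k → k ℕ.≤ n → (n ℕ.∸ k) ℕ.* m ℕ.< B ℕ.∸ k ℕ.* w
      enough k k≤n = ℕ.m+n≤o⇒m≤o∸n (suc ((n ℕ.∸ k) ℕ.* m)) {k ℕ.* w} (ℕ.≤-<-trans (ℕ.+-monoʳ-≤ ((n ℕ.∸ k) ℕ.* m) (ℕ.*-monoʳ-≤ k w≤m))
        (subst (ℕ._< B) (trans (cong (ℕ._* m) (sym (ℕ.m∸n+n≡m k≤n))) (ℕ.*-distribʳ-+ m (n ℕ.∸ k) k)) lt))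

    product-++ : ∀ a b n → product (a ++ b) n ≡ (product a ⋆ product b) n
    product-++ []      b n = sym (⋆-identityˡ (product b) n)
    product-++ (w ∷ a) b n = trans (⋆-cong {geometric (x ^ℚ w)} n (λ _ → refl) (product-++ a b)) (sym (⋆-assoc (geometric (x ^ℚ w)) (product a) (product b) n))

    -- Every exponent N in the sum is below `M`, so the weights in `pairWeights M` beyond those of
    -- `pairWeights N` exceed N and do not affect the count.
    partial-sum : ∀ n M → partialSum (λ N → fromℕ (coef n N) * (x ^ℚ N)) M ≡ truncated M (pairWeights M) n
    partial-sum n M = trans (sumQ-upTo M _) (Σ<-cong M (λ N N<M →
      cong (λ z → fromℕ z * (x ^ℚ N)) (sym (ways-thin-≡ (Thin-pairWeights (ℕ.<⇒≤ N<M)) n N ℕ.≤-refl))))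

    truncated-thin : ∀ {m M} n → m ℕ.≤ M → truncated M (pairWeights m) n ≤ truncated M (pairWeights M) n
    truncated-thin {m} {M} n m≤M = Σ<-mono M (λ N _ → *-mono (0≤fromℕ (ways (pairWeights m) n N))
      (fromℕ-mono (ways-thin-≤ (Thin-pairWeights m≤M) n N)) (0≤^ N 0≤x) ℚ.≤-refl)

-- Convergence of the coefficient series of the infinite product.

module Convergence where

  open Base
  open import Defs using (_^ℚ_; fromℕ; evalPoly; pairWeights; coef; partialSum; SeriesSum)
  open Mahonian using (fromℕ-+; fromℕ-*; Σ<-const; total; module Recursion)
  open Pieri using (module PieriRule)
  open Series
  open import Data.List using ([]; _∷_; applyUpTo)
  open import Data.List.Properties using (map-upTo)
  open import Data.Nat as ℕ using (ℕ; zero; suc; s≤s)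
  import Data.Nat.Properties as ℕ
  open import Data.Product using (∃; _×_; _,_)
  open import Data.Rational using (ℚ; 0ℚ; 1ℚ; _+_; _*_; _-_; -_; _≤_; _<_; ∣_∣; nonNegative; positive; 1/_)
  import Data.Rational.Properties as ℚ
  open import Data.Rational.Properties using (*-zeroˡ; *-identityˡ; *-identityʳ; +-identityʳ; *-assoc; *-comm)
  open import Function using (_∘_; id)
  open import Relation.Binary.PropositionalEquality
  open import Tactic.RingSolver using (solve-∀)
  open ≡-Reasoning

  0<* : ∀ {a b} → 0ℚ < a → 0ℚ < b → 0ℚ < a * b
  0<* {a} {b} p r = ℚ.positive⁻¹ (a * b) {{ℚ.pos*pos⇒pos a {{positive p}} b {{positive r}}}}

  positive-inverse : ∀ {a} → 0ℚ < a → ∃ λ b → 0ℚ < b × a * b ≡ 1ℚ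
  positive-inverse {a} p = 1/a , ℚ.positive⁻¹ 1/a {{ℚ.1/pos⇒pos a {{positive p}}}} , ℚ.*-inverseʳ a {{ℚ.pos⇒nonZero a {{positive p}}}}
    where
    1/a : ℚ
    1/a = (1/ a) {{ℚ.pos⇒nonZero a {{positive p}}}}

  0<fromℕ : ∀ n → 0ℚ < fromℕ (suc n)
  0<fromℕ n = ℚ.<-≤-trans (ℚ.positive⁻¹ 1ℚ) (ℚ.≤-trans (≤-+ʳ 1ℚ (0≤fromℕ n)) (ℚ.≤-reflexive (sym (fromℕ-+ 1 n))))

  bernoulli : ∀ δ → 0ℚ ≤ δ → ∀ n → 1ℚ + fromℕ n * δ ≤ (1ℚ + δ) ^ℚ n
  bernoulli δ p zero    = ℚ.≤-reflexive (trans (cong (1ℚ +_) (*-zeroˡ δ)) refl)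
  bernoulli δ p (suc n) = ℚ.≤-trans (≤-+ʳ _ (0≤* p (0≤* (0≤fromℕ n) p)))
    (ℚ.≤-trans (ℚ.≤-reflexive (trans (cong (λ z → 1ℚ + z * δ + δ * (fromℕ n * δ)) (fromℕ-+ 1 n)) (expand (fromℕ n) δ)))
               (*-monoˡ (0≤+ 0≤1 p) (bernoulli δ p n)))
    where
    expand : ∀ n d → 1ℚ + (1ℚ + n) * d + d * (n * d) ≡ (1ℚ + d) * (1ℚ + n * d)
    expand = solve-∀ ℚ-ring

  module Limit (x q : ℚ) (xq≡1 : x * q ≡ 1ℚ) (ρ : ℕ → ℚ)
               (ρ-inverse : ∀ k → (1ℚ - (x ^ℚ suc k)) * ρ (suc k) ≡ 1ℚ)
               (0≤x : 0ℚ ≤ x) (0≤ρ : ∀ k → 0ℚ ≤ ρ (suc k)) (δ : ℚ) (0<δ : 0ℚ < δ) (q≡1+δ : q ≡ 1ℚ + δ)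
               where

    open PieriRule x q xq≡1 ρ ρ-inverse 0 using (h; h-sum; ^ℚ-inverse)
    open Recursion x q xq≡1 ρ ρ-inverse using (H; H-recursive; H-zero; t)
    open Weights x 0≤x

    0≤h : ∀ n → 0ℚ ≤ h n
    0≤h zero    = 0≤1
    0≤h (suc n) = 0≤* (0≤h n) (0≤ρ n)

    0≤evalPoly : ∀ c → 0ℚ ≤ evalPoly c x
    0≤evalPoly []      = ℚ.≤-refl
    0≤evalPoly (a ∷ c) = 0≤+ (0≤fromℕ a) (0≤* 0≤x (0≤evalPoly c))

    0≤H : ∀ n → 0ℚ ≤ H n
    0≤H n = 0≤* (0≤* (0≤h n) (0≤h n)) (0≤evalPoly (total n))

    0≤scaled : ∀ {y f} → 0ℚ ≤ y → (∀ n → 0ℚ ≤ f n) → ∀ n → 0ℚ ≤ scaled y f n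
    0≤scaled p r n = 0≤* (0≤^ n p) (r n)

    h-factor : ∀ n → h n ≡ (geometric 1ℚ ⋆ scaled x h) n
    h-factor n = sym (trans (⋆-comm (geometric 1ℚ) (scaled x h) n)
      (trans (Σ<-ext (suc n) (λ i → trans (cong (scaled x h i *_) (1^ℚ (n ℕ.∸ i))) (*-identityʳ (scaled x h i)))) (h-sum n)))

    scaled-h : ∀ k n → scaled (x ^ℚ k) h n ≡ (geometric (x ^ℚ k) ⋆ scaled (x ^ℚ suc k) h) n
    scaled-h k n = begin
      scaled (x ^ℚ k) h n
        ≡⟨ cong (((x ^ℚ k) ^ℚ n) *_) (h-factor n) ⟩
      scaled (x ^ℚ k) (geometric 1ℚ ⋆ scaled x h) n
        ≡⟨ scaled-⋆ (x ^ℚ k) (geometric 1ℚ) (scaled x h) n ⟩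
      (scaled (x ^ℚ k) (geometric 1ℚ) ⋆ scaled (x ^ℚ k) (scaled x h)) n
        ≡⟨ ⋆-cong n (λ i → trans (cong (((x ^ℚ k) ^ℚ i) *_) (1^ℚ i)) (*-identityʳ ((x ^ℚ k) ^ℚ i))) (scaled-scaled (x ^ℚ k) x h) ⟩
      (geometric (x ^ℚ k) ⋆ scaled (x ^ℚ suc k) h) n ∎

    scaled-H : ∀ k n → scaled (x ^ℚ k) H n ≡ (scaled (x ^ℚ k) h ⋆ scaled (x ^ℚ suc k) H) n
    scaled-H k n = begin
      scaled (x ^ℚ k) H n                                  ≡⟨ cong (((x ^ℚ k) ^ℚ n) *_) (H-recursive n) ⟩
      scaled (x ^ℚ k) (h ⋆ scaled x H) n                   ≡⟨ scaled-⋆ (x ^ℚ k) h (scaled x H) n ⟩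
      (scaled (x ^ℚ k) h ⋆ scaled (x ^ℚ k) (scaled x H)) n ≡⟨ ⋆-cong {scaled (x ^ℚ k) h} n (λ _ → refl) (scaled-scaled (x ^ℚ k) x H) ⟩
      (scaled (x ^ℚ k) h ⋆ scaled (x ^ℚ suc k) H) n ∎

    product-row : ∀ f d k → (∀ i → f i ≡ k ℕ.+ i) → ∀ n → scaled (x ^ℚ k) h n ≡ (product (applyUpTo f d) ⋆ scaled (x ^ℚ (k ℕ.+ d)) h) n
    product-row f zero    k e n = trans (cong (λ z → scaled (x ^ℚ z) h n) (sym (ℕ.+-identityʳ k))) (sym (⋆-identityˡ (scaled (x ^ℚ (k ℕ.+ 0)) h) n))
    product-row f (suc d) k e n = begin
      scaled (x ^ℚ k) h n
        ≡⟨ scaled-h k n ⟩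
      (geometric (x ^ℚ k) ⋆ scaled (x ^ℚ suc k) h) n
        ≡⟨ ⋆-cong n (λ i → cong (λ z → geometric (x ^ℚ z) i) (sym (trans (e 0) (ℕ.+-identityʳ k))))
             (product-row (f ∘ suc) d (suc k) (λ i → trans (e (suc i)) (ℕ.+-suc k i))) ⟩
      (geometric (x ^ℚ f 0) ⋆ (product (applyUpTo (f ∘ suc) d) ⋆ scaled (x ^ℚ (suc k ℕ.+ d)) h)) n
        ≡⟨ ⋆-assoc (geometric (x ^ℚ f 0)) (product (applyUpTo (f ∘ suc) d)) (scaled (x ^ℚ (suc k ℕ.+ d)) h) n ⟨
      (product (applyUpTo f (suc d)) ⋆ scaled (x ^ℚ (suc k ℕ.+ d)) h) n
        ≡⟨ cong (λ z → (product (applyUpTo f (suc d)) ⋆ scaled (x ^ℚ z) h) n) (ℕ.+-suc k d) ⟨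
      (product (applyUpTo f (suc d)) ⋆ scaled (x ^ℚ (k ℕ.+ suc d)) h) n ∎

    -- H(yu) h(yu)^c. Taking only the weights up to m out of the double product, each of the first m
    -- rows leaves its tail h(yu) with y = x^(m+1), and the later rows together form H(yu).
    remainder : ℚ → ℕ → Seq
    remainder y zero    = scaled y H
    remainder y (suc c) = scaled y h ⋆ remainder y c

    product-rows : ∀ m f c r → (∀ i → f i ≡ r ℕ.+ i) → r ℕ.+ c ≡ m →
                   ∀ n → scaled (x ^ℚ suc r) H n ≡ (product (rows m f c) ⋆ remainder (x ^ℚ suc m) c) n
    product-rows m f zero    r e r≡m n = trans (cong (λ z → scaled (x ^ℚ suc z) H n) (trans (sym (ℕ.+-identityʳ r)) r≡m))
      (sym (⋆-identityˡ (scaled (x ^ℚ suc m) H) n))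
    product-rows m f (suc c) r e r+c≡m n = begin
      scaled (x ^ℚ suc r) H n
        ≡⟨ scaled-H (suc r) n ⟩
      (scaled (x ^ℚ suc r) h ⋆ scaled (x ^ℚ suc (suc r)) H) n
        ≡⟨ ⋆-cong n first-row (product-rows m (f ∘ suc) c (suc r) (λ i → trans (e (suc i)) (ℕ.+-suc r i)) (trans (sym (ℕ.+-suc r c)) r+c≡m)) ⟩
      ((product (row m (f 0)) ⋆ scaled y h) ⋆ (product (rows m (f ∘ suc) c) ⋆ remainder y c)) n
        ≡⟨ ⋆-exchange (product (row m (f 0))) (scaled y h) (product (rows m (f ∘ suc) c)) (remainder y c) n ⟩
      ((product (row m (f 0)) ⋆ product (rows m (f ∘ suc) c)) ⋆ (scaled y h ⋆ remainder y c)) n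
        ≡⟨ ⋆-cong {k = scaled y h ⋆ remainder y c} n (λ i → sym (product-++ (row m (f 0)) (rows m (f ∘ suc) c) i)) (λ _ → refl) ⟩
      (product (rows m f (suc c)) ⋆ remainder y (suc c)) n ∎
      where
      y = x ^ℚ suc m
      f0≡r : f 0 ≡ r
      f0≡r = trans (e 0) (ℕ.+-identityʳ r)
      r≤m : r ℕ.≤ m
      r≤m = subst (r ℕ.≤_) r+c≡m (ℕ.m≤m+n r (suc c))
      first-row : ∀ i → scaled (x ^ℚ suc r) h i ≡ (product (row m (f 0)) ⋆ scaled y h) i
      first-row i = begin
        scaled (x ^ℚ suc r) h i
          ≡⟨ product-row (λ s → suc r ℕ.+ s) (m ℕ.∸ r) (suc r) (λ _ → refl) i ⟩
        (product (applyUpTo (λ s → suc r ℕ.+ s) (m ℕ.∸ r)) ⋆ scaled (x ^ℚ (suc r ℕ.+ (m ℕ.∸ r))) h) i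
          ≡⟨ cong₂ (λ ws z → (product ws ⋆ scaled (x ^ℚ suc z) h) i) (sym (map-upTo (λ s → suc r ℕ.+ s) (m ℕ.∸ r))) (ℕ.m+[n∸m]≡n r≤m) ⟩
        (product (row m r) ⋆ scaled y h) i
          ≡⟨ cong (λ z → (product (row m z) ⋆ scaled y h) i) f0≡r ⟨
        (product (row m (f 0)) ⋆ scaled y h) i ∎

    -- Iterating H(u) = h(u) H(xu) gives exponents r + s with r from 0; the product to be expanded
    -- starts at r = 1, hence the scaling by x.
    limit : Seq
    limit = scaled (x ^ℚ 1) H

    limit-factor : ∀ m n → limit n ≡ (remainder (x ^ℚ suc m) m ⋆ product (pairWeights m)) n
    limit-factor m n = trans (product-rows m id m 0 (λ _ → refl) refl n) (⋆-comm (product (pairWeights m)) (remainder (x ^ℚ suc m) m) n)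

    remainder-zero : ∀ y c → remainder y c 0 ≡ 1ℚ
    remainder-zero y zero    = trans (*-identityˡ (H 0)) H-zero
    remainder-zero y (suc c) = trans (+-identityʳ (1ℚ * 1ℚ * remainder y c 0)) (trans (cong (1ℚ * 1ℚ *_) (remainder-zero y c)) refl)

    0≤remainder : ∀ {y} c → 0ℚ ≤ y → ∀ n → 0ℚ ≤ remainder y c n
    0≤remainder zero    p   = 0≤scaled {f = H} p 0≤H
    0≤remainder (suc c) p n = 0≤⋆ n (0≤scaled {f = h} p 0≤h) (0≤remainder c p)

    -- The remainder has constant term 1 and non-negative coefficients, so multiplying by it cannot
    -- lower a coefficient.
    product≤limit : ∀ m n → product (pairWeights m) n ≤ limit n
    product≤limit m n = ℚ.≤-trans (lower n) (ℚ.≤-reflexive (sym (limit-factor m n)))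
      where
      T Z : Seq
      T = remainder (x ^ℚ suc m) m
      Z = product (pairWeights m)
      lower : ∀ n → Z n ≤ (T ⋆ Z) n
      lower n = ℚ.≤-trans (ℚ.≤-reflexive (sym (trans (cong (_* Z n) (remainder-zero (x ^ℚ suc m) m)) (*-identityˡ (Z n)))))
        (≤-+ʳ (T 0 * Z n) (0≤Σ< n (λ i _ → 0≤* (0≤remainder m (0≤^ (suc m) 0≤x) (suc i)) (0≤product (pairWeights m) (n ℕ.∸ suc i)))))

    -- Any number at least 1 and at least all h k and H k for k up to n would serve. As h and H
    -- start with 1, its powers then dominate both sequences up to degree n.
    bound : ℕ → ℚ
    bound n = 1ℚ + Σ< (suc n) (λ k → h k + H k)

    1≤bound : ∀ n → 1ℚ ≤ bound n
    1≤bound n = ≤-+ʳ 1ℚ (0≤Σ< (suc n) (λ k _ → 0≤+ (0≤h k) (0≤H k)))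

    0≤bound : ∀ n → 0ℚ ≤ bound n
    0≤bound n = ℚ.≤-trans 0≤1 (1≤bound n)

    Σ<-member : ∀ n f → (∀ i → 0ℚ ≤ f i) → ∀ k → k ℕ.< n → f k ≤ Σ< n f
    Σ<-member (suc n) f p zero    _       = ≤-+ʳ (f 0) (0≤Σ< n (λ i _ → p (suc i)))
    Σ<-member (suc n) f p (suc k) (s≤s q) = ℚ.≤-trans (Σ<-member n (f ∘ suc) (p ∘ suc) k q) (≤-+ˡ (Σ< n (f ∘ suc)) (p 0))

    ≤-power : ∀ c (f : Seq) → 1ℚ ≤ c → f 0 ≡ 1ℚ → ∀ k → f k ≤ c → f k ≤ c ^ℚ k
    ≤-power c f 1≤c e zero    p = ℚ.≤-reflexive e
    ≤-power c f 1≤c e (suc k) p = ℚ.≤-trans p (ℚ.≤-trans (ℚ.≤-reflexive (sym (*-identityʳ c))) (*-monoˡ (ℚ.≤-trans 0≤1 1≤c) (1≤^ k)))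
      where
      1≤^ : ∀ k → 1ℚ ≤ c ^ℚ k
      1≤^ zero    = ℚ.≤-refl
      1≤^ (suc k) = ℚ.≤-trans 1≤c (ℚ.≤-trans (ℚ.≤-reflexive (sym (*-identityʳ c))) (*-monoˡ (ℚ.≤-trans 0≤1 1≤c) (1≤^ k)))

    h≤ : ∀ n k → k ℕ.≤ n → h k ≤ bound n ^ℚ k
    h≤ n k k≤n = ≤-power (bound n) h (1≤bound n) refl k (ℚ.≤-trans (≤-+ʳ (h k) (0≤H k))
      (ℚ.≤-trans (Σ<-member (suc n) (λ k → h k + H k) (λ i → 0≤+ (0≤h i) (0≤H i)) k (s≤s k≤n)) (≤-+ˡ (Σ< (suc n) (λ k → h k + H k)) 0≤1)))

    H≤ : ∀ n k → k ℕ.≤ n → H k ≤ bound n ^ℚ k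
    H≤ n k k≤n = ≤-power (bound n) H (1≤bound n) H-zero k (ℚ.≤-trans (≤-+ˡ (H k) (0≤h k))
      (ℚ.≤-trans (Σ<-member (suc n) (λ k → h k + H k) (λ i → 0≤+ (0≤h i) (0≤H i)) k (s≤s k≤n)) (≤-+ˡ (Σ< (suc n) (λ k → h k + H k)) 0≤1)))

    scaled≤ : ∀ y c f k → 0ℚ ≤ y → f k ≤ c ^ℚ k → scaled y f k ≤ geometric (c * y) k
    scaled≤ y c f k 0≤y p = ℚ.≤-trans (*-monoˡ (0≤^ k 0≤y) p) (ℚ.≤-reflexive (trans (*-comm (y ^ℚ k) (c ^ℚ k)) (sym (*-^ℚ c y k))))

    -- Each of the c + 1 factors is dominated up to degree n by the geometric series of ratio
    -- `bound n * y`, and `geometric-⋆` adds the ratios.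
    remainder≤ : ∀ n {y} c → 0ℚ ≤ y → ∀ k → k ℕ.≤ n → remainder y c k ≤ geometric (fromℕ (suc c) * (bound n * y)) k
    remainder≤ n {y} zero    0≤y k k≤n = ℚ.≤-trans (scaled≤ y (bound n) H k 0≤y (H≤ n k k≤n)) (ℚ.≤-reflexive (cong (_^ℚ k) (sym (*-identityˡ (bound n * y)))))
    remainder≤ n {y} (suc c) 0≤y k k≤n = ℚ.≤-trans
      (⋆-mono k (0≤scaled {f = h} 0≤y 0≤h) (λ i i≤k → scaled≤ y (bound n) h i 0≤y (h≤ n i (ℕ.≤-trans i≤k k≤n)))
              (λ i → 0≤^ i 0≤s) (λ i i≤k → remainder≤ n c 0≤y i (ℕ.≤-trans i≤k k≤n)))
      (ℚ.≤-trans (geometric-⋆ w (fromℕ (suc c) * w) k 0≤w 0≤s) (ℚ.≤-reflexive (cong (_^ℚ k) (trans (collect w (fromℕ (suc c))) (cong (_* w) (sym (fromℕ-+ 1 (suc c))))))))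
      where
      w = bound n * y
      0≤w : 0ℚ ≤ w
      0≤w = 0≤* (0≤bound n) 0≤y
      0≤s : 0ℚ ≤ fromℕ (suc c) * w
      0≤s = 0≤* (0≤fromℕ (suc c)) 0≤w
      collect : ∀ w c → w + c * w ≡ (1ℚ + c) * w
      collect = solve-∀ ℚ-ring

    ratio : ℕ → ℕ → ℚ
    ratio n m = fromℕ (suc m) * (bound n * (x ^ℚ suc m))

    0≤ratio : ∀ n m → 0ℚ ≤ ratio n m
    0≤ratio n m = 0≤* (0≤fromℕ (suc m)) (0≤* (0≤bound n) (0≤^ (suc m) 0≤x))

    error : ℕ → ℚ
    error n = fromℕ n * Σ< (suc n) limit

    0≤limit : ∀ n → 0ℚ ≤ limit n
    0≤limit = 0≤scaled {f = H} (0≤^ 1 0≤x) 0≤H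

    -- In the convolution of remainder and product the term 0 is the product. In each of the other n
    -- terms the remainder coefficient is a positive power of a number at most 1, hence at most
    -- `ratio n m`, and the product coefficient is bounded by the sum of the limits.
    limit≤ : ∀ n m → ratio n m ≤ 1ℚ → limit n ≤ product (pairWeights m) n + ratio n m * error n
    limit≤ zero    m p = ℚ.≤-reflexive (trans (limit-factor m 0) (cong₂ _+_ (trans (cong (_* product (pairWeights m) 0) (remainder-zero (x ^ℚ suc m) m)) (*-identityˡ (product (pairWeights m) 0)))
      (sym (*-zeroʳ′ (ratio 0 m) (*-zeroˡ (Σ< 1 limit))))))
    limit≤ (suc n) m p = ℚ.≤-trans (ℚ.≤-reflexive (limit-factor m (suc n)))
      (ℚ.+-mono-≤ (ℚ.≤-reflexive (trans (cong (_* Z (suc n)) (remainder-zero (x ^ℚ suc m) m)) (*-identityˡ (Z (suc n)))))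
        (ℚ.≤-trans (Σ<-mono (suc n) term) (ℚ.≤-reflexive (trans (Σ<-const (suc n) (r * D)) (commute (fromℕ (suc n)) r D)))))
      where
      r = ratio (suc n) m
      D = Σ< (suc (suc n)) limit
      Z : Seq
      Z = product (pairWeights m)
      commute : ∀ a b c → a * (b * c) ≡ b * (a * c)
      commute = solve-∀ ℚ-ring
      power≤ : ∀ i → r ^ℚ suc i ≤ r
      power≤ zero    = ℚ.≤-reflexive (*-identityʳ r)
      power≤ (suc i) = ℚ.≤-trans (*-monoˡ (0≤ratio (suc n) m) (ℚ.≤-trans (power≤ i) p)) (ℚ.≤-reflexive (*-identityʳ r))
      term : ∀ i → i ℕ.< suc n → remainder (x ^ℚ suc m) m (suc i) * Z (n ℕ.∸ i) ≤ r * D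
      term i i<n = *-mono (0≤remainder m (0≤^ (suc m) 0≤x) (suc i))
        (ℚ.≤-trans (remainder≤ (suc n) m (0≤^ (suc m) 0≤x) (suc i) i<n) (power≤ i))
        (0≤Σ< (suc (suc n)) (λ k _ → 0≤limit k))
        (ℚ.≤-trans (product≤limit m (n ℕ.∸ i)) (Σ<-member (suc (suc n)) limit 0≤limit (n ℕ.∸ i) (s≤s (ℕ.≤-trans (ℕ.m∸n≤m n i) (ℕ.n≤1+n n)))))

    -- (1 + δ)^j ≥ j δ gives k x^k = O(1/k) along k = 2 j.
    ratio≤ : ∀ n η w j-1 → 0ℚ < η → η * (δ * δ) * w ≡ 1ℚ → fromℕ 2 * bound n * w ≤ fromℕ (suc j-1) → ratio n (j-1 ℕ.+ suc j-1) ≤ η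
    -- With m + 1 = 2j the ratio is 2j B x^(2j); times jδ² it becomes 2B (jδx^j)², where jδx^j is at
    -- most 1. The Archimedean choice of j makes 2B at most jδ²η.
    ratio≤ n η w j-1 0<η ηδδw≡1 arch = ℚ.*-cancelˡ-≤-pos (jℚ * (δ * δ)) {{positive 0<jδδ}}
      (ℚ.≤-trans (ℚ.≤-reflexive lhs) (ℚ.≤-trans (*-monoˡ (0≤* (0≤fromℕ 2) (0≤bound n)) square≤1)
        (ℚ.≤-trans (ℚ.≤-reflexive (*-identityʳ (fromℕ 2 * bound n))) rhs)))
      where
      j = suc j-1
      jℚ = fromℕ j
      B = bound n
      X = x ^ℚ j
      0≤X : 0ℚ ≤ X
      0≤X = 0≤^ j 0≤x
      0<jδδ : 0ℚ < jℚ * (δ * δ)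
      0<jδδ = 0<* (0<fromℕ j-1) (0<* 0<δ 0<δ)
      JδX≤1 : jℚ * δ * X ≤ 1ℚ
      JδX≤1 = ℚ.≤-trans (ℚ.*-monoʳ-≤-nonNeg X {{nonNegative 0≤X}} (ℚ.≤-trans (≤-+ˡ (jℚ * δ) 0≤1) (bernoulli δ (ℚ.<⇒≤ 0<δ) j)))
        (ℚ.≤-reflexive (trans (cong (λ z → (z ^ℚ j) * X) (sym q≡1+δ)) (^ℚ-inverse j)))
      square≤1 : (jℚ * δ * X) * (jℚ * δ * X) ≤ 1ℚ
      square≤1 = ℚ.≤-trans (*-mono (0≤* (0≤* (0≤fromℕ j) (ℚ.<⇒≤ 0<δ)) 0≤X) JδX≤1 0≤1 JδX≤1) (ℚ.≤-reflexive refl)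
      lhs : jℚ * (δ * δ) * ratio n (j-1 ℕ.+ j) ≡ fromℕ 2 * B * ((jℚ * δ * X) * (jℚ * δ * X))
      lhs = trans (cong₂ (λ u v → jℚ * (δ * δ) * (u * (B * v))) (trans (cong fromℕ (cong (j ℕ.+_) (sym (ℕ.+-identityʳ j)))) (fromℕ-* 2 j)) (^ℚ-+ x j j))
                  (rearrange jℚ δ (fromℕ 2) B X)
        where
        rearrange : ∀ j d t b y → j * (d * d) * (t * j * (b * (y * y))) ≡ t * b * ((j * d * y) * (j * d * y))
        rearrange = solve-∀ ℚ-ring
      rhs : fromℕ 2 * B ≤ jℚ * (δ * δ) * η
      rhs = ℚ.≤-trans (ℚ.≤-reflexive (sym (trans (cong (fromℕ 2 * B *_) (trans (*-comm w (η * (δ * δ))) ηδδw≡1)) (*-identityʳ (fromℕ 2 * B)))))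
        (ℚ.≤-trans (ℚ.≤-reflexive (sym (*-assoc (fromℕ 2 * B) w (η * (δ * δ)))))
          (ℚ.≤-trans (ℚ.*-monoʳ-≤-nonNeg (η * (δ * δ)) {{nonNegative (ℚ.<⇒≤ (0<* 0<η (0<* 0<δ 0<δ)))}} arch) (ℚ.≤-reflexive (rearrange jℚ η δ))))
        where
        rearrange : ∀ j e d → j * (e * (d * d)) ≡ j * (d * d) * e
        rearrange = solve-∀ ℚ-ring

    ratio-small : ∀ n η → 0ℚ < η → ∃ λ m → ratio n m ≤ η
    ratio-small n η 0<η =
      let (w , _ , ηδδw≡1) = positive-inverse (0<* 0<η (0<* 0<δ 0<δ))
          (j-1 , arch)     = archimedean (fromℕ 2 * bound n * w)
      in j-1 ℕ.+ suc j-1 , ratio≤ n η w j-1 0<η ηδδw≡1 arch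

    -- The tolerance for the ratio is η = ε / (error + ε). Having ε in the denominator makes it
    -- meaningful when the error is 0, keeps η at most 1 as `limit≤` requires, and gives η · error <
    -- ε strictly.
    close : ∀ n ε w m → 0ℚ < ε → 0ℚ < w → (error n + ε) * w ≡ 1ℚ → ratio n m ≤ ε * w →
            ∀ M → suc (n ℕ.* m ℕ.+ m) ℕ.≤ M → ∣ limit n - partialSum (λ N → fromℕ (coef n N) * (x ^ℚ N)) M ∣ < ε
    close n ε w m 0<ε 0<w Sw≡1 r≤η M M≥ = ℚ.≤-<-trans (ℚ.≤-reflexive (ℚ.0≤p⇒∣p∣≡p nonneg)) (ℚ.≤-<-trans upper rE<ε)
      where
      E = error n
      r = ratio n m
      0≤E : 0ℚ ≤ E
      0≤E = 0≤* (0≤fromℕ n) (0≤Σ< (suc n) (λ k _ → 0≤limit k))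
      η≤1 : ε * w ≤ 1ℚ
      η≤1 = ℚ.≤-trans (ℚ.*-monoʳ-≤-nonNeg w {{nonNegative (ℚ.<⇒≤ 0<w)}} (≤-+ˡ ε 0≤E)) (ℚ.≤-reflexive Sw≡1)
      rE<ε : r * E < ε
      rE<ε = ℚ.≤-<-trans (ℚ.*-monoʳ-≤-nonNeg E {{nonNegative 0≤E}} r≤η) (ℚ.<-≤-trans strict (ℚ.≤-reflexive whole))
        where
        strict : ε * w * E < ε * w * (E + ε)
        strict = ℚ.*-monoʳ-<-pos (ε * w) {{positive (0<* 0<ε 0<w)}} (ℚ.≤-<-trans (ℚ.≤-reflexive (sym (+-identityʳ E))) (ℚ.+-monoʳ-< E 0<ε))
        whole : ε * w * (E + ε) ≡ ε
        whole = trans (*-assoc ε w (E + ε)) (trans (cong (ε *_) (trans (*-comm w (E + ε)) Sw≡1)) (*-identityʳ ε))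
      P = partialSum (λ N → fromℕ (coef n N) * (x ^ℚ N)) M
      P≤ : P ≤ limit n
      P≤ = ℚ.≤-trans (ℚ.≤-reflexive (partial-sum n M)) (ℚ.≤-trans (truncated-≤ M (pairWeights M) n) (product≤limit M n))
      -- `M` exceeds n m, so the cut loses nothing for weights up to `m`; and `m ≤ M`, so enlarging
      -- the weight list only adds ways.
      ≤P : product (pairWeights m) n ≤ P
      ≤P = ℚ.≤-trans (ℚ.≤-reflexive (sym (truncated-≡ m (AllBelow-pairWeights m) M n (ℕ.≤-trans (s≤s (ℕ.m≤m+n (n ℕ.* m) m)) M≥))))
        (ℚ.≤-trans (truncated-thin n (ℕ.≤-trans (ℕ.m≤n+m m (n ℕ.* m)) (ℕ.≤-trans (ℕ.n≤1+n _) M≥))) (ℚ.≤-reflexive (sym (partial-sum n M))))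
      nonneg : 0ℚ ≤ limit n - P
      nonneg = ℚ.≤-trans (ℚ.≤-reflexive (sym (ℚ.+-inverseʳ P))) (ℚ.+-monoˡ-≤ (- P) P≤)
      upper : limit n - P ≤ r * E
      upper = ℚ.≤-trans (ℚ.+-monoˡ-≤ (- P) (ℚ.≤-trans (limit≤ n m (ℚ.≤-trans r≤η η≤1)) (ℚ.+-monoˡ-≤ (r * E) ≤P)))
        (ℚ.≤-reflexive (cancel P (r * E)))
        where
        cancel : ∀ p e → p + e - p ≡ e
        cancel = solve-∀ ℚ-ring

    converges : ∀ n → SeriesSum (λ N → fromℕ (coef n N) * (x ^ℚ N)) (limit n)
    converges n ε 0<ε =
      let (w , 0<w , Sw≡1) = positive-inverse (ℚ.+-mono-≤-< (0≤* (0≤fromℕ n) (0≤Σ< (suc n) (λ k _ → 0≤limit k))) 0<ε)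
          (m , r≤η)        = ratio-small n (ε * w) (0<* 0<ε 0<w)
      in suc (n ℕ.* m ℕ.+ m) , close n ε w m 0<ε 0<w Sw≡1 r≤η

-- From the definition of `J` to the Cauchy sum, the polynomial and the series.

module Evaluation where

  open Base
  open import Defs hiding (size)
  open Determinant using (∏)
  open Partition using (T-∧⁻; decreasing?; ΣBox; ΣBox-ext; ΣBox-*)
  open Principal using (∏<; module Specialisation)
  open Cauchy using (module CauchySum)
  open Mahonian using (total; total-length; total-reverse; evalPoly-reverse; module Recursion)
  open Series using (0≤1; *-monoˡ; sumQ-upTo)
  open Convergence using (positive-inverse; module Limit)
  open import Data.Bool using (Bool; true; false; _∧_)
  open import Data.List using (List; []; _∷_; _++_; map; concatMap; applyUpTo; upTo; filterᵇ; length; reverse)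
  open import Data.List.Properties using (map-upTo; map-∘)
  open import Data.List.Relation.Unary.All using (All; []; _∷_)
  open import Data.List.Relation.Unary.All.Properties using (++⁺; applyUpTo⁺₁)
  open import Data.Nat as ℕ using (ℕ; zero; suc; _≤ᵇ_; _≡ᵇ_)
  import Data.Nat.Properties as ℕ
  open import Data.Nat.Combinatorics using (_C_; nC1≡n; nCk+nC[k+1]≡[n+1]C[k+1])
  open import Data.Nat.Tactic.RingSolver using () renaming (solve-∀ to ℕ-solve-∀)
  open import Data.Integer as ℤ using (ℤ; _⊖_)
  import Data.Integer.Properties as ℤ
  open import Data.Product using (_,_; proj₁; proj₂)
  open import Data.Rational using (ℚ; 0ℚ; 1ℚ; _+_; _*_; _-_; -_; ∣_∣; _≤_; _<_; 1/_; ≢-nonZero; positive)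
  import Data.Rational.Properties as ℚ
  open import Data.Rational.Properties using (_≟_; *-zeroˡ; *-identityˡ; *-identityʳ; +-identityʳ; +-identityˡ; *-assoc; *-comm; +-assoc; +-comm)
  open import Data.Empty using (⊥-elim)
  open import Function using (_∘_; id)
  open import Relation.Binary.PropositionalEquality hiding (J)
  open import Relation.Nullary using (yes; no)
  open import Tactic.RingSolver using (solve-∀)
  open ≡-Reasoning

  -- An explicit inverse `w` both excludes the default branch of the total division and evaluates
  -- the other one.
  ÷₀-unique : ∀ a y w → y * w ≡ 1ℚ → a ÷₀ y ≡ a * w
  ÷₀-unique a y w yw≡1 with y ≟ 0ℚ
  ... | yes refl = ⊥-elim (ℚ.1≢0 (trans (sym yw≡1) (*-zeroˡ w)))
  ... | no  y≢0  = cong (a *_) (begin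
    1/y            ≡⟨ *-identityʳ 1/y ⟨
    1/y * 1ℚ       ≡⟨ cong (1/y *_) yw≡1 ⟨
    1/y * (y * w)  ≡⟨ *-assoc 1/y y w ⟨
    1/y * y * w    ≡⟨ cong (_* w) (ℚ.*-inverseˡ y {{≢-nonZero y≢0}}) ⟩
    1ℚ * w         ≡⟨ *-identityˡ w ⟩
    w              ∎)
    where
    1/y : ℚ
    1/y = (1/ y) {{≢-nonZero y≢0}}

  sum-over : (List ℕ → ℚ) → List (List ℕ) → ℚ
  sum-over F L = sumQ (map F L)

  sum-over-++ : ∀ F L L′ → sum-over F (L ++ L′) ≡ sum-over F L + sum-over F L′
  sum-over-++ F []      L′ = sym (+-identityˡ (sum-over F L′))
  sum-over-++ F (l ∷ L) L′ = trans (cong (F l +_) (sum-over-++ F L L′)) (sym (+-assoc (F l) (sum-over F L) (sum-over F L′)))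

  sum-over-filter : ∀ F (p : List ℕ → Bool) L → sum-over F (filterᵇ p L) ≡ sum-over (λ l → ⟦ p l ⟧ * F l) L
  sum-over-filter F p []      = refl
  sum-over-filter F p (l ∷ L) with p l
  ... | true  = cong₂ _+_ (sym (*-identityˡ (F l))) (sum-over-filter F p L)
  ... | false = trans (sum-over-filter F p L) (sym (trans (cong (_+ sum-over (λ l → ⟦ p l ⟧ * F l) L) (*-zeroˡ (F l))) (+-identityˡ (sum-over (λ l → ⟦ p l ⟧ * F l) L))))

  sum-over-concatMap : ∀ F (k : ℕ → List (List ℕ)) (f : ℕ → ℕ) n → sum-over F (concatMap k (applyUpTo f n)) ≡ Σ< n (λ i → sum-over F (k (f i)))
  sum-over-concatMap F k f zero    = refl
  sum-over-concatMap F k f (suc n) = trans (sum-over-++ F (k (f 0)) (concatMap k (applyUpTo (f ∘ suc) n)))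
    (cong (sum-over F (k (f 0)) +_) (sum-over-concatMap F k (f ∘ suc) n))

  sum-over-listsOf : ∀ F k m → sum-over F (listsOf k m) ≡ ΣBox (suc m) k F
  sum-over-listsOf F zero    m = +-identityʳ (F [])
  sum-over-listsOf F (suc k) m = trans (sum-over-concatMap F (λ a → map (a ∷_) (listsOf k m)) id (suc m))
    (Σ<-ext (suc m) (λ a → trans (cong sumQ (sym (map-∘ {g = F} {f = a ∷_} (listsOf k m)))) (sum-over-listsOf (F ∘ (a ∷_)) k m)))

  nonIncr-decreasing : ∀ κ → nonIncr κ ≡ decreasing? κ
  nonIncr-decreasing []          = refl
  nonIncr-decreasing (a ∷ [])    = refl
  nonIncr-decreasing (a ∷ b ∷ κ) = cong ((b ≤ᵇ a) ∧_) (nonIncr-decreasing (b ∷ κ))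

  private
    weighted : ℕ → List ℕ → ℕ
    weighted i []       = 0
    weighted i (a ∷ κ) = i ℕ.* a ℕ.+ weighted (suc i) κ

    weighted-unique : (f : ℕ → List ℕ → ℕ) → (∀ i → f i [] ≡ 0) → (∀ i a κ → f i (a ∷ κ) ≡ i ℕ.* a ℕ.+ f (suc i) κ) →
                      ∀ i κ → f i κ ≡ weighted i κ
    weighted-unique f e₁ e₂ i []      = e₁ i
    weighted-unique f e₁ e₂ i (a ∷ κ) = trans (e₂ i a κ) (cong (i ℕ.* a ℕ.+_) (weighted-unique f e₁ e₂ (suc i) κ))

    weighted-suc : ∀ i κ → weighted (suc i) κ ≡ sumℕ κ ℕ.+ weighted i κ
    weighted-suc i []      = refl
    weighted-suc i (a ∷ κ) = trans (cong (a ℕ.+ i ℕ.* a ℕ.+_) (weighted-suc (suc i) κ)) (rearrange a (i ℕ.* a) (sumℕ κ) (weighted (suc i) κ))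
      where
      rearrange : ∀ a b c d → a ℕ.+ b ℕ.+ (c ℕ.+ d) ≡ a ℕ.+ c ℕ.+ (b ℕ.+ d)
      rearrange = ℕ-solve-∀

    -- The auxiliary function in the definition of nλ has no name outside of it;
    -- unification recovers it once the literal 0 in nλ is abstracted to a variable.
    mutual
      weighted′ : ℕ → List ℕ → ℕ
      weighted′ = _

      nλ-weighted : ∀ κ → nλ κ ≡ weighted 0 κ
      nλ-weighted κ with 0
      ... | i = trans {j = weighted′ i κ} refl (weighted-unique weighted′ (λ _ → refl) (λ _ _ _ → refl) i κ)

  -- A new first row pushes every box of κ down by one, so each counts once more.
  nλ-∷ : ∀ a κ → nλ (a ∷ κ) ≡ sumℕ κ ℕ.+ nλ κ
  nλ-∷ a κ = trans (nλ-weighted (a ∷ κ)) (trans (weighted-suc 0 κ) (cong (sumℕ κ ℕ.+_) (sym (nλ-weighted κ))))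

  ∏-++ : ∀ f a b → ∏ f (a ++ b) ≡ ∏ f a * ∏ f b
  ∏-++ f []      b = sym (*-identityˡ (∏ f b))
  ∏-++ f (m ∷ a) b = trans (cong (f m *_) (∏-++ f a b)) (sym (*-assoc (f m) (∏ f a) (∏ f b)))

  -- The inverse of 1 - x^k given by `ρ` exists for positive k, so hooks must be known to be
  -- positive before the hook product is inverted.
  hooks-positive : ∀ κ → All (1 ℕ.≤_) (hooks κ)
  hooks-positive []      = []
  hooks-positive (a ∷ κ) = ++⁺ (subst (All (1 ℕ.≤_)) (sym (map-upTo (λ j → (a ℕ.∸ j) ℕ.+ countGt j κ) a))
    (applyUpTo⁺₁ (λ j → (a ℕ.∸ j) ℕ.+ countGt j κ) a (λ {j} j<a → ℕ.≤-trans (ℕ.m<n⇒0<n∸m j<a) (ℕ.m≤m+n (a ℕ.∸ j) (countGt j κ))))) (hooks-positive κ)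

  n*n : ∀ n → n ℕ.* n ≡ 2 ℕ.* (n C 2) ℕ.+ n
  n*n zero    = refl
  n*n (suc n) = begin
    suc n ℕ.* suc n                          ≡⟨ square n ⟩
    n ℕ.* n ℕ.+ (n ℕ.+ suc n)                ≡⟨ cong (ℕ._+ (n ℕ.+ suc n)) (n*n n) ⟩
    2 ℕ.* (n C 2) ℕ.+ n ℕ.+ (n ℕ.+ suc n)    ≡⟨ rearrange n (n C 2) ⟩
    2 ℕ.* (n ℕ.+ n C 2) ℕ.+ suc n            ≡⟨ cong (λ z → 2 ℕ.* (z ℕ.+ n C 2) ℕ.+ suc n) (nC1≡n n) ⟨
    2 ℕ.* (n C 1 ℕ.+ n C 2) ℕ.+ suc n        ≡⟨ cong (λ z → 2 ℕ.* z ℕ.+ suc n) (nCk+nC[k+1]≡[n+1]C[k+1] n 1) ⟩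
    2 ℕ.* (suc n C 2) ℕ.+ suc n ∎
    where
    square : ∀ n → suc n ℕ.* suc n ≡ n ℕ.* n ℕ.+ (n ℕ.+ suc n)
    square = ℕ-solve-∀
    rearrange : ∀ n c → 2 ℕ.* c ℕ.+ n ℕ.+ (n ℕ.+ suc n) ≡ 2 ℕ.* (n ℕ.+ c) ℕ.+ suc n
    rearrange = ℕ-solve-∀

  prodQ-last : ∀ n (f : ℕ → ℚ) → prodQ (applyUpTo f (suc n)) ≡ prodQ (applyUpTo f n) * f n
  prodQ-last zero    f = *-comm (f 0) 1ℚ
  prodQ-last (suc n) f = trans (cong (f 0 *_) (prodQ-last n (f ∘ suc))) (sym (*-assoc (f 0) (prodQ (applyUpTo (f ∘ suc) n)) (f (suc n))))

  0<-difference : ∀ {a b} → a < b → 0ℚ < b - a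
  0<-difference {a} {b} a<b = ℚ.≤-<-trans (ℚ.≤-reflexive (sym (ℚ.+-inverseʳ a))) (ℚ.+-monoˡ-< (- a) a<b)

  q≡1+[q-1] : ∀ q → q ≡ 1ℚ + (q - 1ℚ)
  q≡1+[q-1] = solve-∀ ℚ-ring

  module AtPoint (q : ℚ) (1<q : 1ℚ < q) where

    0<q : 0ℚ < q
    0<q = ℚ.≤-<-trans 0≤1 1<q

    x : ℚ
    x = proj₁ (positive-inverse 0<q)

    0<x : 0ℚ < x
    0<x = proj₁ (proj₂ (positive-inverse 0<q))

    qx≡1 : q * x ≡ 1ℚ
    qx≡1 = proj₂ (proj₂ (positive-inverse 0<q))

    xq≡1 : x * q ≡ 1ℚ
    xq≡1 = trans (*-comm x q) qx≡1

    x<1 : x < 1ℚ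
    x<1 = ℚ.≤-<-trans (ℚ.≤-reflexive (sym (*-identityʳ x))) (ℚ.<-≤-trans (ℚ.*-monoʳ-<-pos x {{positive 0<x}} 1<q) (ℚ.≤-reflexive xq≡1))

    x^≤1 : ∀ k → x ^ℚ k ≤ 1ℚ
    x^≤1 zero    = ℚ.≤-refl
    x^≤1 (suc k) = ℚ.≤-trans (*-monoˡ (ℚ.<⇒≤ 0<x) (x^≤1 k)) (ℚ.≤-trans (ℚ.≤-reflexive (*-identityʳ x)) (ℚ.<⇒≤ x<1))

    0<1-x^ : ∀ k → 0ℚ < 1ℚ - (x ^ℚ suc k)
    0<1-x^ k = 0<-difference (ℚ.≤-<-trans (ℚ.≤-trans (*-monoˡ (ℚ.<⇒≤ 0<x) (x^≤1 k)) (ℚ.≤-reflexive (*-identityʳ x))) x<1)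

    ρ : ℕ → ℚ
    ρ zero    = 0ℚ
    ρ (suc k) = proj₁ (positive-inverse (0<1-x^ k))

    0≤ρ : ∀ k → 0ℚ ≤ ρ (suc k)
    0≤ρ k = ℚ.<⇒≤ (proj₁ (proj₂ (positive-inverse (0<1-x^ k))))

    ρ-inverse : ∀ k → (1ℚ - (x ^ℚ suc k)) * ρ (suc k) ≡ 1ℚ
    ρ-inverse k = proj₂ (proj₂ (positive-inverse (0<1-x^ k)))

    open Specialisation x q xq≡1 ρ ρ-inverse using (g; h; ^ℚ-inverse)
    open Recursion x q xq≡1 ρ ρ-inverse using (p; p*h; t; H; H-zero; H-recursive; p*p*H)

    1÷₀^ : ∀ k → 1ℚ ÷₀ (q ^ℚ k) ≡ x ^ℚ k
    1÷₀^ k = trans (÷₀-unique 1ℚ (q ^ℚ k) (x ^ℚ k) (^ℚ-inverse k)) (*-identityˡ (x ^ℚ k))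

    poch-p : ∀ n → poch q n ≡ p n
    poch-p n = trans (cong prodQ (map-upTo (λ k → 1ℚ - (1ℚ ÷₀ (q ^ℚ suc k))) n)) (go n)
      where
      go : ∀ n → prodQ (applyUpTo (λ k → 1ℚ - (1ℚ ÷₀ (q ^ℚ suc k))) n) ≡ p n
      go zero    = refl
      go (suc n) = trans (prodQ-last n (λ k → 1ℚ - (1ℚ ÷₀ (q ^ℚ suc k))))
        (trans (cong₂ _*_ (go n) (cong (λ z → 1ℚ - z) (1÷₀^ (suc n)))) (*-comm (p n) (1ℚ - (x ^ℚ suc n))))

    ^ℤ-⊖ : ∀ m n → q ^ℤ (m ⊖ n) ≡ (q ^ℚ m) * (x ^ℚ n)
    ^ℤ-⊖ m       zero    = sym (*-identityʳ (q ^ℚ m))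
    ^ℤ-⊖ zero    (suc n) = trans (1÷₀^ (suc n)) (sym (*-identityˡ (x ^ℚ suc n)))
    ^ℤ-⊖ (suc m) (suc n) = begin
      q ^ℤ (suc m ⊖ suc n)                  ≡⟨ cong (q ^ℤ_) (ℤ.[1+m]⊖[1+n]≡m⊖n m n) ⟩
      q ^ℤ (m ⊖ n)                          ≡⟨ ^ℤ-⊖ m n ⟩
      (q ^ℚ m) * (x ^ℚ n)                   ≡⟨ *-identityˡ ((q ^ℚ m) * (x ^ℚ n)) ⟨
      1ℚ * ((q ^ℚ m) * (x ^ℚ n))            ≡⟨ cong (_* ((q ^ℚ m) * (x ^ℚ n))) qx≡1 ⟨
      q * x * ((q ^ℚ m) * (x ^ℚ n))         ≡⟨ rearrange q x (q ^ℚ m) (x ^ℚ n) ⟩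
      (q ^ℚ suc m) * (x ^ℚ suc n) ∎
      where
      rearrange : ∀ a b c d → a * b * (c * d) ≡ a * c * (b * d)
      rearrange = solve-∀ ℚ-ring

    ^ℤ-expo : ∀ κ n → sumℕ κ ≡ n → q ^ℤ expo κ ≡ (q ^ℚ (n ℕ.* n)) * ((x ^ℚ n) * ((x ^ℚ nλ κ) * (x ^ℚ nλ κ)))
    ^ℤ-expo κ n refl = begin
      q ^ℤ expo κ
        ≡⟨ cong (q ^ℤ_) merge ⟩
      q ^ℤ (n ℕ.* n ⊖ (n ℕ.+ 2 ℕ.* nλ κ))
        ≡⟨ ^ℤ-⊖ (n ℕ.* n) (n ℕ.+ 2 ℕ.* nλ κ) ⟩
      (q ^ℚ (n ℕ.* n)) * (x ^ℚ (n ℕ.+ 2 ℕ.* nλ κ))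
        ≡⟨ cong ((q ^ℚ (n ℕ.* n)) *_) (trans (^ℚ-+ x n (2 ℕ.* nλ κ)) (cong ((x ^ℚ n) *_)
             (trans (cong (λ z → x ^ℚ (nλ κ ℕ.+ z)) (ℕ.+-identityʳ (nλ κ))) (^ℚ-+ x (nλ κ) (nλ κ))))) ⟩
      (q ^ℚ (n ℕ.* n)) * ((x ^ℚ n) * ((x ^ℚ nλ κ) * (x ^ℚ nλ κ))) ∎
      where
      merge : expo κ ≡ n ℕ.* n ⊖ (n ℕ.+ 2 ℕ.* nλ κ)
      merge = begin
        ℤ.+ (n ℕ.* n) ℤ.- ℤ.+ n ℤ.- ℤ.+ (2 ℕ.* nλ κ)                  ≡⟨ ℤ.+-assoc (ℤ.+ (n ℕ.* n)) (ℤ.- (ℤ.+ n)) (ℤ.- (ℤ.+ (2 ℕ.* nλ κ))) ⟩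
        ℤ.+ (n ℕ.* n) ℤ.+ (ℤ.- (ℤ.+ n) ℤ.- ℤ.+ (2 ℕ.* nλ κ))          ≡⟨ cong (λ z → ℤ.+ (n ℕ.* n) ℤ.+ z) (ℤ.neg-distrib-+ (ℤ.+ n) (ℤ.+ (2 ℕ.* nλ κ))) ⟨
        ℤ.+ (n ℕ.* n) ℤ.- ℤ.+ (n ℕ.+ 2 ℕ.* nλ κ)                     ≡⟨ ℤ.m-n≡m⊖n (n ℕ.* n) (n ℕ.+ 2 ℕ.* nλ κ) ⟩
        n ℕ.* n ⊖ (n ℕ.+ 2 ℕ.* nλ κ) ∎

    hooks-g : ∀ κ → (x ^ℚ nλ κ) * ∏ ρ (hooks κ) ≡ g κ
    hooks-g []      = refl
    hooks-g (a ∷ κ) = begin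
      (x ^ℚ nλ (a ∷ κ)) * ∏ ρ (map f (upTo a) ++ hooks κ)
        ≡⟨ cong₂ _*_ (trans (cong (x ^ℚ_) (nλ-∷ a κ)) (^ℚ-+ x (sumℕ κ) (nλ κ))) (trans (∏-++ ρ (map f (upTo a)) (hooks κ)) (cong (λ l → ∏ ρ l * ∏ ρ (hooks κ)) (map-upTo f a))) ⟩
      (x ^ℚ sumℕ κ) * (x ^ℚ nλ κ) * (∏< ρ a f * ∏ ρ (hooks κ))
        ≡⟨ rearrange (x ^ℚ sumℕ κ) (x ^ℚ nλ κ) (∏< ρ a f) (∏ ρ (hooks κ)) ⟩
      (x ^ℚ sumℕ κ) * ∏< ρ a f * ((x ^ℚ nλ κ) * ∏ ρ (hooks κ))
        ≡⟨ cong ((x ^ℚ sumℕ κ) * ∏< ρ a f *_) (hooks-g κ) ⟩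
      g (a ∷ κ) ∎
      where
      f : ℕ → ℕ
      f j = (a ℕ.∸ j) ℕ.+ countGt j κ
      rearrange : ∀ a b c d → a * b * (c * d) ≡ a * c * (b * d)
      rearrange = solve-∀ ℚ-ring

    hook-product : ∀ {hs} → All (1 ℕ.≤_) hs → prodQ (map (λ k → sq (1ℚ - (1ℚ ÷₀ (q ^ℚ k)))) hs) * (∏ ρ hs * ∏ ρ hs) ≡ 1ℚ
    hook-product []                           = refl
    hook-product (_∷_ {suc k} {hs} _ all) = begin
      sq (1ℚ - (1ℚ ÷₀ (q ^ℚ suc k))) * P * (ρ (suc k) * R * (ρ (suc k) * R))
        ≡⟨ cong (λ z → sq (1ℚ - z) * P * (ρ (suc k) * R * (ρ (suc k) * R))) (1÷₀^ (suc k)) ⟩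
      (1ℚ - X) * (1ℚ - X) * P * (ρ (suc k) * R * (ρ (suc k) * R))
        ≡⟨ rearrange (1ℚ - X) P (ρ (suc k)) R ⟩
      (1ℚ - X) * ρ (suc k) * ((1ℚ - X) * ρ (suc k)) * (P * (R * R))
        ≡⟨ cong₂ (λ u v → u * u * v) (ρ-inverse k) (hook-product all) ⟩
      1ℚ * 1ℚ * 1ℚ
        ≡⟨⟩
      1ℚ ∎
      where
      X = x ^ℚ suc k
      P = prodQ (map (λ k → sq (1ℚ - (1ℚ ÷₀ (q ^ℚ k)))) hs)
      R = ∏ ρ hs
      rearrange : ∀ a p r s → a * a * p * (r * s * (r * s)) ≡ a * r * (a * r) * (p * (s * s))
      rearrange = solve-∀ ℚ-ring

    -- q^(n²-n) (x)_n². Its degree in q matches the palindrome: n² - n is twice n over 2, the top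
    -- degree of `total n`.
    prefactor : ℕ → ℚ
    prefactor n = (q ^ℚ (n ℕ.* n)) * (x ^ℚ n) * (p n * p n)

    Jλ-g : ∀ κ n → sumℕ κ ≡ n → Jλ κ q ≡ prefactor n * (g κ * g κ)
    Jλ-g κ n e = begin
      Jλ κ q
        ≡⟨ ÷₀-unique ((q ^ℤ expo κ) * sq (poch q (sumℕ κ))) (prodQ (map (λ k → sq (1ℚ - (1ℚ ÷₀ (q ^ℚ k)))) (hooks κ))) (R * R) (hook-product (hooks-positive κ)) ⟩
      (q ^ℤ expo κ) * sq (poch q (sumℕ κ)) * (R * R)
        ≡⟨ cong₂ (λ u v → u * sq v * (R * R)) (^ℤ-expo κ n e) (trans (cong (poch q) e) (poch-p n)) ⟩
      (q ^ℚ (n ℕ.* n)) * ((x ^ℚ n) * ((x ^ℚ nλ κ) * (x ^ℚ nλ κ))) * (p n * p n) * (R * R)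
        ≡⟨ rearrange (q ^ℚ (n ℕ.* n)) (x ^ℚ n) (x ^ℚ nλ κ) (p n) R ⟩
      prefactor n * ((x ^ℚ nλ κ) * R * ((x ^ℚ nλ κ) * R))
        ≡⟨ cong (λ z → prefactor n * (z * z)) (hooks-g κ) ⟩
      prefactor n * (g κ * g κ) ∎
      where
      R = ∏ ρ (hooks κ)
      rearrange : ∀ a b c d r → a * (b * (c * c)) * (d * d) * (r * r) ≡ a * b * (d * d) * (c * r * (c * r))
      rearrange = solve-∀ ℚ-ring

    J-H : ∀ n → J n q ≡ prefactor n * H n
    -- `J` at 0 is 1 by definition rather than a sum over partitions.
    J-H zero      = sym (trans (cong (1ℚ * 1ℚ * (1ℚ * 1ℚ) *_) H-zero) refl)
    J-H n@(suc _) = begin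
      sum-over (λ κ → Jλ κ q) (partitions n)
        ≡⟨ sum-over-filter (λ κ → Jλ κ q) (isPartitionOf n) (concatMap (λ k → listsOf k n) (upTo (suc n))) ⟩
      sum-over F (concatMap (λ k → listsOf k n) (upTo (suc n)))
        ≡⟨ trans (sum-over-concatMap F (λ k → listsOf k n) id (suc n)) (Σ<-ext (suc n) (λ k → sum-over-listsOf F k n)) ⟩
      Σ< (suc n) (λ k → ΣBox (suc n) k F)
        ≡⟨ Σ<-ext (suc n) (λ k → trans (ΣBox-ext (suc n) k F-weight) (ΣBox-* (suc n) k (prefactor n) (λ κ → ⟦ allPos κ ⟧ * weight n κ))) ⟩
      Σ< (suc n) (λ k → prefactor n * ΣBox (suc n) k (λ κ → ⟦ allPos κ ⟧ * weight n κ))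
        ≡⟨ Σ<-* (suc n) (prefactor n) (λ k → ΣBox (suc n) k (λ κ → ⟦ allPos κ ⟧ * weight n κ)) ⟩
      prefactor n * Σ< (suc n) (λ k → ΣBox (suc n) k (λ κ → ⟦ allPos κ ⟧ * weight n κ))
        -- Entries up to n and at most n rows accommodate every partition of n, so the box with m =
        -- n already gives the full Cauchy sum.
        ≡⟨ cong (prefactor n *_) (trans (sym (K-strip n n)) (K-unique H H-zero H-recursive n ℕ.≤-refl)) ⟩
      prefactor n * H n ∎
      where
      open CauchySum x q xq≡1 ρ ρ-inverse n using (weight; K-strip; K-unique)
      F : List ℕ → ℚ
      F κ = ⟦ isPartitionOf n κ ⟧ * Jλ κ q
      rearrange : ∀ s a d p y → s * (a * d) * (p * y) ≡ p * (a * (d * (s * y)))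
      rearrange = solve-∀ ℚ-ring
      F-weight : ∀ κ → F κ ≡ prefactor n * (⟦ allPos κ ⟧ * weight n κ)
      F-weight κ = begin
        ⟦ isPartitionOf n κ ⟧ * Jλ κ q
          ≡⟨ ⟦⟧-cong (isPartitionOf n κ) (λ t → Jλ-g κ n (ℕ.≡ᵇ⇒≡ (sumℕ κ) n (proj₁ (T-∧⁻ (sumℕ κ ≡ᵇ n) t)))) ⟩
        ⟦ isPartitionOf n κ ⟧ * (prefactor n * (g κ * g κ))
          ≡⟨ cong (_* (prefactor n * (g κ * g κ))) (trans (⟦⟧-∧ (sumℕ κ ≡ᵇ n) (allPos κ ∧ nonIncr κ))
               (cong (⟦ sumℕ κ ≡ᵇ n ⟧ *_) (trans (⟦⟧-∧ (allPos κ) (nonIncr κ)) (cong (λ b → ⟦ allPos κ ⟧ * ⟦ b ⟧) (nonIncr-decreasing κ))))) ⟩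
        ⟦ sumℕ κ ≡ᵇ n ⟧ * (⟦ allPos κ ⟧ * ⟦ decreasing? κ ⟧) * (prefactor n * (g κ * g κ))
          ≡⟨ rearrange ⟦ sumℕ κ ≡ᵇ n ⟧ ⟦ allPos κ ⟧ ⟦ decreasing? κ ⟧ (prefactor n) (g κ * g κ) ⟩
        prefactor n * (⟦ allPos κ ⟧ * weight n κ) ∎

    -- The Cauchy sum lives at x = 1/q whereas the statement evaluates at q; the palindromic
    -- coefficient list connects the two.
    total-at-q : ∀ n → evalPoly (total n) q ≡ (q ^ℚ (2 ℕ.* (n C 2))) * t n
    total-at-q n = begin
      e                                          ≡⟨ *-identityˡ e ⟨
      1ℚ * e                                     ≡⟨ cong (_* e) xq≡1 ⟨
      x * q * e                                  ≡⟨ *-assoc x q e ⟩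
      x * (q * e)                                ≡⟨ cong (λ c → x * (q * evalPoly c q)) (total-reverse n) ⟨
      x * (q * evalPoly (reverse (total n)) q) ≡⟨ cong (x *_) (evalPoly-reverse x q (total n) xq≡1) ⟩
      x * ((q ^ℚ length (total n)) * t n)        ≡⟨ cong (λ z → x * ((q ^ℚ z) * t n)) (trans (total-length n) (ℕ.+-comm (2 ℕ.* (n C 2)) 1)) ⟩
      x * (q * D * t n)                          ≡⟨ rearrange x q D (t n) ⟩
      x * q * (D * t n)                          ≡⟨ cong (_* (D * t n)) xq≡1 ⟩
      1ℚ * (D * t n)                             ≡⟨ *-identityˡ (D * t n) ⟩
      D * t n ∎
      where
      e = evalPoly (total n) q
      D = q ^ℚ (2 ℕ.* (n C 2))
      rearrange : ∀ a b c d → a * (b * c * d) ≡ a * b * (c * d)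
      rearrange = solve-∀ ℚ-ring

    J-total : ∀ n → J n q ≡ evalPoly (total n) q
    J-total n = begin
      J n q                                              ≡⟨ J-H n ⟩
      (q ^ℚ (n ℕ.* n)) * (x ^ℚ n) * (p n * p n) * H n    ≡⟨ *-assoc ((q ^ℚ (n ℕ.* n)) * (x ^ℚ n)) (p n * p n) (H n) ⟩
      (q ^ℚ (n ℕ.* n)) * (x ^ℚ n) * (p n * p n * H n)    ≡⟨ cong₂ (λ u v → u * (x ^ℚ n) * v) (trans (cong (q ^ℚ_) (n*n n)) (^ℚ-+ q (2 ℕ.* (n C 2)) n)) (p*p*H n) ⟩
      D * (q ^ℚ n) * (x ^ℚ n) * t n                      ≡⟨ rearrange D (q ^ℚ n) (x ^ℚ n) (t n) ⟩
      (q ^ℚ n) * (x ^ℚ n) * (D * t n)                    ≡⟨ cong (_* (D * t n)) (^ℚ-inverse n) ⟩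
      1ℚ * (D * t n)                                     ≡⟨ *-identityˡ (D * t n) ⟩
      D * t n                                            ≡⟨ total-at-q n ⟨
      evalPoly (total n) q ∎
      where
      D = q ^ℚ (2 ℕ.* (n C 2))
      rearrange : ∀ a b c d → a * b * c * d ≡ b * c * (a * d)
      rearrange = solve-∀ ℚ-ring

    open Limit x q xq≡1 ρ ρ-inverse (ℚ.<⇒≤ 0<x) 0≤ρ (q - 1ℚ) (0<-difference 1<q) (q≡1+[q-1] q) using (limit; converges)

    -- The divisor removes everything from `prefactor n` except x^n, and this is the scaling by
    -- which `limit` differs from `H`.
    J-limit : ∀ n → J n q ÷₀ ((q ^ℚ (n ℕ.* n)) * sq (poch q n)) ≡ limit n
    J-limit n = begin
      J n q ÷₀ (Q * sq (poch q n))                          ≡⟨ cong (λ z → J n q ÷₀ (Q * sq z)) (poch-p n) ⟩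
      J n q ÷₀ (Q * (p n * p n))                            ≡⟨ ÷₀-unique (J n q) (Q * (p n * p n)) (X * (h n * h n)) inverse ⟩
      J n q * (X * (h n * h n))                             ≡⟨ cong (_* (X * (h n * h n))) (J-H n) ⟩
      Q * (x ^ℚ n) * (p n * p n) * H n * (X * (h n * h n))  ≡⟨ rearrange₂ Q (x ^ℚ n) (p n) (H n) X (h n) ⟩
      Q * (p n * p n) * (X * (h n * h n)) * ((x ^ℚ n) * H n) ≡⟨ trans (cong (_* ((x ^ℚ n) * H n)) inverse) (*-identityˡ ((x ^ℚ n) * H n)) ⟩
      (x ^ℚ n) * H n                                        ≡⟨ cong (λ y → (y ^ℚ n) * H n) (*-identityʳ x) ⟨
      limit n ∎
      where
      Q = q ^ℚ (n ℕ.* n)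
      X = x ^ℚ (n ℕ.* n)
      rearrange₁ : ∀ a p b h → a * (p * p) * (b * (h * h)) ≡ a * b * (p * h * (p * h))
      rearrange₁ = solve-∀ ℚ-ring
      rearrange₂ : ∀ a y p c b h → a * y * (p * p) * c * (b * (h * h)) ≡ a * (p * p) * (b * (h * h)) * (y * c)
      rearrange₂ = solve-∀ ℚ-ring
      inverse : Q * (p n * p n) * (X * (h n * h n)) ≡ 1ℚ
      inverse = trans (rearrange₁ Q (p n) X (h n)) (trans (cong₂ (λ u v → u * (v * v)) (^ℚ-inverse (n ℕ.* n)) (p*h n)) refl)

    J-series : ∀ n → SeriesSum (λ N → fromℕ (coef n N) * (1ℚ ÷₀ (q ^ℚ N))) (J n q ÷₀ ((q ^ℚ (n ℕ.* n)) * sq (poch q n)))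
    J-series n = subst₂-SeriesSum (sym (J-limit n)) (λ N → cong (fromℕ (coef n N) *_) (sym (1÷₀^ N))) (converges n)
      where
      subst₂-SeriesSum : ∀ {a b : ℕ → ℚ} {L L′} → L ≡ L′ → (∀ N → a N ≡ b N) → SeriesSum a L → SeriesSum b L′
      subst₂-SeriesSum {a} {b} {L} refl e s ε 0<ε = proj₁ (s ε 0<ε) , λ M M≥ →
        subst (λ z → ∣ L - z ∣ < ε) (trans (sumQ-upTo M a) (trans (Σ<-ext M e) (sym (sumQ-upTo M b)))) (proj₂ (s ε 0<ε) M M≥)

open import Defs
open import Data.Nat using (ℕ; suc; _+_; _*_)
open import Data.Nat.Combinatorics using (_C_)
open import Data.List using (List; length; reverse; last)
open import Data.Maybe using (just)
open import Data.Rational using (ℚ; 1ℚ; _<_) renaming (_*_ to _ℚ*_)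
open import Data.Nat using (_!)
open import Data.Product using (Σ; ∃; _×_; _,_)
open import Relation.Binary.PropositionalEquality using (_≡_)
open Mahonian using (total; total-length; total-last; total-reverse; total-at-1)
open Evaluation using (module AtPoint)

theorem9 : (n : ℕ) →
    (Σ (List ℕ) λ c →
    (length c ≡ 2 * (n C 2) + 1)
    × (∃ λ k → last c ≡ just (suc k))
    × (reverse c ≡ c)
    × (evalPoly c 1ℚ ≡ fromℕ (n !))
    × ((q : ℚ) → 1ℚ < q → J n q ≡ evalPoly c q))
    × ((q : ℚ) → 1ℚ < q →
    SeriesSum (λ N → fromℕ (coef n N) ℚ* (1ℚ ÷₀ (q ^ℚ N)))
    (J n q ÷₀ ((q ^ℚ (n * n)) ℚ* sq (poch q n))))
theorem9 n =
    (total n , total-length n , total-last n , total-reverse n , total-at-1 n , λ q 1<q → AtPoint.J-total q 1<q n)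
  , λ q 1<q → AtPoint.J-series q 1<q n
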